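{- Let $(W_1,S_1)$ and $(W_2,S_2)$ be arbitrary Coxeter systems with identity elements $e_1$ and $e_2$, let $H_1\subseteq S_1$, $H_2\subseteq S_2$, and let $v_1\in W_1^{H_1}$, $v_2\in W_2^{H_2}$. Suppose there exists a poset isomorphism from the Bruhat interval $[e_1,v_1]$ to $[e_2,v_2]$ that restricts to a poset isomorphism from $[e_1,v_1]^{H_1}$ to $[e_2,v_2]^{H_2}$. Then, for each $x\in\{ -1,q\}$, $$P^{H_1,x}_{e_1,v_1}(q)=P^{H_2,x}_{e_2,v_2}(q)\quad\text{and}\quad R^{H_1,x}_{e_1,v_1}(q)=R^{H_2,x}_{e_2,v_2}(q).$$
   Context: For a Coxeter system $(W,S)$ with identity $e$ and length function $\ell$, $\le$ denotes Bruhat order, $[u,v]=\{z\in W: u\le z\le v\}$, $D_L(w)=\{s\in S:\ell(sw)<\ell(w)\}$, $D_R(w)=\{s\in S:\ell(ws)<\ell(w)\}$. For $H\subseteq S$, $W^H=\{w\in W: D_R(w)\subseteq S\setminus H\}$ and $[u,v]^H=[u,v]\cap W^H$. For $x\in\{ -1,q\}$, the parabolic Kazhdan–Lusztig $R$-polynomials $\{R^{H,x}_{u,v}(q)\}_{u,v\in W^H}\subseteq\mathbb Z[q]$ (Deodhar) are the unique family such that: $R^{H,x}_{u,v}=0$ if $u\not\le v$; $R^{H,x}_{u,u}=1$; and if $u<v$ and $s\in D_L(v)$, then $R^{H,x}_{u,v}=R^{H,x}_{su,sv}$ if $s\in D_L(u)$; $R^{H,x}_{u,v}=(q-1)R^{H,x}_{u,sv}+qR^{H,x}_{su,sv}$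 if $s\notin D_L(u)$ and $su\in W^H$; $R^{H,x}_{u,v}=(q-1-x)R^{H,x}_{u,sv}$ if $s\notin D_L(u)$ and $su\notin W^H$. The parabolic Kazhdan–Lusztig polynomials $\{P^{H,x}_{u,v}(q)\}_{u,v\in W^H}\subseteq\mathbb Z[q]$ are the unique family such that: $P^{H,x}_{u,v}=0$ if $u\not\le v$; $P^{H,x}_{u,u}=1$; $\deg P^{H,x}_{u,v}\le\frac12(\ell(v)-\ell(u)-1)$ if $u<v$; and $q^{\ell(v)-\ell(u)}P^{H,x}_{u,v}(1/q)=\sum_{z\in[u,v]^H}R^{H,x}_{u,z}(q)P^{H,x}_{z,v}(q)$. -}

module Defs where

open import Level using (0ℓ)
open import Data.Nat using (ℕ; zero; suc; _+_; _*_; _∸_; _≤_; _<_; _≤ᵇ_)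
open import Data.Integer as ℤ using (ℤ; 0ℤ; 1ℤ; -1ℤ)
open import Data.Bool using (if_then_else_)
open import Data.List using (List; []; _∷_; _++_; length; reverse; _∷ʳ_; foldr; map)
open import Data.List.Relation.Unary.All using (All)
open import Data.List.Relation.Unary.Any using (Any)
open import Data.List.Relation.Unary.AllPairs using (AllPairs)
open import Data.Product using (Σ; _×_; _,_)
open import Relation.Nullary using (¬_)
open import Relation.Binary.PropositionalEquality using (_≡_)

-- Polynomials in ℤ[q], represented by their coefficient sequences.
-- Equality is coefficientwise; membership in ℤ[q] (finite support)
-- is imposed separately where needed.

Poly : Set
Poly = ℕ → ℤ

_≈P_ : Poly → Poly → Set
f ≈P g = ∀ n → f n ≡ g n

infix 4 _≈P_
infixl 6 _+P_
infixl 7 _*P_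

FiniteSupport : Poly → Set
FiniteSupport f = Σ ℕ λ N → ∀ n → N ≤ n → f n ≡ 0ℤ

0P : Poly
0P _ = 0ℤ

1P : Poly
1P zero    = 1ℤ
1P (suc _) = 0ℤ

qP : Poly
qP (suc zero) = 1ℤ
qP _          = 0ℤ

constP : ℤ → Poly
constP c zero    = c
constP c (suc _) = 0ℤ

_+P_ : Poly → Poly → Poly
(f +P g) n = f n ℤ.+ g n

-P_ : Poly → Poly
(-P f) n = ℤ.- (f n)

convAux : Poly → Poly → ℕ → ℕ → ℤ
convAux f g n zero    = f 0 ℤ.* g n
convAux f g n (suc i) = f (suc i) ℤ.* g (n ∸ suc i) ℤ.+ convAux f g n i

_*P_ : Poly → Poly → Poly
(f *P g) n = convAux f g n n

qm1 : Poly
qm1 = qP +P constP -1ℤ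

sumP : List Poly → Poly
sumP = foldr _+P_ 0P

-- q^d · f(1/q)  (for f of degree ≤ d)
revP : ℕ → Poly → Poly
revP d f n = if n ≤ᵇ d then f (d ∸ n) else 0ℤ

data XParam : Set where
  x=-1 x=q : XParam

xPoly : XParam → Poly
xPoly x=-1 = constP -1ℤ
xPoly x=q  = qP

-- Coxeter systems, given by a Coxeter matrix on an arbitrary set S.
-- m s t = 0 encodes m(s,t) = ∞.

record CoxeterSystem : Set₁ where
  field
    S     : Set
    m     : S → S → ℕ
    m-diag : ∀ s → m s s ≡ 1
    m-sym  : ∀ s t → m s t ≡ m t s
    m-off  : ∀ s t → ¬ (s ≡ t) → ¬ (m s t ≡ 1)

module Coxeter (C : CoxeterSystem) where
  open CoxeterSystem C public

  -- elements of W are represented by words in S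
  Word : Set
  Word = List S

  e : Word
  e = []

  alt : S → S → ℕ → Word
  alt s t zero    = []
  alt s t (suc n) = s ∷ alt t s n

  -- equality in W = ⟨ S | (st)^{m(s,t)} = e ⟩ : congruence generated by
  -- the defining relators
  data _≈W_ : Word → Word → Set where
    ≈refl  : ∀ {a} → a ≈W a
    ≈sym   : ∀ {a b} → a ≈W b → b ≈W a
    ≈trans : ∀ {a b c} → a ≈W b → b ≈W c → a ≈W c
    relator : ∀ a c s t k → m s t ≡ suc k →
              (a ++ alt s t (2 * suc k) ++ c) ≈W (a ++ c)

  infix 4 _≈W_

  Len : Word → ℕ → Set
  Len w k = Σ Word (λ w' → w' ≈W w × length w' ≡ k)
          × (∀ w' → w' ≈W w → k ≤ length w')

  Shorter : Word → Word → Set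
  Shorter a b = Σ Word λ a' → a' ≈W a × (∀ b' → b' ≈W b → length a' < length b')

  DL : S → Word → Set
  DL s w = Shorter (s ∷ w) w

  DR : S → Word → Set
  DR s w = Shorter (w ∷ʳ s) w

  -- reflections T = { w s w⁻¹ }  (w⁻¹ is the reversed word)
  refl-word : Word → S → Word
  refl-word w s = w ++ s ∷ reverse w

  data _≤B_ (u : Word) : Word → Set where
    base : ∀ {v} → u ≈W v → u ≤B v
    step : ∀ {v v'} w s → u ≤B v → Shorter v (v ++ refl-word w s) →
           v' ≈W (v ++ refl-word w s) → u ≤B v'

  infix 4 _≤B_

  _<B_ : Word → Word → Set
  u <B v = u ≤B v × ¬ (u ≈W v)

  InInterval : Word → Word → Word → Set
  InInterval u v z = u ≤B z × z ≤B v

  module Parabolic (H : S → Set) where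

    InWH : Word → Set
    InWH w = ∀ s → H s → ¬ DR s w

    EnumIntervalH : Word → Word → List Word → Set
    EnumIntervalH u v L =
        All (λ z → InInterval u v z × InWH z) L
      × (∀ z → InInterval u v z → InWH z → Any (λ z' → z ≈W z') L)
      × AllPairs (λ a b → ¬ (a ≈W b)) L

    record IsParabolicR (x : XParam) (R : Word → Word → Poly) : Set where
      field
        finite   : ∀ u v → FiniteSupport (R u v)
        respects : ∀ u u' v v' → u ≈W u' → v ≈W v' → R u v ≈P R u' v'
        r-zero   : ∀ u v → InWH u → InWH v → ¬ (u ≤B v) → R u v ≈P 0P
        r-one    : ∀ u → InWH u → R u u ≈P 1P
        r-desc   : ∀ u v s → InWH u → InWH v → u <B v → DL s v → DL s u →
                   R u v ≈P R (s ∷ u) (s ∷ v)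
        r-asc-in : ∀ u v s → InWH u → InWH v → u <B v → DL s v → ¬ DL s u →
                   InWH (s ∷ u) →
                   R u v ≈P qm1 *P R u (s ∷ v) +P qP *P R (s ∷ u) (s ∷ v)
        r-asc-out : ∀ u v s → InWH u → InWH v → u <B v → DL s v → ¬ DL s u →
                   ¬ InWH (s ∷ u) →
                   R u v ≈P (qm1 +P (-P xPoly x)) *P R u (s ∷ v)

    record IsParabolicP (R : Word → Word → Poly) (P : Word → Word → Poly) : Set where
      field
        finite   : ∀ u v → FiniteSupport (P u v)
        respects : ∀ u u' v v' → u ≈W u' → v ≈W v' → P u v ≈P P u' v'
        p-zero   : ∀ u v → InWH u → InWH v → ¬ (u ≤B v) → P u v ≈P 0P
        p-one    : ∀ u → InWH u → P u u ≈P 1P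
        p-deg    : ∀ u v lu lv → InWH u → InWH v → u <B v → Len u lu → Len v lv →
                   ∀ n → lv ∸ lu ≤ 2 * n → P u v n ≡ 0ℤ
        p-inv    : ∀ u v lu lv L → InWH u → InWH v → u ≤B v → Len u lu → Len v lv →
                   EnumIntervalH u v L →
                   revP (lv ∸ lu) (P u v) ≈P sumP (map (λ z → R u z *P P z v) L)

record IntervalIso (C₁ C₂ : CoxeterSystem)
                   (H₁ : CoxeterSystem.S C₁ → Set) (H₂ : CoxeterSystem.S C₂ → Set)
                   (v₁ : List (CoxeterSystem.S C₁)) (v₂ : List (CoxeterSystem.S C₂)) : Set where
  private
    module W₁ = Coxeter C₁
    module W₂ = Coxeter C₂
    module P₁ = W₁.Parabolic H₁
    module P₂ = W₂.Parabolic H₂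
    I₁ = W₁.InInterval W₁.e v₁
    I₂ = W₂.InInterval W₂.e v₂
  field
    f        : W₁.Word → W₂.Word
    f-resp   : ∀ a b → a W₁.≈W b → f a W₂.≈W f b
    f-into   : ∀ a → I₁ a → I₂ (f a)
    f-inj    : ∀ a b → I₁ a → I₁ b → f a W₂.≈W f b → a W₁.≈W b
    f-surj   : ∀ b → I₂ b → Σ W₁.Word λ a → I₁ a × f a W₂.≈W b
    f-mono   : ∀ a b → I₁ a → I₁ b → a W₁.≤B b → f a W₂.≤B f b
    f-refl   : ∀ a b → I₁ a → I₁ b → f a W₂.≤B f b → a W₁.≤B b
    f-para   : ∀ a → I₁ a → P₁.InWH a → P₂.InWH (f a)
    f-para⁻¹ : ∀ a → I₁ a → P₂.InWH (f a) → P₁.InWH a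

{-# OPTIONS --safe #-}
module Submission where

-- Multiplication by a descent s of v is a special matching M of the Bruhat interval below v, and
-- the ordinary R-polynomials satisfy R v = T M (R (M v)), where T M is the Hecke operator of M.
-- The point is that every special matching of a lower interval calculates them in this way, so
-- that they only depend on the poset. Two special matchings with different values at v are
-- compared on the orbits of the dihedral group they generate: on orbits of the size of that of v
-- their operators satisfy the braid relation, and elsewhere they agree by induction, applied to
-- the matching which is one of the two on orbits of that size and the other off them. That this
-- mixture is again special rests on the absence of K₃,₂ in the cover graph of Bruhat order, which
-- comes from the canonical generators of reflection subgroups.
-- For u ∈ W^H the parabolic R-polynomial is the sum of (−x)^(ℓ(z) − ℓ(u)) R v z over z ∈ u W_H,
-- and z ∈ u W_H means that u is the largest element of W^H below z, a condition on the poset and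
-- W^H alone. The P-polynomials are then determined by the degree bound.

-- A poset isomorphism need not carry multiplication by a generator to multiplication by a
-- generator. What it does carry over is the notion of special matching, so the recursion has to be
-- proved for all special matchings, including those that come from no generator: `R` is defined by
-- multiplications in the first system, and those of the second then appear as further special
-- matchings of the same finite poset. The second obstacle is constructive. The recursion for P asks
-- for a list of an interval that is complete for every word, so equality in W has to be decided,
-- although equality of generators is not. The only data at hand are the numbers `m s t`, where the
-- value 1 marks equal generators; the division algorithm uses nothing else. Its completeness needs
-- that s t has order exactly `m s t`. The usual proof uses the real numbers 2 cos (π / m); here
-- they are replaced by adjacency operators of paths acting on integer sequences, because equations
-- between integers are stable under double negation.

open import Defs
open import Data.Nat as ℕ using (ℕ; zero; suc; _≤_; _<_; z≤n; s≤s; _<?_; NonZero)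
import Data.Nat.Properties as ℕ
open import Data.Nat.Induction using (<-wellFounded)
open import Induction.WellFounded using (Acc; acc)
open import Data.Bool as Bool using (Bool; true; false; not; _xor_)
import Data.Bool.Properties as Bool
open import Data.Fin as Fin using (Fin; #_)
import Data.Fin.Properties as Fin
open import Data.Fin.Permutation using (permutation)
open import Data.Integer as ℤ using (ℤ; 0ℤ)
import Data.Integer.Properties as ℤ
open import Data.Integer.Tactic.RingSolver using (solve-∀)
open import Data.List hiding (find; sum)
open import Data.Product hiding (map)
open import Data.Sum hiding (map)
open import Data.Empty
open import Data.Unit using (⊤; tt)
open import Function using (id; case_of_)
open import Relation.Nullary
open import Relation.Nullary.Decidable using (decidable-stable; _×-dec_; _⊎-dec_; _→-dec_; ¬?)
open import Relation.Binary.Definitions using (tri<; tri≈; tri>)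
open import Relation.Binary.PropositionalEquality hiding ([_])

-- Polynomials

module Polynomials where
  open import Data.Integer using (ℤ; 0ℤ; 1ℤ; _+_; _-_; -_; _*_)
  open import Data.Fin using (zero; suc)
  open import Algebra.Properties.CommutativeMonoid.Sum ℤ.+-0-commutativeMonoid
    using (sum; sum-cong-≗; ∑-distrib-+; sum-permute)

  shift : Poly → Poly
  shift f zero    = 0ℤ
  shift f (suc n) = f n

  -- (q − 1) f + q g
  mix : Poly → Poly → Poly
  mix f g n = shift f n - f n + shift g n

  ≈P-sym : ∀ {f g} → f ≈P g → g ≈P f
  ≈P-sym h n = sym (h n)

  ≈P-trans : ∀ {f g h} → f ≈P g → g ≈P h → f ≈P h
  ≈P-trans p r n = trans (p n) (r n)

  ≡⇒≈P : ∀ {f g : Poly} → f ≡ g → f ≈P g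
  ≡⇒≈P refl n = refl

  shift-cong : ∀ {f g} → f ≈P g → shift f ≈P shift g
  shift-cong h zero    = refl
  shift-cong h (suc n) = h n

  mix-cong : ∀ {f f' g g'} → f ≈P f' → g ≈P g' → mix f g ≈P mix f' g'
  mix-cong p r n = cong₂ _+_ (cong₂ _-_ (shift-cong p n) (p n)) (shift-cong r n)

  mix-0 : mix 0P 0P ≈P 0P
  mix-0 zero    = refl
  mix-0 (suc n) = refl

  -- Both sides are (q - 1)² a + (q - 1) q (b + c) + q² d. This makes the operators `T M` commute
  -- with `mix`, see `T-mix`.
  mix-interchange : ∀ a b c d → mix (mix a b) (mix c d) ≈P mix (mix a c) (mix b d)
  mix-interchange a b c d zero = lemma (a 0)
    where
    lemma : ∀ a₀ → 0ℤ - (0ℤ - a₀ + 0ℤ) + 0ℤ ≡ 0ℤ - (0ℤ - a₀ + 0ℤ) + 0ℤ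
    lemma _ = refl
  mix-interchange a b c d (suc n) =
    lemma (shift a n) (shift b n) (shift c n) (shift d n) (a n) (b n) (c n) (a (suc n))
    where
    lemma : ∀ sa sb sc sd a₀ b₀ c₀ a₁ →
      (sa - a₀ + sb) - (a₀ - a₁ + b₀) + (sc - c₀ + sd) ≡
      (sa - a₀ + sc) - (a₀ - a₁ + c₀) + (sb - b₀ + sd)
    lemma = solve-∀

  n≡0⊎0<n : ∀ n → n ≡ 0 ⊎ 1 ≤ n
  n≡0⊎0<n zero    = inj₁ refl
  n≡0⊎0<n (suc n) = inj₂ (s≤s z≤n)

  -- Antisymmetry and monotonicity of the rank are both contained in `⊑-cases`; `up-cover` refines
  -- every relation to a chain of steps of rank one. The carrier is `Fin N` so that searches are
  -- decidable.
  record FiniteGradedPoset (N : ℕ) : Set₁ where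
    field
      _⊑_      : Fin N → Fin N → Set
      _⊑?_     : ∀ x y → Dec (x ⊑ y)
      ⊑-refl   : ∀ x → x ⊑ x
      ⊑-trans  : ∀ {x y z} → x ⊑ y → y ⊑ z → x ⊑ z
      rk       : Fin N → ℕ
      ⊑-cases  : ∀ {x y} → x ⊑ y → x ≡ y ⊎ rk x < rk y
      up-cover : ∀ {x y} → x ⊑ y → ¬ x ≡ y → ∃ λ z → (x ⊑ z × rk z ≡ suc (rk x)) × z ⊑ y


  convAux-cong : ∀ {f f' g g'} → f ≈P f' → g ≈P g' → ∀ n i → convAux f g n i ≡ convAux f' g' n i
  convAux-cong p q n zero    = cong₂ _*_ (p 0) (q n)
  convAux-cong p q n (suc i) = cong₂ _+_ (cong₂ _*_ (p (suc i)) (q (n ℕ.∸ suc i))) (convAux-cong p q n i)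

  *P-cong : ∀ {f f' g g'} → f ≈P f' → g ≈P g' → f *P g ≈P f' *P g'
  *P-cong p q n = convAux-cong p q n n

  +P-cong : ∀ {f f' g g'} → f ≈P f' → g ≈P g' → f +P g ≈P f' +P g'
  +P-cong p q n = cong₂ _+_ (p n) (q n)

  1P-*P : ∀ f → 1P *P f ≈P f
  1P-*P f n = go n
    where
    go : ∀ i → convAux 1P f n i ≡ f n
    go zero    = ℤ.*-identityˡ (f n)
    go (suc i) = trans (ℤ.+-identityˡ _) (go i)

  convAux-linear : ∀ {f} → (∀ j → f (2 ℕ.+ j) ≡ 0ℤ) → ∀ g n i →
                   convAux f g n (suc i) ≡ f 1 * g (n ℕ.∸ 1) + f 0 * g n
  convAux-linear z g n zero    = refl
  convAux-linear {f} z g n (suc i) = trans (cong (_+ convAux f g n (suc i)) (cong (_* g (n ℕ.∸ suc (suc i))) (z i)))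
    (trans (ℤ.+-identityˡ _) (convAux-linear {f} z g n i))

  linear-*P : ∀ {f} → (∀ j → f (2 ℕ.+ j) ≡ 0ℤ) → ∀ g n → (f *P g) n ≡ f 1 * shift g n + f 0 * g n
  linear-*P {f} z g zero    = sym (trans (cong (_+ f 0 * g 0) (ℤ.*-zeroʳ (f 1))) (ℤ.+-identityˡ _))
  linear-*P {f} z g (suc n) = convAux-linear {f} z g (suc n) n

  mix-*P : ∀ f g → qm1 *P f +P qP *P g ≈P mix f g
  mix-*P f g n = trans (cong₂ _+_ (linear-*P {qm1} (λ _ → refl) f n) (linear-*P {qP} (λ _ → refl) g n)) (lem (shift f n) (f n) (shift g n) (g n))
    where
    lem : ∀ a b c d → (1ℤ * a + ℤ.-1ℤ * b) + (1ℤ * c + 0ℤ * d) ≡ a - b + c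
    lem = solve-∀

  -- multiplication by −x and by q − 1 − x
  E G : XParam → Poly → Poly
  E x=-1 f   = f
  E x=q  f n = - shift f n
  G x=-1 f   = shift f
  G x=q  f n = - f n

  G-*P : ∀ x f → (qm1 +P (-P xPoly x)) *P f ≈P G x f
  G-*P x=-1 f n = trans (linear-*P {qm1 +P (-P xPoly x=-1)} (λ _ → refl) f n) (lem (shift f n) (f n))
    where
    lem : ∀ a b → 1ℤ * a + 0ℤ * b ≡ a
    lem = solve-∀
  G-*P x=q f n = trans (linear-*P {qm1 +P (-P xPoly x=q)} (λ _ → refl) f n) (lem (shift f n) (f n))
    where
    lem : ∀ a b → 0ℤ * a + ℤ.-1ℤ * b ≡ - b
    lem = solve-∀

  E-cong : ∀ x {f g} → f ≈P g → E x f ≈P E x g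
  E-cong x=-1 h = h
  E-cong x=q  h n = cong -_ (shift-cong h n)

  G-cong : ∀ x {f g} → f ≈P g → G x f ≈P G x g
  G-cong x=-1 h = shift-cong h
  G-cong x=q  h n = cong -_ (h n)

  E-mix : ∀ x f g → E x (mix f g) ≈P mix (E x f) (E x g)
  E-mix x=-1 f g n = refl
  E-mix x=q f g zero = refl
  E-mix x=q f g (suc zero) = lem (f 0)
    where
    lem : ∀ a → - (0ℤ - a + 0ℤ) ≡ 0ℤ - (- a) + 0ℤ
    lem = solve-∀
  E-mix x=q f g (suc (suc n)) = lem (f n) (f (suc n)) (g n)
    where
    lem : ∀ a b c → - (a - b + c) ≡ - a - (- b) + - c
    lem = solve-∀

  -- q − 1 + E = G and q = G E, for the two values of x
  mix-E : ∀ x f g → mix f g +P E x f ≈P G x f +P G x (E x g)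
  mix-E x=-1 f g n = lem (shift f n) (f n) (shift g n)
    where
    lem : ∀ a b c → (a - b + c) + b ≡ a + c
    lem = solve-∀
  mix-E x=q f g n = lem (shift f n) (f n) (shift g n)
    where
    lem : ∀ a b c → (a - b + c) + - a ≡ - b + - - c
    lem = solve-∀

  E^ : XParam → ℕ → Poly → Poly
  E^ x zero    f = f
  E^ x (suc k) f = E x (E^ x k f)

  E^-cong : ∀ x k {f g} → f ≈P g → E^ x k f ≈P E^ x k g
  E^-cong x zero    h = h
  E^-cong x (suc k) h = E-cong x (E^-cong x k h)

  E^-mix : ∀ x k f g → E^ x k (mix f g) ≈P mix (E^ x k f) (E^ x k g)
  E^-mix x zero    f g = λ _ → refl
  E^-mix x (suc k) f g = ≈P-trans (E-cong x (E^-mix x k f g)) (E-mix x (E^ x k f) (E^ x k g))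

  E-0 : ∀ x → E x 0P ≈P 0P
  E-0 x=-1 n = refl
  E-0 x=q zero = refl
  E-0 x=q (suc n) = refl

  G-0 : ∀ x → G x 0P ≈P 0P
  G-0 x=-1 zero = refl
  G-0 x=-1 (suc n) = refl
  G-0 x=q n = refl

  E^-0 : ∀ x k → E^ x k 0P ≈P 0P
  E^-0 x zero    = λ _ → refl
  E^-0 x (suc k) = ≈P-trans (E-cong x (E^-0 x k)) (E-0 x)

  ΣP : ∀ {n} → (Fin n → Poly) → Poly
  ΣP f k = sum (λ i → f i k)

  ΣP-cong : ∀ {n} {f g : Fin n → Poly} → (∀ i → f i ≈P g i) → ΣP f ≈P ΣP g
  ΣP-cong h k = sum-cong-≗ (λ i → h i k)

  sum-0 : ∀ n → sum {n} (λ _ → 0ℤ) ≡ 0ℤ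
  sum-0 zero    = refl
  sum-0 (suc n) = trans (ℤ.+-identityˡ _) (sum-0 n)

  ΣP-0 : ∀ {n} {f : Fin n → Poly} → (∀ i → f i ≈P 0P) → ΣP f ≈P 0P
  ΣP-0 {n} h k = trans (sum-cong-≗ (λ i → h i k)) (sum-0 n)

  ΣP-single : ∀ {n} {f : Fin n → Poly} i → (∀ j → ¬ j ≡ i → f j ≈P 0P) → ΣP f ≈P f i
  ΣP-single {suc n} {f} zero h k = trans (cong (f zero k +_) (trans (sum-cong-≗ (λ j → h (suc j) (λ ()) k)) (sum-0 n))) (ℤ.+-identityʳ _)
  ΣP-single {suc n} {f} (suc i) h k = trans (cong₂ _+_ (h zero (λ ()) k) (ΣP-single {n} {λ j → f (suc j)} i (λ j ne → h (suc j) (λ e → ne (Fin.suc-injective e))) k)) (ℤ.+-identityˡ _)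

  ΣP-shift : ∀ {n} (f : Fin n → Poly) → ΣP (λ i → shift (f i)) ≈P shift (ΣP f)
  ΣP-shift {n} f zero    = sum-0 n
  ΣP-shift {n} f (suc k) = refl

  sum-neg : ∀ {n} (f : Fin n → ℤ) → sum (λ i → - f i) ≡ - sum f
  sum-neg {zero}  f = refl
  sum-neg {suc n} f = trans (cong (- f zero +_) (sum-neg (λ i → f (suc i)))) (sym (ℤ.neg-distrib-+ (f zero) _))

  ΣP-mix : ∀ {n} (f g : Fin n → Poly) → ΣP (λ i → mix (f i) (g i)) ≈P mix (ΣP f) (ΣP g)
  ΣP-mix f g k = trans (∑-distrib-+ (λ i → shift (f i) k - f i k) (λ i → shift (g i) k))
    (cong₂ _+_ (trans (∑-distrib-+ (λ i → shift (f i) k) (λ i → - f i k)) (cong₂ _+_ (ΣP-shift f k) (sum-neg (λ i → f i k)))) (ΣP-shift g k))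

  ΣP-G : ∀ {n} x (f : Fin n → Poly) → ΣP (λ i → G x (f i)) ≈P G x (ΣP f)
  ΣP-G x=-1 f = ΣP-shift f
  ΣP-G x=q  f k = sum-neg (λ i → f i k)

  ΣP-reindex : ∀ {n} (f : Fin n → Poly) (M : Fin n → Fin n) → (∀ i → M (M i) ≡ i) → ΣP f ≈P ΣP (λ i → f (M i))
  ΣP-reindex f M inv k = sum-permute (λ i → f i k) (permutation M M inv inv)

  halve : ∀ {a b : ℤ} → a + a ≡ b + b → a ≡ b
  halve {a} {b} e = ℤ.*-cancelˡ-≡ (ℤ.+ 2) a b (trans (lem a) (trans e (sym (lem b))))
    where
    lem : ∀ a → ℤ.+ 2 * a ≡ a + a
    lem = solve-∀

  -- Adding over all i counts every pair twice, so the sums agree after doubling. This avoids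
  -- choosing one element of each pair and treats fixed points of `M` alike.
  ΣP-pairs : ∀ {n} (f g : Fin n → Poly) (M : Fin n → Fin n) → (∀ i → M (M i) ≡ i) →
             (∀ i → f i +P f (M i) ≈P g i +P g (M i)) → ΣP f ≈P ΣP g
  ΣP-pairs f g M inv h k = halve (trans (twice f) (trans (sum-cong-≗ (λ i → h i k)) (sym (twice g))))
    where
    twice : ∀ f → ΣP f k + ΣP f k ≡ sum (λ i → f i k + f (M i) k)
    twice f = trans (cong (ΣP f k +_) (ΣP-reindex f M inv k)) (sym (∑-distrib-+ (λ i → f i k) (λ i → f (M i) k)))

  revP-≤ : ∀ d f n → n ℕ.≤ d → revP d f n ≡ f (d ℕ.∸ n)
  revP-≤ d f n l with n ℕ.≤ᵇ d in eq
  ... | true  = refl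
  ... | false = ⊥-elim (subst Bool.T eq (ℕ.≤⇒≤ᵇ l))

  -- f − g is fixed by revP d and vanishes from degree d/2 on.
  low-degree-unique : ∀ d {f g h₁ h₂} → revP d f ≈P f +P h₁ → revP d g ≈P g +P h₂ → h₁ ≈P h₂ →
    (∀ n → d ℕ.≤ 2 ℕ.* n → f n ≡ 0ℤ) → (∀ n → d ℕ.≤ 2 ℕ.* n → g n ≡ 0ℤ) → f ≈P g
  low-degree-unique d {f} {g} {h₁} {h₂} p q h zf zg n with d ℕ.≤? 2 ℕ.* n
  ... | yes l = trans (zf n l) (sym (zg n l))
  ... | no nl = trans (lem (f n) (h₁ n)) (trans (cong₂ _-_ (trans (sym (p n)) (trans (trans (revP-≤ d f n n≤d) (trans (zf (d ℕ.∸ n) big) (sym (zg (d ℕ.∸ n) big))))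
                  (trans (sym (revP-≤ d g n n≤d)) (q n)))) (h n)) (sym (lem (g n) (h₂ n))))
    where
    lem : ∀ a b → a ≡ (a + b) - b
    lem = solve-∀
    2n<d : 2 ℕ.* n ℕ.< d
    2n<d = ℕ.≰⇒> nl
    n≤d : n ℕ.≤ d
    n≤d = ℕ.≤-trans (ℕ.m≤m+n n _) (ℕ.<⇒≤ 2n<d)
    big : d ℕ.≤ 2 ℕ.* (d ℕ.∸ n)
    big = ℕ.≤-trans (ℕ.≤-reflexive (sym (ℕ.m∸n+n≡m n≤d))) (ℕ.≤-trans (ℕ.+-monoʳ-≤ (d ℕ.∸ n) n≤d-n)
            (ℕ.≤-reflexive (cong (d ℕ.∸ n ℕ.+_) (sym (ℕ.+-identityʳ _)))))
      where
      n≤d-n : n ℕ.≤ d ℕ.∸ n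
      n≤d-n = ℕ.m+n≤o⇒m≤o∸n n (ℕ.≤-trans (ℕ.≤-reflexive (cong (n ℕ.+_) (sym (ℕ.+-identityʳ n)))) (ℕ.<⇒≤ 2n<d))

-- The discrete wave equation

module Waves where
  open import Data.Nat.DivMod using (_/_; _%_; [m+kn]%n≡m%n; m<n⇒m%n≡m; m<n⇒m/n≡0; m*n/n≡m; +-distrib-/-∣ʳ; m≡m%n+[m/n]*n; m%n<n)
  open import Data.Nat.Divisibility using (n∣m*n)
  open import Data.Integer using (ℤ; 0ℤ; 1ℤ; _+_; _-_; -_)

  stableℤ : ∀ {a b : ℤ} → ¬ ¬ (a ≡ b) → a ≡ b
  stableℤ = decidable-stable (_ ℤ.≟ _)

  double-zero : ∀ {a} → a ≡ - a → a ≡ 0ℤ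
  double-zero {ℤ.+ zero} e = refl

  -- Solutions of the discrete wave equation on a path with the wall condition X n 0 = 0.
  module Wave (X : ℕ → ℕ → ℤ) (wall : ∀ n → X n 0 ≡ 0ℤ) where

    -- The equation at the site `suc j`, whose neighbours are `j` and `2 + j`; with this shift the
    -- wall 0 is never itself a site.
    WaveAt : ℕ → Set
    WaveAt j = ∀ n → X (2 ℕ.+ n) (suc j) + X n (suc j) ≡ X (1 ℕ.+ n) j + X (1 ℕ.+ n) (2 ℕ.+ j)

    module Front (reg : ∀ j → WaveAt j ⊎ (∀ n → X n (suc j) ≡ 0ℤ))
      (x₀ : ∀ j → X 0 j ≡ 0ℤ) (x₁₁ : X 1 1 ≡ 1ℤ) (x₁ : ∀ j → X 1 (2 ℕ.+ j) ≡ 0ℤ) where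

      Ahead : ℕ → Set
      Ahead n = ∀ {j} → n < j → X n j ≡ 0ℤ

      -- The equation has second order in time, so two consecutive times are carried along. The
      -- second alternative of `reg` is for the sites on and beyond another wall.
      ahead₂ : ∀ n → Ahead n × Ahead (suc n)
      ahead₂ zero = (λ {j} _ → x₀ j) , λ { {suc (suc j)} _ → x₁ j ; {suc zero} (s≤s ()) }
      ahead₂ (suc n) = proj₂ (ahead₂ n) , λ { {suc j} (s≤s l) → by (reg j) l }
        where
        lemma : ∀ a b → a ≡ (a + b) - b
        lemma = solve-∀
        by : ∀ {j} → WaveAt j ⊎ (∀ n → X n (suc j) ≡ 0ℤ) → suc n < j → X (2 ℕ.+ n) (suc j) ≡ 0ℤ
        by (inj₂ z) l = z (suc (suc n))
        by {j} (inj₁ w) l = trans (lemma (X (suc (suc n)) (suc j)) (X n (suc j)))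
             (cong₂ _-_ (trans (w n) (cong₂ _+_ (proj₂ (ahead₂ n) l) (proj₂ (ahead₂ n) (ℕ.m≤n⇒m≤1+n (ℕ.m≤n⇒m≤1+n l)))))
                        (proj₁ (ahead₂ n) (ℕ.m≤n⇒m≤1+n (ℕ.<⇒≤ l))))

      ahead : ∀ n {j} → n < j → X n j ≡ 0ℤ
      ahead n = proj₁ (ahead₂ n)

      -- At the site n + 2 and the times n and n + 2, two of the four terms of the equation are
      -- ahead of the front and vanish, so the value 1 moves one site per step.
      front : ∀ n → (∀ j → j ≤ n → WaveAt j) → X (suc n) (suc n) ≡ 1ℤ
      front zero w = x₁₁
      front (suc n) w = trans (lemma (X (2 ℕ.+ n) (2 ℕ.+ n)) (X n (2 ℕ.+ n)))
          (cong₂ _-_ (trans (w (suc n) ℕ.≤-refl n) (cong₂ _+_ (front n λ j l → w j (ℕ.m≤n⇒m≤1+n l))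
                                              (ahead (suc n) (ℕ.m≤n⇒m≤1+n ℕ.≤-refl))))
                     (ahead n (ℕ.n≤1+n (suc n))))
        where
        lemma : ∀ a b → a ≡ (a + b) - b
        lemma = solve-∀

    module Periodic (m : ℕ) (wave : ∀ j → suc j < m → WaveAt j) (wallᵐ : ∀ n → X n m ≡ 0ℤ) (1<m : 1 < m) where

      -- X (n + 1) i − X n (i + 1) is constant along the characteristic (n + k , i + k).
      characteristic : ∀ j n → suc j ≤ m → X (suc (j ℕ.+ n)) j - X (j ℕ.+ n) (suc j) ≡ - X n 1
      characteristic zero n l = trans (cong (_- X n 1) (wall (suc n))) (ℤ.+-identityˡ _)
      characteristic (suc j) n l = trans (lemma (X (2 ℕ.+ (j ℕ.+ n)) (suc j)) (X (j ℕ.+ n) (suc j)) (X (1 ℕ.+ (j ℕ.+ n)) j) (X (1 ℕ.+ (j ℕ.+ n)) (2 ℕ.+ j)) (wave j l (j ℕ.+ n)))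
                                         (characteristic j n (ℕ.<⇒≤ l))
        where
        lem : ∀ a b c d → a - d ≡ (c - b) + ((a + b) - (c + d))
        lem = solve-∀
        lemma : ∀ a b c d → a + b ≡ c + d → a - d ≡ c - b
        lemma a b c d e = trans (lem a b c d) (trans (cong ((c - b) +_) (trans (cong (_- (c + d)) e) (ℤ.+-inverseʳ (c + d)))) (ℤ.+-identityʳ _))

      -- A string fixed at 0 and `m` is after time `m` the negative of its mirror image; doing this
      -- twice gives the period 2 m.
      Mirror : ℕ → ℕ → Set
      Mirror n i = ∀ j → j ℕ.+ i ≡ m → X (n ℕ.+ m) j ≡ - X n i

      mirror₀ : ∀ n → Mirror n 0
      mirror₀ n j e = trans (cong (X (n ℕ.+ m)) (trans (sym (ℕ.+-identityʳ j)) e))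
                            (trans (wallᵐ (n ℕ.+ m)) (cong -_ (sym (wall n))))

      mirror₁ : ∀ n → Mirror n 1
      mirror₁ n j e = trans (sym (ℤ.+-identityʳ _)) (trans
          (cong₂ (λ a b → X a j - b) (trans (ℕ.+-comm n m) (cong (ℕ._+ n) m≡)) (sym (trans (cong (X (j ℕ.+ n)) (sym m≡)) (wallᵐ (j ℕ.+ n)))))
          (characteristic j n (ℕ.≤-reflexive (sym m≡))))
        where
        m≡ : m ≡ suc j
        m≡ = trans (sym e) (ℕ.+-comm j 1)

      -- The equation gives site i + 2 from site i + 1 at the two neighbouring times and from site
      -- i, so the symmetry spreads from the wall. Each further site uses one earlier time, whence i
      -- ≤ n.
      mirror-late : ∀ i n → i ≤ n → Mirror n i × Mirror (suc n) (suc i)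
      mirror-late zero n l = mirror₀ n , mirror₁ (suc n)
      mirror-late (suc i) (suc n) (s≤s l) = proj₂ (mirror-late i n l) , step
        where
        step : Mirror (2 ℕ.+ n) (2 ℕ.+ i)
        step j e = trans (move (X (3 ℕ.+ n ℕ.+ m) (suc j)) (X (1 ℕ.+ n ℕ.+ m) (suc j)) (X (2 ℕ.+ n ℕ.+ m) j) (X (2 ℕ.+ n ℕ.+ m) (2 ℕ.+ j)) (wave j (ℕ.≤-trans (ℕ.+-monoʳ-≤ 2 (ℕ.m≤m+n j i)) (ℕ.≤-reflexive j≡)) (suc n ℕ.+ m)))
                  (trans (cong₂ _-_ (cong₂ _+_ (proj₂ (mirror-late i (2 ℕ.+ n) (ℕ.m≤n⇒m≤1+n (ℕ.m≤n⇒m≤1+n l))) (suc j) e₁)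
                                               (proj₂ (mirror-late i n l) (suc j) e₁))
                                    (proj₁ (mirror-late i (2 ℕ.+ n) (ℕ.m≤n⇒m≤1+n (ℕ.m≤n⇒m≤1+n l))) (2 ℕ.+ j) j≡))
                         (back (X (3 ℕ.+ n) (suc i)) (X (1 ℕ.+ n) (suc i)) (X (2 ℕ.+ n) i) (X (2 ℕ.+ n) (2 ℕ.+ i)) (wave i (ℕ.≤-trans (ℕ.m≤n+m (2 ℕ.+ i) j) (ℕ.≤-reflexive e)) (suc n))))
          where
          e₁ : suc j ℕ.+ suc i ≡ m
          e₁ = trans (sym (ℕ.+-suc j (suc i))) e
          j≡ : 2 ℕ.+ j ℕ.+ i ≡ m
          j≡ = trans (cong suc (sym (ℕ.+-suc j i))) e₁
          move : ∀ a b c d → a + b ≡ c + d → c ≡ (a + b) - d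
          move a b c d q = trans (lem c d) (cong (_- d) (sym q))
            where lem : ∀ c d → c ≡ (c + d) - d
                  lem = solve-∀
          back : ∀ a b c d → a + b ≡ c + d → (- a + - b) - - c ≡ - d
          back a b c d q = trans (lem a b c) (trans (cong (λ z → c - z) q) (lem' c d))
            where lem : ∀ a b c → (- a + - b) - - c ≡ c - (a + b)
                  lem = solve-∀
                  lem' : ∀ c d → c - (c + d) ≡ - d
                  lem' = solve-∀

      -- The equation is symmetric in time, so the times that `mirror-late` misses are reached
      -- backwards from the two times that follow.
      mirror-back : ∀ n i → i ≤ m → (∀ i → i ≤ m → Mirror (1 ℕ.+ n) i) → (∀ i → i ≤ m → Mirror (2 ℕ.+ n) i) → Mirror n i
      mirror-back n zero l r₁ r₂ = mirror₀ n
      mirror-back n (suc i) l r₁ r₂ zero e = trans (wall (n ℕ.+ m)) (cong -_ (sym (trans (cong (X n) e) (wallᵐ n))))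
      mirror-back n (suc i) l r₁ r₂ (suc j) e =
          trans (move (X (2 ℕ.+ (n ℕ.+ m)) (suc j)) (X (n ℕ.+ m) (suc j)) (X (1 ℕ.+ (n ℕ.+ m)) j) (X (1 ℕ.+ (n ℕ.+ m)) (2 ℕ.+ j)) (wave j (ℕ.≤-trans (ℕ.m≤m+n (2 ℕ.+ j) i) (ℕ.≤-reflexive e₂)) (n ℕ.+ m)))
         (trans (cong₂ _-_ (cong₂ _+_ (r₁ (2 ℕ.+ i) (ℕ.≤-trans (ℕ.m≤n+m (2 ℕ.+ i) j) (ℕ.≤-reflexive e₁)) j e₁)
                                      (r₁ i (ℕ.<⇒≤ l) (2 ℕ.+ j) e₂))
                           (r₂ (suc i) l (suc j) e))
                (back (X (2 ℕ.+ n) (suc i)) (X n (suc i)) (X (1 ℕ.+ n) i) (X (1 ℕ.+ n) (2 ℕ.+ i)) (wave i (ℕ.≤-trans (ℕ.m≤n+m (2 ℕ.+ i) j) (ℕ.≤-reflexive e₁)) n)))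
        where
        e₁ : j ℕ.+ (2 ℕ.+ i) ≡ m
        e₁ = trans (ℕ.+-suc j (suc i)) e
        e₂ : 2 ℕ.+ j ℕ.+ i ≡ m
        e₂ = trans (cong suc (sym (ℕ.+-suc j i))) e
        move : ∀ a b c d → a + b ≡ c + d → b ≡ (c + d) - a
        move a b c d q = trans (lem a b) (cong (_- a) q)
          where lem : ∀ a b → b ≡ (a + b) - a
                lem = solve-∀
        back : ∀ a b c d → a + b ≡ c + d → (- d + - c) - - a ≡ - b
        back a b c d q = trans (lem a c d) (trans (cong (λ z → a - z) (sym q)) (lem' a b))
          where lem : ∀ a c d → (- d + - c) - - a ≡ a - (c + d)
                lem = solve-∀
                lem' : ∀ a b → a - (a + b) ≡ - b
                lem' = solve-∀

      mirror : ∀ n i → i ≤ m → Mirror n i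
      mirror n = go m n (ℕ.m≤m+n m n)
        where
        go : ∀ k n → m ≤ k ℕ.+ n → ∀ i → i ≤ m → Mirror n i
        go zero n l i l' = proj₁ (mirror-late i n (ℕ.≤-trans l' l))
        go (suc k) n l i l' = mirror-back n i l'
          (go k (suc n) (ℕ.≤-trans l (ℕ.≤-reflexive (sym (ℕ.+-suc k n)))))
          (go k (suc (suc n)) (ℕ.≤-trans l (ℕ.≤-trans (ℕ.≤-reflexive (sym (ℕ.+-suc k n))) (ℕ.+-monoʳ-≤ k (ℕ.n≤1+n (suc n))))))

      periodic : ∀ n i → i ≤ m → X ((n ℕ.+ m) ℕ.+ m) i ≡ X n i
      periodic n i l = trans (mirror (n ℕ.+ m) (m ℕ.∸ i) (ℕ.m∸n≤m m i) i (ℕ.m+[n∸m]≡n l))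
        (trans (cong -_ (mirror n i l (m ℕ.∸ i) (ℕ.m∸n+n≡m l))) (ℤ.neg-involutive _))

      -- The sum over the `k` times n, n + 2, n + 4, .... Since X has period 2 m, `Z` below sums
      -- over all times of one parity in a period.
      Y : ℕ → ℕ → ℕ → ℤ
      Y zero    n i = 0ℤ
      Y (suc k) n i = X n i + Y k (2 ℕ.+ n) i

      Y-shift : ∀ k n i → Y k (2 ℕ.+ n) i + X n i ≡ X (k ℕ.+ k ℕ.+ n) i + Y k n i
      Y-shift zero n i = ℤ.+-comm 0ℤ (X n i)
      Y-shift (suc k) n i = trans (cong (_+ X n i) (trans (ℤ.+-comm (X (2 ℕ.+ n) i) _) (Y-shift k (2 ℕ.+ n) i)))
          (trans (lem (X (k ℕ.+ k ℕ.+ (2 ℕ.+ n)) i) (Y k (2 ℕ.+ n) i) (X n i))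
                 (cong (λ a → X a i + (X n i + Y k (2 ℕ.+ n) i)) idx))
        where
        lem : ∀ a b c → (a + b) + c ≡ a + (c + b)
        lem = solve-∀
        idx : k ℕ.+ k ℕ.+ (2 ℕ.+ n) ≡ suc k ℕ.+ suc k ℕ.+ n
        idx = trans (ℕ.+-suc (k ℕ.+ k) (suc n)) (cong suc (trans (ℕ.+-suc (k ℕ.+ k) n) (cong (ℕ._+ n) (sym (ℕ.+-suc k k)))))

      Y-wave : ∀ k n i → suc i < m → Y k (2 ℕ.+ n) (suc i) + Y k n (suc i) ≡ Y k (1 ℕ.+ n) i + Y k (1 ℕ.+ n) (2 ℕ.+ i)
      Y-wave zero n i l = refl
      Y-wave (suc k) n i l = trans (lem (X (2 ℕ.+ n) (suc i)) (Y k (4 ℕ.+ n) (suc i)) (X n (suc i)) (Y k (2 ℕ.+ n) (suc i)))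
          (trans (cong₂ _+_ (wave i l n) (Y-wave k (2 ℕ.+ n) i l))
                 (lem (X (1 ℕ.+ n) i) (X (1 ℕ.+ n) (2 ℕ.+ i)) (Y k (3 ℕ.+ n) i) (Y k (3 ℕ.+ n) (2 ℕ.+ i))))
        where
        lem : ∀ a b c d → (a + b) + (c + d) ≡ (a + c) + (b + d)
        lem = solve-∀

      Y-wall : ∀ k n i → (∀ n → X n i ≡ 0ℤ) → Y k n i ≡ 0ℤ
      Y-wall zero    n i h = refl
      Y-wall (suc k) n i h = trans (cong₂ _+_ (h n) (Y-wall k (2 ℕ.+ n) i h)) refl

      Z : ℕ → ℕ → ℤ
      Z = Y m

      Z-period : ∀ n i → i ≤ m → Z (2 ℕ.+ n) i ≡ Z n i
      Z-period n i l = cancel (X n i) _ _ (trans (Y-shift m n i)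
        (trans (cong (_+ Z n i) (trans (cong (λ a → X a i) idx) (periodic n i l))) (ℤ.+-comm (X n i) (Z n i))))
        where
        cancel : ∀ c a b → a + c ≡ b + c → a ≡ b
        cancel c a b e = trans (lem a c) (trans (cong (_- c) e) (sym (lem b c)))
          where lem : ∀ a c → a ≡ (a + c) - c
                lem = solve-∀
        idx : m ℕ.+ m ℕ.+ n ≡ n ℕ.+ m ℕ.+ m
        idx = trans (ℕ.+-comm (m ℕ.+ m) n) (sym (ℕ.+-assoc n m m))

      -- As `Z` has period 2 in time, the wave equation turns into 2 z (i + 1) = z i + z (i + 2)
      -- along the diagonal, so z is linear in i, starting from 0 at the wall.
      diagonal₂ : ∀ n i → suc i ≤ m → Z (i ℕ.+ n) i ≡ ℤ.+ i ℤ.* Z (suc n) 1 × Z (suc i ℕ.+ n) (suc i) ≡ ℤ.+ suc i ℤ.* Z (suc n) 1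
      diagonal₂ n zero l = Y-wall m n 0 wall , sym (ℤ.*-identityˡ _)
      diagonal₂ n (suc i) l with diagonal₂ n i (ℕ.<⇒≤ l)
      ... | d₀ , d₁ = d₁ , trans (move (Z A (suc i)) (Z A (suc i)) (Z (suc A) i) (Z (suc A) (2 ℕ.+ i)) (trans (cong (Z (suc i ℕ.+ n) (suc i) +_) (sym (Z-period (suc i ℕ.+ n) (suc i) (ℕ.<⇒≤ l))))
                             (trans (ℤ.+-comm (Z A (suc i)) (Z (2 ℕ.+ A) (suc i))) (Y-wave m (suc i ℕ.+ n) i l))))
                       (trans (cong₂ (λ a b → (a + a) - b) d₁ (trans (Z-period (i ℕ.+ n) i (ℕ.≤-trans (ℕ.n≤1+n i) (ℕ.<⇒≤ l))) d₀))
                              (lem i (Z (suc n) 1)))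
        where
        A : ℕ
        A = suc i ℕ.+ n
        move : ∀ a b c d → a + b ≡ c + d → d ≡ (a + b) - c
        move a b c d q = trans (lem₁ c d) (cong (_- c) (sym q))
          where lem₁ : ∀ c d → d ≡ (c + d) - c
                lem₁ = solve-∀
        lem : ∀ i z → (ℤ.+ suc i ℤ.* z + ℤ.+ suc i ℤ.* z) - ℤ.+ i ℤ.* z ≡ ℤ.+ suc (suc i) ℤ.* z
        lem i z = trans (cong (λ a → (a ℤ.* z + a ℤ.* z) - ℤ.+ i ℤ.* z) (ℤ.pos-+ 1 i))
                 (trans (lem₂ (ℤ.+ i) z) (cong (ℤ._* z) (sym (ℤ.pos-+ 2 i))))
          where lem₂ : ∀ i z → (((ℤ.+ 1) + i) ℤ.* z + ((ℤ.+ 1) + i) ℤ.* z) - i ℤ.* z ≡ ((ℤ.+ 2) + i) ℤ.* z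
                lem₂ = solve-∀

      -- The linear function of `diagonal₂` vanishes at the second wall as well, so its slope is
      -- zero. This is what makes a relator fix the entries at third generators, see
      -- `relator-trivial`.
      sum-zero : ∀ n i → i ≤ m → Z n i ≡ 0ℤ
      sum-zero n i l = trans (sym (periods i n)) (trans (cong (λ a → Z a i) (ℕ.+-assoc i i n)) (diag i (i ℕ.+ n) l))
        where
        pred-m : ∃ λ p → suc p ≡ m
        pred-m = m ℕ.∸ 1 , ℕ.m+[n∸m]≡n (ℕ.<⇒≤ 1<m)
        z₁ : ∀ n → Z (suc n) 1 ≡ 0ℤ
        z₁ n with pred-m
        ... | p , e with ℤ.i*j≡0⇒i≡0∨j≡0 (ℤ.+ suc p) (trans (sym (proj₂ (diagonal₂ n p (ℕ.≤-reflexive e))))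
                          (Y-wall m (suc p ℕ.+ n) (suc p) (λ k → trans (cong (X k) e) (wallᵐ k))))
        ...   | inj₂ q = q
        diag : ∀ i n → i ≤ m → Z (i ℕ.+ n) i ≡ 0ℤ
        diag zero    n l = Y-wall m n 0 wall
        diag (suc i) n l = trans (proj₂ (diagonal₂ n i l)) (trans (cong (ℤ.+ suc i ℤ.*_) (z₁ n)) (ℤ.*-zeroʳ (ℤ.+ suc i)))
        periods : ∀ k n → Z (k ℕ.+ k ℕ.+ n) i ≡ Z n i
        periods zero n = refl
        periods (suc k) n = trans (cong (λ a → Z (suc a ℕ.+ n) i) (ℕ.+-suc k k)) (trans (Z-period (k ℕ.+ k ℕ.+ n) i l) (periods k n))

  -- The value of `g` at the site `j` of the path number `q`. The sites of a path are numbered from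
  -- 1, and the value is 0 at the walls 0 and `k` and beyond; for k = 0 there is one path and no
  -- second wall.
  ext : ℕ → (ℕ → ℤ) → ℕ → ℕ → ℤ
  ext k       g q zero    = 0ℤ
  ext zero    g q (suc r) = g r
  ext (suc w) g q (suc r) with r <? w
  ... | yes _ = g (r ℕ.+ q ℕ.* w)
  ... | no  _ = 0ℤ

  -- The adjacency operator of a disjoint union of paths covering ℕ: consecutive
  -- blocks of k − 1 vertices, or a single infinite path when k = 0.
  Adj : ℕ → (ℕ → ℤ) → ℕ → ℤ
  Adj 0 g i = ext 0 g 0 i + ext 0 g 0 (2 ℕ.+ i)
  Adj 1 g i = 0ℤ
  Adj k@(suc w@(suc _)) g i = ext k g (i / w) (i % w) + ext k g (i / w) (2 ℕ.+ i % w)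

  ext-cong : ∀ k {g h} → (∀ i → g i ≡ h i) → ∀ q j → ext k g q j ≡ ext k h q j
  ext-cong k       e q zero    = refl
  ext-cong zero    e q (suc r) = e r
  ext-cong (suc w) e q (suc r) with r <? w
  ... | yes _ = e _
  ... | no  _ = refl

  ext-+ : ∀ k g h q j → ext k (λ i → g i + h i) q j ≡ ext k g q j + ext k h q j
  ext-+ k       g h q zero    = refl
  ext-+ zero    g h q (suc r) = refl
  ext-+ (suc w) g h q (suc r) with r <? w
  ... | yes _ = refl
  ... | no  _ = refl

  ext-neg : ∀ k g q j → ext k (λ i → - g i) q j ≡ - ext k g q j
  ext-neg k       g q zero    = refl
  ext-neg zero    g q (suc r) = refl
  ext-neg (suc w) g q (suc r) with r <? w
  ... | yes _ = refl
  ... | no  _ = refl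

  ext-0 : ∀ k q j → ext k (λ _ → 0ℤ) q j ≡ 0ℤ
  ext-0 k       q zero    = refl
  ext-0 zero    q (suc r) = refl
  ext-0 (suc w) q (suc r) with r <? w
  ... | yes _ = refl
  ... | no  _ = refl

  ext-wall : ∀ w g q j → ¬ j < w → ext (suc w) g q (suc j) ≡ 0ℤ
  ext-wall w g q j n with j <? w
  ... | yes l = ⊥-elim (n l)
  ... | no _  = refl

  ext-self : ∀ w .{{_ : NonZero w}} g i → ext (suc w) g (i / w) (suc (i % w)) ≡ g i
  ext-self w g i with (i % w) <? w
  ... | yes _ = cong g (sym (m≡m%n+[m/n]*n i w))
  ... | no n  = ⊥-elim (n (m%n<n i w))

  Adj-cong : ∀ k {g h} → (∀ i → g i ≡ h i) → ∀ i → Adj k g i ≡ Adj k h i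
  Adj-cong 0 e i = cong₂ _+_ (ext-cong 0 e 0 i) (ext-cong 0 e 0 (2 ℕ.+ i))
  Adj-cong 1 e i = refl
  Adj-cong k@(suc w@(suc _)) e i = cong₂ _+_ (ext-cong k e (i / w) (i % w)) (ext-cong k e (i / w) (2 ℕ.+ i % w))

  interchange : ∀ a b c d → (a + b) + (c + d) ≡ (a + c) + (b + d)
  interchange = solve-∀

  Adj-+ : ∀ k g h i → Adj k (λ i → g i + h i) i ≡ Adj k g i + Adj k h i
  Adj-+ 0 g h i = trans (cong₂ _+_ (ext-+ 0 g h 0 i) (ext-+ 0 g h 0 (2 ℕ.+ i)))
    (interchange (ext 0 g 0 i) (ext 0 h 0 i) (ext 0 g 0 (2 ℕ.+ i)) (ext 0 h 0 (2 ℕ.+ i)))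
  Adj-+ 1 g h i = refl
  Adj-+ k@(suc w@(suc _)) g h i = trans (cong₂ _+_ (ext-+ k g h (i / w) (i % w)) (ext-+ k g h (i / w) (2 ℕ.+ i % w)))
    (interchange (ext k g (i / w) (i % w)) (ext k h (i / w) (i % w)) (ext k g (i / w) (2 ℕ.+ i % w)) (ext k h (i / w) (2 ℕ.+ i % w)))

  Adj-neg : ∀ k g i → Adj k (λ i → - g i) i ≡ - Adj k g i
  Adj-neg 0 g i = trans (cong₂ _+_ (ext-neg 0 g 0 i) (ext-neg 0 g 0 (2 ℕ.+ i))) (sym (ℤ.neg-distrib-+ (ext 0 g 0 i) _))
  Adj-neg 1 g i = refl
  Adj-neg k@(suc w@(suc _)) g i = trans (cong₂ _+_ (ext-neg k g (i / w) (i % w)) (ext-neg k g (i / w) (2 ℕ.+ i % w)))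
    (sym (ℤ.neg-distrib-+ (ext k g (i / w) (i % w)) _))

  Adj-0 : ∀ k i → Adj k (λ _ → 0ℤ) i ≡ 0ℤ
  Adj-0 0 i = cong₂ _+_ (ext-0 0 0 i) (ext-0 0 0 (2 ℕ.+ i))
  Adj-0 1 i = refl
  Adj-0 k@(suc w@(suc _)) i = cong₂ _+_ (ext-0 k (i / w) (i % w)) (ext-0 k (i / w) (2 ℕ.+ i % w))

  ext-Adj : ∀ w g q j → j < w → ext (suc w) (Adj (suc w) g) q (suc j) ≡ ext (suc w) g q j + ext (suc w) g q (2 ℕ.+ j)
  ext-Adj w@(suc _) g q j l with j <? w
  ... | no n  = ⊥-elim (n l)
  ... | yes _ = cong₂ (λ a b → ext (suc w) g a b + ext (suc w) g a (2 ℕ.+ b)) div mod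
    where
    mod : (j ℕ.+ q ℕ.* w) % w ≡ j
    mod = trans ([m+kn]%n≡m%n j q w) (m<n⇒m%n≡m l)
    div : (j ℕ.+ q ℕ.* w) / w ≡ q
    div = trans (+-distrib-/-∣ʳ j (n∣m*n q)) (cong₂ ℕ._+_ (m<n⇒m/n≡0 l) (m*n/n≡m q w))

  module WaveSequence (k : ℕ) (x : ℕ → ℕ → ℤ) (x-step : ∀ n i → x (2 ℕ.+ n) i ≡ Adj k (x (1 ℕ.+ n)) i - x n i) where

    X : ℕ → ℕ → ℕ → ℤ
    X q n j = ext k (x n) q j

    ext-step : ∀ n q j → X q (2 ℕ.+ n) j ≡ ext k (Adj k (x (1 ℕ.+ n))) q j - X q n j
    ext-step n q j = trans (ext-cong k (x-step n) q j) (trans (ext-+ k (Adj k (x (1 ℕ.+ n))) (λ i → - x n i) q j)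
      (cong (ext k (Adj k (x (1 ℕ.+ n))) q j +_) (ext-neg k (x n) q j)))

    wave-from : ∀ q j → (∀ n → ext k (Adj k (x n)) q (suc j) ≡ X q n j + X q n (2 ℕ.+ j)) → Wave.WaveAt (X q) (λ _ → refl) j
    wave-from q j h n = trans (cong (_+ X q n (suc j)) (trans (ext-step n q (suc j)) (cong (_- X q n (suc j)) (h (1 ℕ.+ n)))))
      (lem _ (X q n (suc j)))
      where
      lem : ∀ a b → (a - b) + b ≡ a
      lem = solve-∀

    sx : ℕ → ℕ → ℕ → ℤ
    sx zero    n i = 0ℤ
    sx (suc j) n i = x n i + sx j (2 ℕ.+ n) i

  module FiniteWave (w : ℕ) .{{_ : NonZero w}} (x : ℕ → ℕ → ℤ) (x-step : ∀ n i → x (2 ℕ.+ n) i ≡ Adj (suc w) (x (1 ℕ.+ n)) i - x n i) where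
    open WaveSequence (suc w) x x-step

    private module Per q = Wave.Periodic (X q) (λ _ → refl) (suc w)
                     (λ j l → wave-from q j (λ n → ext-Adj w (x n) q j (ℕ.s≤s⁻¹ l)))
                     (λ n → ext-wall w (x n) q w (ℕ.<-irrefl refl)) (s≤s (ℕ.>-nonZero⁻¹ w))

    x-periodic : ∀ n i → x ((n ℕ.+ suc w) ℕ.+ suc w) i ≡ x n i
    x-periodic n i = trans (sym (ext-self w (x _) i)) (trans (Per.periodic (i / w) n (suc (i % w)) (ℕ.m≤n⇒m≤1+n (m%n<n i w))) (ext-self w (x n) i))

    ext-sx : ∀ j n q r → ext (suc w) (sx j n) q r ≡ Wave.Periodic.Y (X q) (λ _ → refl) (suc w) (λ j l → wave-from q j (λ n → ext-Adj w (x n) q j (ℕ.s≤s⁻¹ l)))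
                     (λ n → ext-wall w (x n) q w (ℕ.<-irrefl refl)) (s≤s (ℕ.>-nonZero⁻¹ w)) j n r
    ext-sx zero    n q r = ext-0 (suc w) q r
    ext-sx (suc j) n q r = trans (ext-+ (suc w) (x n) (sx j (2 ℕ.+ n)) q r) (cong (X q n r +_) (ext-sx j (2 ℕ.+ n) q r))

    sx-zero : ∀ n i → sx (suc w) n i ≡ 0ℤ
    sx-zero n i = trans (sym (ext-self w (sx (suc w) n) i)) (trans (ext-sx (suc w) n (i / w) (suc (i % w)))
      (Per.sum-zero (i / w) n (suc (i % w)) (ℕ.m≤n⇒m≤1+n (m%n<n i w))))

  -- A unit impulse at the first vertex of the first path reaches its vertex number `n` (counted
  -- from 0) at time `suc n` with value 1, as long as the path does not end before.
  front-nonzero : ∀ k (x : ℕ → ℕ → ℤ) (x-step : ∀ n i → x (2 ℕ.+ n) i ≡ Adj k (x (1 ℕ.+ n)) i - x n i) →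
    (∀ i → x 0 i ≡ 0ℤ) → x 1 0 ≡ 1ℤ → (∀ i → x 1 (suc i) ≡ 0ℤ) →
    ∀ n → k ≡ 0 ⊎ suc n < k → ¬ (∀ i → x (suc n) i ≡ 0ℤ)
  front-nonzero zero x x-step z₀ o z₁ n _ z with trans (sym (Fr.front n λ j _ → wv j)) (z n)
    where
    open WaveSequence 0 x x-step
    wv : ∀ j → Wave.WaveAt (X 0) (λ _ → refl) j
    wv j = wave-from 0 j (λ n → refl)
    x₀ : ∀ j → X 0 0 j ≡ 0ℤ
    x₀ zero    = refl
    x₀ (suc j) = z₀ j
    module Fr = Wave.Front (X 0) (λ _ → refl) (λ j → inj₁ (wv j)) x₀ o z₁
  ... | ()
  front-nonzero (suc w) x x-step z₀ o z₁ n (inj₂ (s≤s l)) z with trans (sym (Fr.front n λ j l' → wv j (ℕ.≤-<-trans l' l)))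
      (trans (ext-cong (suc w) z 0 (suc n)) (ext-0 (suc w) 0 (suc n)))
    where
    open WaveSequence (suc w) x x-step
    wv : ∀ j → j < w → Wave.WaveAt (X 0) (λ _ → refl) j
    wv j l = wave-from 0 j (λ n → ext-Adj w (x n) 0 j l)
    reg : ∀ j → Wave.WaveAt (X 0) (λ _ → refl) j ⊎ (∀ n → X 0 n (suc j) ≡ 0ℤ)
    reg j = by (j <? w)
      where
      by : Dec (j < w) → Wave.WaveAt (X 0) (λ _ → refl) j ⊎ (∀ n → X 0 n (suc j) ≡ 0ℤ)
      by (yes l) = inj₁ (wv j l)
      by (no nl) = inj₂ λ n → ext-wall w (x n) 0 j nl
    x₀ : ∀ j → X 0 0 j ≡ 0ℤ
    x₀ j = trans (ext-cong (suc w) z₀ 0 j) (ext-0 (suc w) 0 j)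
    x₁₁ : X 0 1 1 ≡ 1ℤ
    x₁₁ with 0 <? w
    ... | yes _ = o
    ... | no nl = ⊥-elim (nl (ℕ.≤-<-trans z≤n l))
    x₁ : ∀ j → X 0 1 (2 ℕ.+ j) ≡ 0ℤ
    x₁ j with suc j <? w
    ... | yes _ = z₁ _
    ... | no _  = refl
    module Fr = Wave.Front (X 0) (λ _ → refl) reg x₀ x₁₁ x₁
  ... | ()


open import Data.Nat using (_+_; _*_; _∸_; s≤s⁻¹)
open import Data.Nat.Properties
open Polynomials
open Waves

-- Special matchings of graded posets

module GradedPoset {N : ℕ} (Γ : FiniteGradedPoset N) where
  open FiniteGradedPoset Γ public

  P : Set
  P = Fin N

  infix 4 _◁_
  _◁_ : P → P → Set
  x ◁ y = x ⊑ y × rk y ≡ suc (rk x)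

  ◁-irrefl : ∀ {x} → ¬ x ◁ x
  ◁-irrefl (_ , e) = 1+n≢n (sym e)

  ◁-asym : ∀ {x y} → x ◁ y → ¬ y ◁ x
  ◁-asym (_ , e) (_ , e') = <-asym (≤-reflexive (sym e)) (≤-reflexive (sym e'))

  ⊑-antisym-rk : ∀ {x y} → x ⊑ y → rk x ≡ rk y → x ≡ y
  ⊑-antisym-rk h e with ⊑-cases h
  ... | inj₁ p = p
  ... | inj₂ l = ⊥-elim (<-irrefl e l)

  rk-mono : ∀ {x y} → x ⊑ y → rk x ≤ rk y
  rk-mono h with ⊑-cases h
  ... | inj₁ refl = ≤-refl
  ... | inj₂ l    = <⇒≤ l

  Up Dn : (P → P) → P → Set
  Up M x = x ◁ M x
  Dn M x = M x ◁ x

  -- a special matching of the interval below v; the values of M elsewhere are junk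
  record Spec (v : P) (M : P → P) : Set where
    field
      inv  : ∀ {x} → x ⊑ v → M (M x) ≡ x
      mem  : ∀ {x} → x ⊑ v → M x ⊑ v
      cov  : ∀ {x} → x ⊑ v → Up M x ⊎ Dn M x
      -- For x ◁ y, the condition that M x = y or M x ⊑ M y, split by directions. If M lowers x and
      -- raises y it holds anyway.
      s-up : ∀ {x y} → x ◁ y → y ⊑ v → Up M x → Up M y → M x ◁ M y
      s-dn : ∀ {x y} → x ◁ y → y ⊑ v → Dn M x → Dn M y → M x ◁ M y
      s-eq : ∀ {x y} → x ◁ y → y ⊑ v → Up M x → Dn M y → M x ≡ y

    top-dn : Dn M v
    top-dn with cov (⊑-refl v)
    ... | inj₁ (_ , e) = ⊥-elim (1+n≰n (≤-trans (≤-reflexive (sym e)) (rk-mono (mem (⊑-refl v)))))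
    ... | inj₂ d = d

    up⇒dn : ∀ {x} → x ⊑ v → Up M x → Dn M (M x)
    up⇒dn h u = subst (_◁ M _) (sym (inv h)) u

    dn⇒up : ∀ {x} → x ⊑ v → Dn M x → Up M (M x)
    dn⇒up h d = subst (M _ ◁_) (sym (inv h)) d

  private
    gap : ∀ {x y z} → x ◁ y → y ⊑ z → rk z ∸ rk y < rk z ∸ rk x
    gap {x} {y} {z} (_ , e) h =
      subst (λ k → rk z ∸ k < rk z ∸ rk x) (sym e)
        (∸-monoʳ-< (n<1+n (rk x)) (≤-trans (≤-reflexive (sym e)) (rk-mono h)))

  -- Induction downwards from `v` along covers; the rank gap to `v` decreases on the way up.
  ascend : ∀ {v} (Q : P → Set) → Q v →
           (∀ {x y} → x ◁ y → y ⊑ v → Q y → Q x) → ∀ {x} → x ⊑ v → Q x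
  ascend {v} Q base step {x} = go x (<-wellFounded _)
    where
    go : ∀ x → Acc _<_ (rk v ∸ rk x) → x ⊑ v → Q x
    go x (acc rs) h with x Fin.≟ v
    ... | yes refl = base
    ... | no ne with up-cover h ne
    ... | y , c , h' = step c h' (go y (rs (gap c h')) h')

  module _ {v M} (S : Spec v M) where
    open Spec S

    -- The lifting property of Bruhat order, from the axioms of a special matching alone. The two
    -- halves are proved together because the direction of M may change from one element of a chain
    -- to the next.
    lifting : ∀ {w} → w ⊑ v → Dn M w → ∀ {x} → x ⊑ w →
              (Up M x → x ⊑ M w) × (Dn M x → M x ⊑ M w)
    lifting {w} wv dw = ascend _ ((λ u → ⊥-elim (◁-asym u dw)) , λ _ → ⊑-refl _) step
      where
      step : ∀ {x y} → x ◁ y → y ⊑ w → (Up M y → y ⊑ M w) × (Dn M y → M y ⊑ M w) →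
             (Up M x → x ⊑ M w) × (Dn M x → M x ⊑ M w)
      step {x} {y} c h (iu , id) with cov (⊑-trans h wv)
      ... | inj₁ uy = (λ _ → ⊑-trans (proj₁ c) (iu uy))
                    , λ dx → ⊑-trans (proj₁ dx) (⊑-trans (proj₁ c) (iu uy))
      ... | inj₂ dy = (λ ux → subst (_⊑ M w)
                        (trans (cong M (sym (s-eq c (⊑-trans h wv) ux dy)))
                               (inv (⊑-trans (proj₁ c) (⊑-trans h wv)))) (id dy))
                    , λ dx → ⊑-trans (proj₁ (s-dn c (⊑-trans h wv) dx dy)) (id dy)

    -- This makes `restrict` possible. Going down a cover x ◁ y, only an ascent at x needs an
    -- argument: then M x is `y` or is covered by M y.
    mem-below : ∀ {w} → w ⊑ v → Dn M w → ∀ {x} → x ⊑ w → M x ⊑ w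
    mem-below {w} wv dw = ascend (λ x → M x ⊑ w) (proj₁ dw) step
      where
      step : ∀ {x y} → x ◁ y → y ⊑ w → M y ⊑ w → M x ⊑ w
      step {x} {y} c h ih with cov (⊑-trans (proj₁ c) (⊑-trans h wv))
      ... | inj₂ dx = ⊑-trans (proj₁ dx) (⊑-trans (proj₁ c) h)
      ... | inj₁ ux with cov (⊑-trans h wv)
      ...   | inj₁ uy = ⊑-trans (proj₁ (s-up c (⊑-trans h wv) ux uy)) ih
      ...   | inj₂ dy = subst (_⊑ w) (sym (s-eq c (⊑-trans h wv) ux dy)) h

    restrict : ∀ {w} → w ⊑ v → Dn M w → Spec w M
    restrict wv dw = record
      { inv  = λ h → inv (⊑-trans h wv)
      ; mem  = mem-below wv dw
      ; cov  = λ h → cov (⊑-trans h wv)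
      ; s-up = λ c h → s-up c (⊑-trans h wv)
      ; s-dn = λ c h → s-dn c (⊑-trans h wv)
      ; s-eq = λ c h → s-eq c (⊑-trans h wv)
      }

  module Thin (some-spec : ∀ {x v} → x ◁ v → ∃ (Spec v)) where

    -- Take M special with M z ◁ z. If M raises x, the elements M x and M z both lie between x and
    -- z. If M lowers x, the problem moves to the interval from M x to M z or, when y = M z, is
    -- posed there for x; a second solution there is carried back by M.
    thin : ∀ {x y z} → x ◁ y → y ◁ z → ∃ λ y' → ¬ y' ≡ y × x ◁ y' × y' ◁ z
    thin {z = z} = go z (<-wellFounded _)
      where
      go : ∀ z → Acc _<_ (rk z) → ∀ {x y} → x ◁ y → y ◁ z → ∃ λ y' → ¬ y' ≡ y × x ◁ y' × y' ◁ z
      go z (acc rs) {x} {y} xy yz = helper (cov xv)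
        where
        MS : ∃ (Spec z)
        MS = some-spec yz
        M : P → P
        M = proj₁ MS
        open Spec (proj₂ MS)
        yv : y ⊑ z
        yv = proj₁ yz
        xv : x ⊑ z
        xv = ⊑-trans (proj₁ xy) yv
        rkM : rk (M z) ≡ suc (rk x)
        rkM = suc-injective (trans (sym (proj₂ top-dn)) (trans (proj₂ yz) (cong suc (proj₂ xy))))
        below : ∀ {w} → w ⊑ z → rk w ≡ suc (rk x) → w ◁ z
        below h e = h , trans (proj₂ yz) (cong suc (trans (proj₂ xy) (sym e)))
        z≢x : ¬ z ≡ x
        z≢x e = <-irrefl (cong rk (sym e)) (<-trans (≤-reflexive (sym (proj₂ xy))) (≤-reflexive (sym (proj₂ yz))))
        M-eq : ∀ {w u} → w ⊑ z → M w ≡ u → w ≡ M u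
        M-eq h e = trans (sym (inv h)) (cong M e)
        s-dnᵉ : ∀ {a} → Dn M x → M x ◁ a → a ⊑ z → ¬ a ≡ x → Up M a × x ◁ M a
        s-dnᵉ dx c h ne with cov h
        ... | inj₂ d = ⊥-elim (ne (trans (sym (s-eq c h (dn⇒up xv dx) d)) (inv xv)))
        ... | inj₁ u = u , subst (_◁ M _) (inv xv) (s-up c h (dn⇒up xv dx) u)
        helper : Up M x ⊎ Dn M x → ∃ λ y' → ¬ y' ≡ y × x ◁ y' × y' ◁ z
        helper (inj₁ ux) with y Fin.≟ M x
        ... | yes e = M z , (λ e' → z≢x (trans (M-eq (⊑-refl z) (trans e' e)) (inv xv)))
                    , (proj₁ (lifting (proj₂ MS) (⊑-refl z) top-dn xv) ux , rkM) , top-dn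
        ... | no ne = M x , (λ e → ne (sym e)) , ux , below (mem xv) (proj₂ ux)
        helper (inj₂ dx) with y Fin.≟ M z
        ... | yes e with go (M z) (rs (≤-reflexive (sym (proj₂ top-dn)))) dx (subst (x ◁_) e xy)
        ...   | x₂ , ne , c₁ , c₂ with s-dnᵉ dx c₁ (⊑-trans (proj₁ c₂) (proj₁ top-dn)) ne
        ...     | u₂ , c = M x₂
            , (λ e' → <-irrefl (cong rk (M-eq x₂z (trans e' e)))
                        (<-trans (≤-reflexive (sym (proj₂ c₂))) (≤-reflexive (sym (trans (cong rk (inv (⊑-refl z))) (proj₂ top-dn))))))
            , c , below (mem x₂z) (proj₂ c)
          where x₂z : x₂ ⊑ z
                x₂z = ⊑-trans (proj₁ c₂) (proj₁ top-dn)
        helper (inj₂ dx) | no ne with cov yv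
        ... | inj₁ uy = ⊥-elim (ne (M-eq yv (s-eq yz (⊑-refl z) uy top-dn)))
        ... | inj₂ dy with go (M z) (rs (≤-reflexive (sym (proj₂ top-dn)))) (s-dn xy yv dx dy) (s-dn yz (⊑-refl z) dy top-dn)
        ...   | x₂ , ne₂ , c₁ , c₂ with x₂ Fin.≟ x
        ...     | yes e = M z , (λ e' → ne (sym e')) , subst (_◁ M z) e c₂ , top-dn
        ...     | no ne' with s-dnᵉ dx c₁ (⊑-trans (proj₁ c₂) (proj₁ top-dn)) ne'
        ...       | u₂ , c = M x₂ , (λ e' → ne₂ (M-eq x₂z e')) , c , below (mem x₂z) (proj₂ c)
          where x₂z : x₂ ⊑ z
                x₂z = ⊑-trans (proj₁ c₂) (proj₁ top-dn)

  -- The cover graph contains no K₃,₂: two elements have at most two common covers, and dually.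
  record NoK : Set where
    field
      K↑ : ∀ {w w' a b c} → ¬ w ≡ w' → ¬ a ≡ b → ¬ a ≡ c → ¬ b ≡ c →
           w ◁ a → w ◁ b → w ◁ c → w' ◁ a → w' ◁ b → w' ◁ c → ⊥
      K↓ : ∀ {w w' a b c} → ¬ w ≡ w' → ¬ a ≡ b → ¬ a ≡ c → ¬ b ≡ c →
           a ◁ w → b ◁ w → c ◁ w → a ◁ w' → b ◁ w' → c ◁ w' → ⊥

  -- Orbits of two special matchings

  op : Bool → ℕ → Bool
  op β zero    = β
  op β (suc i) = not (op β i)

  op-not : ∀ β i → op (not β) i ≡ not (op β i)
  op-not β zero    = refl
  op-not β (suc i) = cong not (op-not β i)

  op-hit : ∀ γ i → ∃ λ β → op β i ≡ γ
  op-hit γ zero    = γ , refl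
  op-hit γ (suc i) with op-hit (not γ) i
  ... | β , e = β , trans (cong not e) (Bool.not-involutive γ)

  two : ∀ (β γ : Bool) → γ ≡ β ⊎ γ ≡ not β
  two false false = inj₁ refl
  two false true  = inj₂ refl
  two true  false = inj₂ refl
  two true  true  = inj₁ refl

  module Orbits
    (some-spec : ∀ {x v} → x ◁ v → ∃ (Spec v)) (noK : NoK)
    {v : P} (X : Bool → P → P) (SX : ∀ β → Spec v (X β)) where

    open Thin some-spec
    open NoK noK
    private module S β = Spec (SX β)

    -- The alternating product of length `i` that begins with `X β`, applied to `b`; `op β i` is the
    -- index of the matching to be applied next.
    c : Bool → ℕ → P → P
    c β zero    b = b
    c β (suc i) b = X (op β i) (c β i b)

    Bot : P → Set
    Bot b = ∀ β → Up (X β) b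

    NoMeet : P → ℕ → Set
    NoMeet b i = ∀ β j → 1 ≤ j → j ≤ i → ¬ c β j b ≡ c (not β) j b

    c-mem : ∀ {b} → b ⊑ v → ∀ β i → c β i b ⊑ v
    c-mem h β zero    = h
    c-mem h β (suc i) = S.mem _ (c-mem h β i)

    NoMeet-≤ : ∀ {b i j} → j ≤ i → NoMeet b i → NoMeet b j
    NoMeet-≤ l nm β k p q = nm β k p (≤-trans q l)

    -- The two alternating paths rise together and cross edges join consecutive levels, as in a
    -- dihedral group. The cross edge below decides: if the next matching went down, `s-eq` would
    -- make the paths meet.
    ladder : ∀ {b} → b ⊑ v → Bot b → ∀ i → NoMeet b i → ∀ β →
             c β i b ◁ c β (suc i) b × c (not β) i b ◁ c β (suc i) b
    ladder h bot zero    nm β = bot β , bot β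
    ladder {b} h bot (suc i) nm β = go (S.cov Z (c-mem h β (suc i)))
      where
      Z : Bool
      Z = op β (suc i)
      ih₁ : c (not β) i b ◁ X Z (c (not β) i b)
      ih₁ = subst (λ γ → c (not β) i b ◁ X γ (c (not β) i b)) (op-not β i)
              (proj₁ (ladder h bot i (NoMeet-≤ (n≤1+n i) nm) (not β)))
      ih₂ : c (not β) i b ◁ c β (suc i) b
      ih₂ = proj₂ (ladder h bot i (NoMeet-≤ (n≤1+n i) nm) β)
      Zeq : X Z (c (not β) i b) ≡ c (not β) (suc i) b
      Zeq = cong (λ γ → X γ (c (not β) i b)) (sym (op-not β i))
      go : Up (X Z) (c β (suc i) b) ⊎ Dn (X Z) (c β (suc i) b) →
           c β (suc i) b ◁ c β (suc (suc i)) b × c (not β) (suc i) b ◁ c β (suc (suc i)) b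
      go (inj₁ u) = u , subst (_◁ X Z (c β (suc i) b)) Zeq (S.s-up Z ih₂ (c-mem h β (suc i)) ih₁ u)
      go (inj₂ d) = ⊥-elim (nm β (suc i) (s≤s z≤n) ≤-refl
                      (trans (sym (S.s-eq Z ih₂ (c-mem h β (suc i)) ih₁ d)) Zeq))

    -- b is the bottom of an orbit of the two matchings with 2 κ + 2 elements.
    record Orb (b : P) (κ : ℕ) : Set where
      field
        b⊑v  : b ⊑ v
        bot  : Bot b
        nm   : NoMeet b κ
        meet : ∀ β → c β (suc κ) b ≡ c (not β) (suc κ) b

      mem-c : ∀ β i → c β i b ⊑ v
      mem-c = c-mem b⊑v

      up-at : ∀ β {i} → i ≤ κ → Up (X (op β i)) (c β i b)
      up-at β l = proj₁ (ladder b⊑v bot _ (NoMeet-≤ l nm) β)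

      dn-at : ∀ β {i} → i ≤ κ → Dn (X (op β i)) (c β (suc i) b)
      dn-at β {i} l = S.up⇒dn _ (mem-c β i) (up-at β l)

      top-dn : ∀ β γ → Dn (X γ) (c β (suc κ) b)
      top-dn β γ with two (op β κ) γ
      ... | inj₁ refl = dn-at β ≤-refl
      ... | inj₂ refl = subst (Dn (X (not (op β κ)))) (sym (meet β))
                          (subst (λ g → Dn (X g) (c (not β) (suc κ) b)) (op-not β κ) (dn-at (not β) ≤-refl))

      flip-at : ∀ β {i} → i ≤ κ → c (not β) i b ◁ c β (suc i) b
      flip-at β l = proj₂ (ladder b⊑v bot _ (NoMeet-≤ l nm) β)

      rk-at : ∀ β {i} → i ≤ suc κ → rk (c β i b) ≡ i + rk b
      rk-at β {zero}  l = refl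
      rk-at β {suc i} (s≤s l) = trans (proj₂ (up-at β l)) (cong suc (rk-at β (m≤n⇒m≤1+n l)))

    -- Both paths gain one rank per step and stay below `v`, so they meet within `suc (rk v)` steps,
    -- which is the fuel.
    find-orb : ∀ {b} → b ⊑ v → Bot b → ∃ (Orb b)
    find-orb {b} h bot = go (suc (rk v)) 0 (λ _ → λ { _ (s≤s _) () }) (+-identityʳ _)
      where
      rk≤ : ∀ i → NoMeet b i → i + rk b ≡ rk (c false i b)
      rk≤ zero    nm = refl
      rk≤ (suc i) nm = trans (cong suc (rk≤ i nm'))
                             (sym (proj₂ (proj₁ (ladder h bot i nm' false))))
        where nm' = NoMeet-≤ (n≤1+n i) nm
      go : ∀ n i → NoMeet b i → n + i ≡ suc (rk v) → ∃ (Orb b)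
      go zero i nm refl = ⊥-elim (1+n≰n (≤-trans (m≤m+n _ (rk b))
                            (≤-trans (≤-reflexive (rk≤ i nm)) (rk-mono (c-mem h false i)))))
      go (suc n) i nm e with c false (suc i) b Fin.≟ c true (suc i) b
      ... | yes q = i , record { b⊑v = h ; bot = bot ; nm = nm
                               ; meet = λ { false → q ; true → sym q } }
      ... | no nq = go n (suc i) nm' (trans (+-suc n i) e)
        where
        nm' : NoMeet b (suc i)
        nm' β j p q with m≤n⇒m<n∨m≡n q
        ... | inj₁ (s≤s l) = nm β j p l
        nm' false j p q | inj₂ refl = nq
        nm' true  j p q | inj₂ refl = λ r → nq (sym r)

    record At (u : P) : Set where
      constructor at′
      field
        {b}  : P
        {κ}  : ℕ
        orb  : Orb b κ
        β    : Bool
        i    : ℕ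
        i≤   : i ≤ suc κ
        loc  : u ≡ c β i b

    At-X : ∀ {u} (A : At u) γ → Σ (At (X γ u)) λ A' → At.b A' ≡ At.b A × At.κ A' ≡ At.κ A
    At-X (at′ o β zero l refl) γ = at′ o γ 1 (s≤s z≤n) refl , refl , refl
    At-X {u} (at′ {b} {κ} o β (suc i) (s≤s l) refl) γ with two (op β i) γ | m≤n⇒m<n∨m≡n l
    ... | inj₁ refl | _ = at′ o β i (m≤n⇒m≤1+n l) (S.inv _ (Orb.mem-c o β i)) , refl , refl
    ... | inj₂ refl | inj₁ l' = at′ o β (suc (suc i)) (s≤s l') refl , refl , refl
    ... | inj₂ refl | inj₂ refl = at′ o (not β) i (n≤1+n i)
            (trans (cong (X (not (op β i))) (Orb.meet o β))
              (trans (cong (λ g → X g (c (not β) (suc i) b)) (sym (op-not β i)))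
                     (S.inv _ (Orb.mem-c o (not β) i)))) , refl , refl

    -- Descend while one of the matchings goes down; the descent stops at the bottom of an orbit,
    -- and `At-X` retraces it.
    locate : ∀ {u} → u ⊑ v → At u
    locate {u} h = go u (<-wellFounded _) h
      where
      go : ∀ u → Acc _<_ (rk u) → u ⊑ v → At u
      go u (acc rs) h = choose (S.cov false h) (S.cov true h)
        where
        desc : ∀ γ → Dn (X γ) u → At u
        desc γ d = subst At (S.inv γ h)
          (proj₁ (At-X (go (X γ u) (rs (≤-reflexive (sym (proj₂ d)))) (S.mem γ h)) γ))
        choose : Up (X false) u ⊎ Dn (X false) u → Up (X true) u ⊎ Dn (X true) u → At u
        choose (inj₁ a) (inj₁ b) with find-orb h (λ { false → a ; true → b })
        ... | κ , o = at′ o false 0 z≤n refl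
        choose (inj₂ d) _ = desc false d
        choose (inj₁ _) (inj₂ d) = desc true d

    flip-top : ∀ {b κ} → Orb b κ → ∀ β {i} → i ≤ κ → Dn (X (not (op β i))) (c β (suc i) b) →
               c β (suc i) b ≡ c (not β) (suc i) b
    flip-top o β l d with m≤n⇒m<n∨m≡n l
    ... | inj₁ l'   = ⊥-elim (◁-asym (Orb.up-at o β l') d)
    ... | inj₂ refl = Orb.meet o β

    -- Walk down both orbits with the same matching. If the two positions were reached by different
    -- matchings, then both matchings go down there, so the element is a top and its other path may
    -- be used instead.
    bot-unique : ∀ {b κ b' κ'} → Orb b κ → Orb b' κ' → ∀ β i β' i' → i ≤ suc κ → i' ≤ suc κ' →
                 c β i b ≡ c β' i' b' → b ≡ b'
    bot-unique o o' β zero β' zero l l' e = e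
    bot-unique o o' β zero β' (suc i') l (s≤s l') e =
      ⊥-elim (◁-asym (subst (Up (X (op β' i'))) e (Orb.bot o _)) (Orb.dn-at o' β' l'))
    bot-unique o o' β (suc i) β' zero (s≤s l) l' e =
      ⊥-elim (◁-asym (subst (Up (X (op β i))) (sym e) (Orb.bot o' _)) (Orb.dn-at o β l))
    bot-unique {b} {κ} {b'} o o' β (suc i) β' (suc i') (s≤s l) (s≤s l') e with two (op β i) (op β' i')
    ... | inj₁ q = bot-unique o o' β i β' i' (m≤n⇒m≤1+n l) (m≤n⇒m≤1+n l')
          (trans (sym (S.inv _ (Orb.mem-c o β i)))
            (trans (cong (X (op β i)) e) (trans (cong (λ g → X g (X (op β' i') (c β' i' b'))) (sym q)) (S.inv _ (Orb.mem-c o' β' i')))))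
    ... | inj₂ q = bot-unique o o' (not β) i β' i' (m≤n⇒m≤1+n l) (m≤n⇒m≤1+n l')
          (trans (sym (S.inv _ (Orb.mem-c o (not β) i)))
            (trans (cong (X (op (not β) i)) (trans (sym (flip-top o β l dd)) e))
              (trans (cong (λ g → X g (X (op β' i') (c β' i' b'))) (trans (op-not β i) (sym q)))
                (S.inv _ (Orb.mem-c o' β' i')))))
      where
      dd : Dn (X (not (op β i))) (c β (suc i) b)
      dd = subst (Dn (X (not (op β i)))) (sym e)
             (subst (λ g → Dn (X g) (c β' (suc i') b')) q (Orb.dn-at o' β' l'))

    κ-unique : ∀ {b κ κ'} → Orb b κ → Orb b κ' → κ ≡ κ'
    κ-unique {κ = κ} {κ'} o o' with <-cmp κ κ'
    ... | tri< l _ _ = ⊥-elim (Orb.nm o' false (suc κ) (s≤s z≤n) l (Orb.meet o false))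
    ... | tri≈ _ e _ = e
    ... | tri> _ _ l = ⊥-elim (Orb.nm o false (suc κ') (s≤s z≤n) l (Orb.meet o' false))

    At-unique : ∀ {u} (A A' : At u) → At.b A ≡ At.b A' × At.κ A ≡ At.κ A'
    At-unique (at′ o β i l refl) (at′ o' β' i' l' e) with bot-unique o o' β i β' i' l l' e
    ... | refl = refl , κ-unique o o'

    -- An orbit has 2 κ + 2 elements, so its size is recorded by κ; the value 0 outside the interval
    -- is junk.
    cls : P → ℕ
    cls u with u ⊑? v
    ... | yes h = At.κ (locate h)
    ... | no _  = 0

    cls≡ : ∀ {u} (A : At u) → cls u ≡ At.κ A
    cls≡ {u} A with u ⊑? v
    ... | yes h = proj₂ (At-unique (locate h) A)
    ... | no n  = ⊥-elim (n (subst (_⊑ v) (sym (At.loc A)) (Orb.mem-c (At.orb A) (At.β A) (At.i A))))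

    cls-X : ∀ {u} → u ⊑ v → ∀ γ → cls (X γ u) ≡ cls u
    cls-X h γ with locate h
    ... | A with At-X A γ
    ... | A' , _ , e = trans (cls≡ A') (trans e (sym (cls≡ A)))

    module _ {z κz u κu} (oz : Orb z κz) (ou : Orb u κu) (zu : z ◁ u) where
      private
        module Z = Orb oz
        module U = Orb ou

      parallel-ascent : ∀ β i → i ≤ suc κz → i ≤ suc κu → c β i z ◁ c β i u
      parallel-ascent β zero    _ _ = zu
      parallel-ascent β (suc i) (s≤s l) (s≤s l') =
        S.s-up _ (parallel-ascent β i (m≤n⇒m≤1+n l) (m≤n⇒m≤1+n l')) (U.mem-c β i) (Z.up-at β l) (U.up-at β l')

      -- Climb both orbits in parallel. If that of `u` closes first, `s-eq` makes the orbits share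
      -- an element. If that of `z` closes first, its top and the two elements of level κz over `u`
      -- are three common lower covers of the two elements of the next level over `u`, against `K↓`.
      adjacent-bottoms : 1 ≤ κz → κz ≡ κu
      adjacent-bottoms k≥1 with <-cmp κz κu
      ... | tri≈ _ e _ = e
      ... | tri> _ _ l = ⊥-elim (◁-irrefl (subst (_◁ u)
              (bot-unique oz ou false (suc (suc κu)) false (suc κu) (s≤s l) ≤-refl
                (S.s-eq _ (parallel-ascent false (suc κu) (≤-trans l (n≤1+n κz)) ≤-refl)
                  (U.mem-c false (suc κu)) (Z.up-at false l) (U.top-dn false _))) zu))
      ... | tri< l _ _ = ⊥-elim (K↓
              (U.nm false (suc κz) (s≤s z≤n) l)
              (U.nm false κz k≥1 (<⇒≤ l))
              (neq false) (neq true)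
              (U.up-at false (<⇒≤ l)) (U.flip-at false (<⇒≤ l)) (parallel-ascent false (suc κz) ≤-refl (m≤n⇒m≤1+n l))
              (U.flip-at true (<⇒≤ l)) (U.up-at true (<⇒≤ l))
              (subst (_◁ c true (suc κz) u) (sym (Z.meet false)) (parallel-ascent true (suc κz) ≤-refl (m≤n⇒m≤1+n l)))) 
        where
        neq : ∀ β → ¬ c β κz u ≡ c false (suc κz) z
        neq β e = ◁-asym (U.up-at β (<⇒≤ l)) (subst (Dn (X (op β κz))) (sym e) (Z.top-dn false _))

    -- When the same matching comes next at both ends of an edge, the same matchings lead down from
    -- both, and `s-dn` moves the edge down until one end is a bottom. The lower end cannot arrive
    -- first, since `s-eq` would put both ends into one orbit.
    parallel-descent : ∀ {b κ b' κ'} (o : Orb b κ) (o' : Orb b' κ') → ¬ b ≡ b' →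
      ∀ β β' i j → i ≤ κ → j ≤ κ' → op β i ≡ op β' j → c β i b ◁ c β' j b' →
      (i ≡ j × b ◁ b') ⊎ ∃ λ k → 1 ≤ k × k + j ≡ i × c β k b ◁ b'
    parallel-descent o o' ne β β' zero    zero    l l' q cv = inj₁ (refl , cv)
    parallel-descent o o' ne β β' (suc i) zero    l l' q cv = inj₂ (suc i , s≤s z≤n , +-identityʳ _ , cv)
    parallel-descent {b} o o' ne β β' zero (suc j) l l' q cv =
      ⊥-elim (ne (bot-unique o o' (op β' j) 1 β' (suc j) (s≤s z≤n) (m≤n⇒m≤1+n l')
        (S.s-eq _ cv (Orb.mem-c o' β' (suc j)) (Orb.bot o _) (Orb.dn-at o' β' (<⇒≤ l')))))
    parallel-descent {b} {b' = b'} o o' ne β β' (suc i) (suc j) l l' q cv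
      with parallel-descent o o' ne β β' i j (<⇒≤ l) (<⇒≤ l') q'
             (subst₂ _◁_ (S.inv _ (Orb.mem-c o β i))
                         (S.inv _ (Orb.mem-c o' β' j))
               (subst (λ g → X (op β i) (c β (suc i) b) ◁ X g (c β' (suc j) b')) q'
                 (S.s-dn _ cv (Orb.mem-c o' β' (suc j)) (Orb.dn-at o β (<⇒≤ l))
                   (subst (λ g → Dn (X g) (c β' (suc j) b')) (sym q') (Orb.dn-at o' β' (<⇒≤ l'))))))
      where q' = Bool.not-injective q
    ... | inj₁ (refl , r) = inj₁ (refl , r)
    ... | inj₂ (k , p , refl , r) = inj₂ (k , p , +-suc k j , r)

    not-top : ∀ {u} (A : At u) γ → Up (X γ) u → At.i A ≤ At.κ A
    not-top (at′ o β i l refl) γ h with m≤n⇒m<n∨m≡n l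
    ... | inj₁ (s≤s l') = l'
    ... | inj₂ refl     = ⊥-elim (◁-asym h (Orb.top-dn o β γ))

    op-up : ∀ {b κ} → Orb b κ → ∀ β i γ → i ≤ κ → 1 ≤ i → Up (X γ) (c β i b) → op β i ≡ γ
    op-up {b} o β (suc i) γ l _ h with two (op β i) γ
    ... | inj₁ refl = ⊥-elim (◁-asym h (Orb.dn-at o β (<⇒≤ l)))
    ... | inj₂ refl = refl

    lowest-other : ∀ {b x} → b ⊑ v → Bot b → ∀ β i → i ≡ 0 → c β i b ◁ x → x ⊑ v →
                   Dn (X (not (op β i))) x → x ≡ c (not β) (suc i) b
    lowest-other _ bt β .0 refl cv h d = sym (S.s-eq (not β) cv h (bt (not β)) d)

    -- By `thin` there is a second element x' between the predecessor of `c β i b` and y. It turns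
    -- out to be `c (not β) i b`; then the two elements of level i have y as a common cover besides
    -- the two elements of the next level, unless i = κ.
    interior-below-bottom : ∀ i {b κ y κy} → Orb b κ → Orb y κy → ∀ β → 1 ≤ i → i ≤ κ →
      c β i b ◁ y → ¬ κy ≡ κ → i ≡ κ × c (not β) i b ◁ y
    interior-below-bottom i = go i (<-wellFounded i)
      where
      go : ∀ i → Acc _<_ i → ∀ {b κ y κy} → Orb b κ → Orb y κy → ∀ β → 1 ≤ i → i ≤ κ →
           c β i b ◁ y → ¬ κy ≡ κ → i ≡ κ × c (not β) i b ◁ y
      go (suc i) (acc rs) {b} {κ} {y} {κy} o oy β _ l xy ne = finish x'≡
        where
        module O = Orb o
        module Y = Orb oy
        κ≥1 : 1 ≤ κ
        κ≥1 = ≤-trans (s≤s z≤n) l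
        g : Bool
        g = op β i
        T : ∃ λ x' → ¬ x' ≡ c β (suc i) b × c β i b ◁ x' × x' ◁ y
        T = thin (O.up-at β (<⇒≤ l)) xy
        x' : P
        x' = proj₁ T
        px' : c β i b ◁ x'
        px' = proj₁ (proj₂ (proj₂ T))
        x'y : x' ◁ y
        x'y = proj₂ (proj₂ (proj₂ T))
        x'v : x' ⊑ v
        x'v = ⊑-trans (proj₁ x'y) Y.b⊑v
        up-g : Up (X g) x'
        up-g with S.cov g x'v
        ... | inj₁ u = u
        ... | inj₂ d = ⊥-elim (proj₁ (proj₂ T) (sym (S.s-eq g px' x'v (O.up-at β (<⇒≤ l)) d)))
        both-bottom : ∀ {κ'} → Orb x' κ' → κ' ≡ κ → ⊥
        both-bottom o' refl = ne (sym (adjacent-bottoms o' oy x'y κ≥1))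
        same-class : ∀ {b' κ' j} → Orb b' κ' → (β' : Bool) → 1 ≤ j → j ≤ i → c β' j b' ≡ x' → κ' ≡ κ → ⊥
        same-class {j = j} o' β' p q e refl =
          1+n≰n (≤-trans l (≤-trans (≤-reflexive (sym (proj₁ (go j (rs (s≤s q)) o' oy β' p
            (≤-trans q (<⇒≤ l)) (subst (_◁ y) (sym e) x'y) ne)))) q))
        low : ∀ {b' κ' k} → Orb b' κ' → (β₁ : Bool) → 1 ≤ k → k ≤ i → c β₁ k b ◁ b' → κ' ≡ κ
        low {κ' = κ'} {k} o' β₁ p q cv with κ' ≟ κ
        ... | yes e  = e
        ... | no ne' = ⊥-elim (1+n≰n (≤-trans l (≤-trans (≤-reflexive (sym (proj₁ (go k (rs (s≤s q)) o o' β₁ p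
                         (≤-trans q (<⇒≤ l)) cv ne')))) q)))
        either-up : ∀ {γ} → Up (X (not g)) x' → γ ≡ g ⊎ γ ≡ not g → Up (X γ) x'
        either-up u (inj₁ q) = subst (λ h → Up (X h) x') (sym q) up-g
        either-up u (inj₂ q) = subst (λ h → Up (X h) x') (sym q) u
        -- As a bottom, x' has an orbit of size κ, by induction or by `adjacent-bottoms`; then so
        -- has its cover y, which is excluded.
        bottom : Bot x' → ⊥
        bottom bt with find-orb x'v bt | n≡0⊎0<n i
        ... | κ' , o' | inj₁ q = both-bottom o' (sym (adjacent-bottoms o o' (subst (λ k → c β k b ◁ x') q px') κ≥1))
        ... | κ' , o' | inj₂ p = both-bottom o' (low o' β p ≤-refl px')
        at-x' : (A : At x') → Dn (X (not g)) x' → 1 ≤ i → x' ≡ c (not β) (suc i) b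
        at-x' A@(at′ o' β' zero l' refl) d i≥1 = ⊥-elim (◁-asym (Orb.bot o' _) d)
        at-x' A@(at′ {b'} o' β' (suc j) l' e) d i≥1 with b' Fin.≟ b
        ... | yes refl with suc-injective (+-cancelʳ-≡ (rk b) (suc j) (suc i) (trans (sym (Orb.rk-at o' β' l')) (trans (cong rk (sym e)) (trans (proj₂ px') (cong suc (O.rk-at β (≤-trans (<⇒≤ l) (n≤1+n _))))))))
        ...   | refl with two β β'
        ...     | inj₂ refl = e
        ...     | inj₁ refl = ⊥-elim (proj₁ (proj₂ T) e)
        at-x' A@(at′ {b'} o' β' (suc j) l' e) d i≥1 | no ne'
          with parallel-descent o o' (λ q → ne' (sym q)) β β' i (suc j) (<⇒≤ l) (not-top A g up-g)
                 (sym (op-up o' β' (suc j) g (not-top A g up-g) (s≤s z≤n) (subst (Up (X g)) e up-g)))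
                 (subst (c β i b ◁_) e px')
        ... | inj₁ (ieq , cv) = ⊥-elim (same-class o' β' (s≤s z≤n) (≤-reflexive (sym ieq)) (sym e) (sym (adjacent-bottoms o o' cv κ≥1)))
        ... | inj₂ (k , k≥1 , ieq , cv) = ⊥-elim (same-class o' β' (s≤s z≤n) (≤-trans (m≤n+m (suc j) k) (≤-reflexive ieq)) (sym e)
                  (low o' β k≥1 (≤-trans (m≤m+n k (suc j)) (≤-reflexive ieq)) cv))
        x'≡ : x' ≡ c (not β) (suc i) b
        x'≡ with S.cov (not g) x'v
        ... | inj₁ u = ⊥-elim (bottom λ γ → either-up u (two g γ))
        ... | inj₂ d with n≡0⊎0<n i
        ...   | inj₁ q = lowest-other O.b⊑v O.bot β i q px' x'v d
        ...   | inj₂ p = at-x' (locate x'v) d p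
        finish : x' ≡ c (not β) (suc i) b → suc i ≡ κ × c (not β) (suc i) b ◁ y
        finish e with m≤n⇒m<n∨m≡n l
        ... | inj₂ q = q , subst (_◁ y) e x'y
        -- Below level κ the two elements of the next level and y are three common covers, against
        -- `K↑`.
        ... | inj₁ l' = ⊥-elim (K↑ (O.nm β (suc i) (s≤s z≤n) l) (O.nm β (suc (suc i)) (s≤s z≤n) l')
                (neq β) (neq (not β))
                (O.up-at β l) (subst (λ γ → c γ (suc i) b ◁ c (not β) (suc (suc i)) b) (Bool.not-involutive β) (O.flip-at (not β) l)) xy
                (O.flip-at β l) (O.up-at (not β) l) (subst (_◁ y) e x'y))
          where
          neq : ∀ γ → ¬ c γ (suc (suc i)) b ≡ y
          neq γ q = ◁-asym (subst (Up (X (op γ (suc i)))) (sym q) (Y.bot _)) (O.dn-at γ l)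

    top≡ : ∀ {b κ} → Orb b κ → ∀ β β' → c β (suc κ) b ≡ c β' (suc κ) b
    top≡ o β β' with two β β'
    ... | inj₁ refl = refl
    ... | inj₂ refl = Orb.meet o β

    top-step : ∀ {b κ} → Orb b κ → ∀ β γ → ∃ λ β' → op β' κ ≡ γ × X γ (c β (suc κ) b) ≡ c β' κ b
    top-step {b} {κ} o β γ with op-hit γ κ
    ... | β' , refl = β' , refl , trans (cong (X (op β' κ)) (top≡ o β β')) (S.inv _ (Orb.mem-c o β' κ))

    -- Let γ go up at x. Then γ goes up at y too, since otherwise x and y share an orbit, and the
    -- other matching goes down at both. `parallel-descent` brings the edge to the bottom of the
    -- orbit of y, where `adjacent-bottoms` and `interior-below-bottom` leave no room.
    no-up : ∀ {x y} (A : At x) (B : At y) → x ◁ y → 1 ≤ At.κ A → ¬ At.κ A ≡ At.κ B →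
            1 ≤ At.i B → ∀ γ → ¬ Up (X γ) x
    no-up A@(at′ {b} {κ} o β i l refl) B@(at′ {b'} {κ'} o' β' (suc j) l'@(s≤s l₁) refl) xy κ≥1 ne _ γ u =
      go (S.cov γ yv) (two γ (op β' j))
      where
      yv : c β' (suc j) b' ⊑ v
      yv = Orb.mem-c o' β' (suc j)
      same : ∀ δ → Up (X δ) (c β i b) → Dn (X δ) (c β' (suc j) b') → ⊥
      same δ u' d with At-X A δ
      ... | A' , _ , q = ne (trans (sym q) (proj₂ (At-unique A' (at′ o' β' (suc j) l' (S.s-eq δ xy yv u' d)))))
      go : Up (X γ) (c β' (suc j) b') ⊎ Dn (X γ) (c β' (suc j) b') → op β' j ≡ γ ⊎ op β' j ≡ not γ → ⊥
      go (inj₂ d) _ = same γ u d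
      go (inj₁ uy) (inj₁ q) = ◁-asym uy (subst (λ g → Dn (X g) (c β' (suc j) b')) q (Orb.dn-at o' β' l₁))
      go (inj₁ uy) (inj₂ q) = low i refl (not-top A γ u)
        where
        dy : Dn (X (not γ)) (c β' (suc j) b')
        dy = subst (λ g → Dn (X g) (c β' (suc j) b')) q (Orb.dn-at o' β' l₁)
        dx : Dn (X (not γ)) (c β i b)
        dx with S.cov (not γ) (Orb.mem-c o β i)
        ... | inj₁ u' = ⊥-elim (same (not γ) u' dy)
        ... | inj₂ d  = d
        ne-b : ¬ b ≡ b'
        ne-b refl = ne (κ-unique o o')
        low : ∀ k → k ≡ i → i ≤ κ → ⊥
        low zero refl _ = ◁-asym (Orb.bot o _) dx
        low (suc k) refl lκ with parallel-descent o o' ne-b β β' (suc k) (suc j) lκ (not-top B γ uy)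
             (trans (op-up o β (suc k) γ lκ (s≤s z≤n) u) (sym (op-up o' β' (suc j) γ (not-top B γ uy) (s≤s z≤n) uy))) xy
        ... | inj₁ (_ , cv) = ne (adjacent-bottoms o o' cv κ≥1)
        ... | inj₂ (n , n≥1 , eq , cv) = m+1+n≰m κ {j} (≤-trans (≤-reflexive (trans (cong (_+ suc j)
                 (sym (proj₁ (interior-below-bottom n o o' β n≥1 (≤-trans (m≤m+n n (suc j)) (≤-trans (≤-reflexive eq) lκ)) cv
                   (λ q → ne (sym q)))))) eq)) lκ)

    -- Between orbits of different sizes the axioms hold even if one matching acts on x and the
    -- other on y. Such an edge either leads to a bottom, when its lower end is just under a top, or
    -- starts at a top and ends on the first level; in both cases it comes with its mirror image, by
    -- `interior-below-bottom`.
    mixed : ∀ {x y} (A : At x) (B : At y) → x ◁ y → 1 ≤ At.κ A → 1 ≤ At.κ B → ¬ At.κ A ≡ At.κ B → ∀ γ δ →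
      (Up (X γ) x → Dn (X δ) y → ⊥) ×
      (Up (X γ) x → Up (X δ) y → X γ x ◁ X δ y) ×
      (Dn (X γ) x → Dn (X δ) y → X γ x ◁ X δ y)
    mixed A@(at′ {b} {κ} o β i l refl) B@(at′ {y} {κ'} o' β' zero _ refl) xy κ≥1 κ'≥1 ne γ δ =
      (λ _ d → ◁-asym (Orb.bot o' δ) d) , (λ u _ → go i refl (not-top A γ u) u) , λ _ d → ⊥-elim (◁-asym (Orb.bot o' δ) d)
      where
      go : ∀ k → k ≡ i → i ≤ κ → Up (X γ) (c β i b) → X γ (c β i b) ◁ X δ y
      go zero refl _ _ = ⊥-elim (ne (adjacent-bottoms o o' xy κ≥1))
      go (suc k) refl lκ u with interior-below-bottom (suc k) o o' β (s≤s z≤n) lκ xy (λ q → ne (sym q))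
                              | op-up o β (suc k) γ lκ (s≤s z≤n) u
      ... | refl , cv | refl with two (op β (suc k)) δ
      ...   | inj₁ refl = S.s-up δ xy (Orb.b⊑v o') u (Orb.bot o' δ)
      ...   | inj₂ refl = subst₂ _◁_ (sym (Orb.meet o β)) (cong (λ g → X g y) (op-not β (suc k)))
                            (S.s-up _ cv (Orb.b⊑v o') (Orb.up-at o (not β) ≤-refl) (Orb.bot o' _))
    mixed A@(at′ {b} {κ} o β i l refl) B@(at′ {b'} {κ'} o' β' (suc j) (s≤s l') refl) xy κ≥1 κ'≥1 ne γ δ =
      (λ u _ → ⊥-elim (nu u)) , (λ u _ → ⊥-elim (nu u)) , λ _ → go i refl l (m≤n⇒m<n∨m≡n l')
      where
      nu : ∀ {γ} → ¬ Up (X γ) (c β i b)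
      nu = no-up A B xy κ≥1 ne (s≤s z≤n) _
      contra : ∀ {x y} (A : At x) (B : At y) → At.κ A ≡ κ → At.κ B ≡ κ' → 1 ≤ At.i B → x ◁ y → ∀ {γ} → ¬ Up (X γ) x
      contra A B refl refl i≥1 cv = no-up A B cv κ≥1 ne i≥1 _
      go : ∀ k → k ≡ i → k ≤ suc κ → j < κ' ⊎ j ≡ κ' → Dn (X δ) (c β' (suc j) b') → X γ (c β i b) ◁ X δ (c β' (suc j) b')
      go zero refl _ _ _ = ⊥-elim (nu (Orb.bot o γ))
      go (suc k) refl (s≤s lk) jj d with m≤n⇒m<n∨m≡n lk
      ... | inj₁ lk' = ⊥-elim (nu (Orb.up-at o β lk'))
      ... | inj₂ refl with jj
      -- If y is a top too, γ lowers both ends; the new lower end goes up again, which `no-up`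
      -- forbids as the new upper end is no bottom.
      ...   | inj₂ refl = ⊥-elim (stuck (top-step o' β' γ))
        where
        stuck : (∃ λ β₁ → op β₁ κ' ≡ γ × X γ (c β' (suc κ') b') ≡ c β₁ κ' b') → ⊥
        stuck (β₁ , _ , e) = contra (proj₁ (At-X A γ)) (at′ o' β₁ κ' (n≤1+n κ') e) (proj₂ (proj₂ (At-X A γ))) refl κ'≥1
              (S.s-dn γ xy (Orb.mem-c o' β' (suc κ')) (Orb.top-dn o β γ) (Orb.top-dn o' β' γ))
              (S.dn⇒up γ (Orb.mem-c o β (suc κ)) (Orb.top-dn o β γ))
      ...   | inj₁ jl with two (op β' j) δ
      ...     | inj₂ refl = ⊥-elim (◁-asym (Orb.up-at o' β' jl) d)
      ...     | inj₁ refl with n≡0⊎0<n j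
      ...       | inj₂ j≥1 = ⊥-elim (contra (proj₁ (At-X A δ)) (at′ o' β' j (m≤n⇒m≤1+n (<⇒≤ jl)) (S.inv δ (Orb.mem-c o' β' j)))
                     (proj₂ (proj₂ (At-X A δ))) refl j≥1 xyδ (S.dn⇒up δ (Orb.mem-c o β (suc κ)) (Orb.top-dn o β δ)))
        where
        xyδ : X δ (c β (suc κ) b) ◁ X δ (c β' (suc j) b')
        xyδ = S.s-dn δ xy (Orb.mem-c o' β' (suc j)) (Orb.top-dn o β δ) d
      -- Only the first level remains: `X δ y` is the bottom b', and it covers both elements just
      -- below the top x.
      ...       | inj₁ refl with top-step o β δ
      ...         | β₁ , _ , e₁ with top-step o β γ
      ...           | β₂ , _ , e₂ with two β₁ β₂
      ...             | inj₁ refl = subst (_◁ X δ (c β' 1 b')) (trans e₁ (sym e₂)) xyδ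
        where
        xyδ : X δ (c β (suc κ) b) ◁ X δ (c β' (suc j) b')
        xyδ = S.s-dn δ xy (Orb.mem-c o' β' (suc j)) (Orb.top-dn o β δ) d
      ...             | inj₂ refl = subst₂ _◁_ (sym e₂) (sym b'≡)
                (proj₂ (interior-below-bottom κ o o' β₁ κ≥1 ≤-refl
                  (subst₂ _◁_ e₁ b'≡ (S.s-dn δ xy (Orb.mem-c o' β' (suc j)) (Orb.top-dn o β δ) d)) (λ q → ne (sym q))))
        where
        b'≡ : X δ (X δ b') ≡ b'
        b'≡ = S.inv δ (Orb.b⊑v o')

  -- T M x u is (q − 1) x u + q x (M u) or x (M u), according as M goes up or down at u.
  Tₘ : P → (P → Poly) → P → Poly
  Tₘ m x u with rk u <? rk m
  ... | yes _ = mix (x u) (x m)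
  ... | no  _ = x m

  T : (P → P) → (P → Poly) → P → Poly
  T M x u = Tₘ (M u) x u

  T-up : ∀ {m u} x → u ◁ m → Tₘ m x u ≈P mix (x u) (x m)
  T-up {m} {u} x (_ , e) with rk u <? rk m
  ... | yes _ = λ _ → refl
  ... | no nl = ⊥-elim (nl (≤-reflexive (sym e)))

  T-dn : ∀ {m u} x → m ◁ u → Tₘ m x u ≈P x m
  T-dn {m} {u} x (_ , e) with rk u <? rk m
  ... | yes l = ⊥-elim (<-asym l (≤-reflexive (sym e)))
  ... | no  _ = λ _ → refl

  T-congₘ : ∀ {m x y u} → x u ≈P y u → x m ≈P y m → Tₘ m x u ≈P Tₘ m y u
  T-congₘ {m} {u = u} p q with rk u <? rk m
  ... | yes _ = mix-cong p q
  ... | no  _ = q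

  module _ {v M} (S : Spec v M) where
    open Spec S

    -- The quadratic relation T² = (q - 1) T + q of the Hecke algebra, checked on each pair {u, M
    -- u}.
    T-quad : ∀ x {u} → u ⊑ v → T M (T M x) u ≈P mix (T M x u) (x u)
    T-quad x {u} h with cov h
    ... | inj₁ p = ≈P-trans (T-up (T M x) p) (mix-cong (λ _ → refl)
                     (≈P-trans (T-dn x (up⇒dn h p)) (≡⇒≈P (cong x (inv h)))))
    ... | inj₂ d = ≈P-trans (T-dn (T M x) d) (≈P-trans (T-up x (dn⇒up h d))
                     (mix-cong (≈P-sym (T-dn x d)) (≡⇒≈P (cong x (inv h)))))

    T-mix : ∀ x y {u} → u ⊑ v → T M (λ z → mix (x z) (y z)) u ≈P mix (T M x u) (T M y u)
    T-mix x y {u} h with cov h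
    ... | inj₁ p = ≈P-trans (T-up _ p) (≈P-trans (mix-interchange (x u) (y u) (x (M u)) (y (M u)))
                     (mix-cong (≈P-sym (T-up x p)) (≈P-sym (T-up y p))))
    ... | inj₂ d = ≈P-trans (T-dn _ d) (mix-cong (≈P-sym (T-dn x d)) (≈P-sym (T-dn y d)))

    T-zero : ∀ {x u} → u ⊑ v → x u ≈P 0P → x (M u) ≈P 0P → T M x u ≈P 0P
    T-zero {x} {u} h p q with cov h
    ... | inj₁ c = ≈P-trans (T-up x c) (≈P-trans (mix-cong p q) mix-0)
    ... | inj₂ d = ≈P-trans (T-dn x d) q

  Calculates : (P → P → Poly) → P → (P → P) → Set
  Calculates R v M = ∀ {u} → u ⊑ v → R v u ≈P T M (R (M v)) u

  -- All special matchings calculate the same polynomials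

  module Calculation
    (noK : NoK)
    (R : P → P → Poly) (R-zero : ∀ {v u} → ¬ u ⊑ v → R v u ≈P 0P)
    (least : ∀ {x y} → rk x ≡ 0 → rk y ≡ 0 → x ≡ y)
    (chosen : ∀ {x v} → x ◁ v → ∃ λ M → Spec v M × Calculates R v M)
    (second : ∀ {v} → 2 ≤ rk v → (m : P) → ∃ λ K → Spec v K × ¬ K v ≡ m)
    where

    Calc : P → (P → P) → Set
    Calc = Calculates R

    some-spec : ∀ {x v} → x ◁ v → ∃ (Spec v)
    some-spec c with chosen c
    ... | M , S , _ = M , S

    -- `Calc` speaks only of elements below y. Elsewhere both sides vanish, because M stabilises the
    -- interval below y.
    Calc⁺ : ∀ {v M} (S : Spec v M) {y} → y ⊑ v → Dn M y → Calc y M →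
            ∀ {u} → u ⊑ v → R y u ≈P T M (R (M y)) u
    Calc⁺ {v} {M} S {y} yv d cy {u} h with u ⊑? y
    ... | yes p = cy p
    ... | no np = ≈P-trans (R-zero np) (≈P-sym (T-zero S h
          (R-zero λ q → np (⊑-trans q (proj₁ d)))
          (R-zero λ q → np (subst (_⊑ y) (Spec.inv S h) (mem-below S yv d (⊑-trans q (proj₁ d)))))))

    module Exchange
      {v : P} (ih : ∀ {w} → rk w < rk v → ∀ {M} → Spec w M → Calc w M)
      (X : Bool → P → P) (SX : ∀ β → Spec v (X β)) (distinct : ¬ X false v ≡ X true v)
      where
      open Orbits some-spec noK X SX
      private module S β = Spec (SX β)

      A : At v
      A = locate (⊑-refl v)
      w : P
      w = At.b A
      κ : ℕ
      κ = At.κ A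
      o : Orb w κ
      o = At.orb A
      module O = Orb o

      v≡top : ∃ λ β → v ≡ c β (suc κ) w
      v≡top = go A refl refl
        where
        go : ∀ (A' : At v) → At.b A' ≡ w → At.κ A' ≡ κ → ∃ λ β → v ≡ c β (suc κ) w
        go (at′ o' β i l e) refl refl with m≤n⇒m<n∨m≡n l
        ... | inj₁ (s≤s l') = ⊥-elim (◁-asym (Orb.up-at o' β l') (subst (Dn (X (op β i))) e (S.top-dn _)))
        ... | inj₂ refl     = β , e

      below-top : ∀ γ → ∃ λ β → op β κ ≡ γ × X γ v ≡ c β κ w
      below-top γ with v≡top
      ... | β , e with top-step o β γ
      ... | β' , q , e' = β' , q , trans (cong (X γ) e) e'

      κ≥1 : 1 ≤ κ
      κ≥1 with n≡0⊎0<n κ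
      ... | inj₂ p = p
      ... | inj₁ z = ⊥-elim (distinct (trans (at-bottom false) (sym (at-bottom true))))
        where
        at-bottom : ∀ γ → X γ v ≡ w
        at-bottom γ with below-top γ
        ... | β , _ , e = trans e (cong (λ k → c β k w) z)

      rk-c< : ∀ β {i} → i ≤ κ → rk (c β i w) < rk v
      rk-c< β {i} l with v≡top
      ... | β' , e = subst (suc (rk (c β i w)) ≤_) (trans (sym (O.rk-at β' ≤-refl)) (cong rk (sym e)))
            (s≤s (≤-trans (≤-reflexive (O.rk-at β (m≤n⇒m≤1+n l))) (+-monoˡ-≤ (rk w) l)))

      w₁ : P
      w₁ = X true w
      w₁⊑v : w₁ ⊑ v
      w₁⊑v = O.mem-c true 1
      w₁-dn : Dn (X true) w₁
      w₁-dn = O.dn-at true z≤n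

      -- M′ is X true on the orbits of the same size as that of v and X false elsewhere. It is
      -- special below w₁ and sends w₁ to w, so by induction it calculates the same R w₁ as X true:
      -- off the class of v the operators of X false and X true agree on R w.
      M′ : P → P
      M′ u with cls u ≟ κ
      ... | yes _ = X true u
      ... | no  _ = X false u

      M′-in : ∀ {u} → cls u ≡ κ → M′ u ≡ X true u
      M′-in {u} e with cls u ≟ κ
      ... | yes _ = refl
      ... | no n  = ⊥-elim (n e)

      M′-out : ∀ {u} → ¬ cls u ≡ κ → M′ u ≡ X false u
      M′-out {u} n with cls u ≟ κ
      ... | yes e = ⊥-elim (n e)
      ... | no _  = refl

      M′-X : ∀ u → ∃ λ γ → M′ u ≡ X γ u
      M′-X u with cls u ≟ κ
      ... | yes _ = true , refl
      ... | no  _ = false , refl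

      -- An orbit with κ = 0 is a pair matched by both matchings alike. This disposes of the edges
      -- to which `mixed` does not apply.
      cls0 : ∀ {u} → u ⊑ v → cls u ≡ 0 → ∀ γ δ → X γ u ≡ X δ u
      cls0 h z γ δ with locate h
      ... | A'@(at′ {κ = zero} o' β zero l refl) = top≡ o' γ δ
      ... | A'@(at′ {κ = zero} o' β 1 l refl) with top-step o' β γ | top-step o' β δ
      ...   | _ , _ , e | _ , _ , e' = trans e (sym e')
      cls0 h z γ δ | at′ {κ = zero} o' β (suc (suc i)) (s≤s ()) e
      cls0 h z γ δ | A'@(at′ {κ = suc κ'} o' β i l e) with trans (sym (cls≡ A')) z
      ... | ()

      mixed-pair : ∀ {x y} → x ◁ y → y ⊑ v → ¬ cls x ≡ cls y →
        (cls x ≡ 0 ⊎ cls y ≡ 0) ⊎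
        (∀ γ δ → (Up (X γ) x → Dn (X δ) y → ⊥) ×
                 (Up (X γ) x → Up (X δ) y → X γ x ◁ X δ y) ×
                 (Dn (X γ) x → Dn (X δ) y → X γ x ◁ X δ y))
      mixed-pair {x} {y} xy h ne with n≡0⊎0<n (cls x) | n≡0⊎0<n (cls y)
      ... | inj₁ z | _      = inj₁ (inj₁ z)
      ... | inj₂ _ | inj₁ z = inj₁ (inj₂ z)
      ... | inj₂ p | inj₂ q = inj₂ (mixed Ax Ay xy (subst (1 ≤_) (cls≡ Ax) p) (subst (1 ≤_) (cls≡ Ay) q)
                                (λ e → ne (trans (cls≡ Ax) (trans e (sym (cls≡ Ay))))))
        where
        Ax : At x
        Ax = locate (⊑-trans (proj₁ xy) h)
        Ay : At y
        Ay = locate h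

      record Compat (x y : P) (a b : P) : Set where
        field
          c-up : x ◁ a → y ◁ b → a ◁ b
          c-dn : a ◁ x → b ◁ y → a ◁ b
          c-eq : x ◁ a → b ◁ y → a ≡ y

      compat : ∀ {x y} → x ◁ y → y ⊑ v → ∀ γ → Compat x y (X γ x) (X γ y)
      compat xy h γ = record { c-up = S.s-up γ xy h ; c-dn = S.s-dn γ xy h ; c-eq = S.s-eq γ xy h }

      compat-mixed : ∀ {x y} → x ◁ y → y ⊑ v → ¬ cls x ≡ cls y → ∀ γ δ → Compat x y (X γ x) (X δ y)
      compat-mixed {x} {y} xy h ne γ δ with mixed-pair xy h ne
      ... | inj₁ (inj₁ z) = subst (λ t → Compat x y t (X δ y)) (cls0 (⊑-trans (proj₁ xy) h) z δ γ) (compat xy h δ)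
      ... | inj₁ (inj₂ z) = subst (Compat x y (X γ x)) (cls0 h z γ δ) (compat xy h γ)
      ... | inj₂ f with f γ δ
      ...   | p , q , r = record { c-up = q ; c-dn = r ; c-eq = λ u d → ⊥-elim (p u d) }

      compat-M′ : ∀ {x y} → x ◁ y → y ⊑ v → Compat x y (M′ x) (M′ y)
      compat-M′ {x} {y} xy h with cls x ≟ cls y
      ... | no ne with M′-X x | M′-X y
      ...   | γ , e | δ , e' = subst₂ (Compat x y) (sym e) (sym e') (compat-mixed xy h ne γ δ)
      compat-M′ {x} {y} xy h | yes q with cls x ≟ κ
      ... | yes e = subst (Compat x y _) (sym (M′-in (trans (sym q) e))) (compat xy h true)
      ... | no n  = subst (Compat x y _) (sym (M′-out (λ e → n (trans q e)))) (compat xy h false)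

      closure : ∀ {u} → u ⊑ w₁ → M′ u ⊑ w₁
      closure = ascend (λ u → M′ u ⊑ w₁) base step
        where
        cls-w₁ : cls w₁ ≡ κ
        cls-w₁ = cls≡ (at′ o true 1 (s≤s z≤n) refl)
        base : M′ w₁ ⊑ w₁
        base = subst (_⊑ w₁) (sym (M′-in cls-w₁)) (proj₁ w₁-dn)
        cov-M′ : ∀ {u} → u ⊑ v → Up M′ u ⊎ Dn M′ u
        cov-M′ {u} h with M′-X u
        ... | γ , e = subst (λ t → u ◁ t ⊎ t ◁ u) (sym e) (S.cov γ h)
        step : ∀ {x y} → x ◁ y → y ⊑ w₁ → M′ y ⊑ w₁ → M′ x ⊑ w₁
        step {x} {y} xy h q with cov-M′ (⊑-trans (proj₁ xy) (⊑-trans h w₁⊑v))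
        ... | inj₂ d = ⊑-trans (proj₁ d) (⊑-trans (proj₁ xy) h)
        ... | inj₁ u with cov-M′ (⊑-trans h w₁⊑v)
        ...   | inj₁ u' = ⊑-trans (proj₁ (Compat.c-up (compat-M′ xy (⊑-trans h w₁⊑v)) u u')) q
        ...   | inj₂ d' = subst (_⊑ w₁) (sym (Compat.c-eq (compat-M′ xy (⊑-trans h w₁⊑v)) u d')) h

      M′-invol : ∀ {u} → u ⊑ v → M′ (M′ u) ≡ u
      M′-invol {u} h with cls u ≟ κ
      ... | yes e = trans (M′-in (trans (cls-X h true) e)) (S.inv true h)
      ... | no n  = trans (M′-out (λ e → n (trans (sym (cls-X h false)) e))) (S.inv false h)

      spec-M′ : Spec w₁ M′
      spec-M′ = record
        { inv  = λ h → M′-invol (⊑-trans h w₁⊑v)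
        ; mem  = closure
        ; cov  = cov-M′
        ; s-up = λ xy h → Compat.c-up (compat-M′ xy (⊑-trans h w₁⊑v))
        ; s-dn = λ xy h → Compat.c-dn (compat-M′ xy (⊑-trans h w₁⊑v))
        ; s-eq = λ xy h → Compat.c-eq (compat-M′ xy (⊑-trans h w₁⊑v))
        }
        where
        cov-M′ : ∀ {u} → u ⊑ w₁ → Up M′ u ⊎ Dn M′ u
        cov-M′ {u} h with M′-X u
        ... | γ , e = subst (λ t → u ◁ t ⊎ t ◁ u) (sym e) (S.cov γ (⊑-trans h w₁⊑v))

      T-off-class : ∀ {u} → u ⊑ v → ¬ cls u ≡ κ → T (X false) (R w) u ≈P T (X true) (R w) u
      T-off-class {u} h ne with u ⊑? w₁
      ... | yes p = ≈P-trans (≡⇒≈P (cong (λ t → Tₘ t (R w) u) (sym (M′-out ne))))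
                   (≈P-trans (≡⇒≈P (cong (λ t → T M′ (R t) u) (sym M′w₁)))
                   (≈P-trans (≈P-sym (ih (rk-c< true κ≥1) spec-M′ p))
                   (≈P-trans (ih (rk-c< true κ≥1) (restrict (SX true) w₁⊑v w₁-dn) p)
                     (≡⇒≈P (cong (λ t → T (X true) (R t) u) (S.inv true O.b⊑v))))))
        where
        M′w₁ : M′ w₁ ≡ w
        M′w₁ = trans (M′-in (cls≡ (at′ o true 1 (s≤s z≤n) refl))) (S.inv true O.b⊑v)
      -- Outside the interval below w₁ everything vanishes: this interval is stable under `X true`,
      -- and under M′, which is `X false` off the class of v.
      ... | no np = ≈P-trans
          (T-zero (SX false) h (R-zero u⋢w) (R-zero λ q → np (subst (_⊑ w₁)
            (trans (M′-out (λ e → ne (trans (sym (cls-X h false)) e))) (S.inv false h)) (closure (⊑-trans q w⊑w₁)))))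
          (≈P-sym (T-zero (SX true) h (R-zero u⋢w) (R-zero λ q → np (subst (_⊑ w₁) (S.inv true h)
            (mem-below (SX true) w₁⊑v w₁-dn (⊑-trans q w⊑w₁))))))
        where
        w⊑w₁ : w ⊑ w₁
        w⊑w₁ = proj₁ (O.bot true)
        u⋢w : ¬ u ⊑ w
        u⋢w q = np (⊑-trans q w⊑w₁)

      -- The alternating product of `i` Hecke operators in which `T (X β)` acts first. By `R-col` it
      -- takes `R w` up the path over w.
      col : Bool → ℕ → (P → Poly) → P → Poly
      col β zero    x = x
      col β (suc i) x = T (X (op β i)) (col β i x)

      R-col : ∀ β i → i ≤ κ → ∀ {u} → u ⊑ v → R (c β i w) u ≈P col β i (R w) u
      R-col β zero    l h = λ _ → refl
      R-col β (suc i) l {u} h = ≈P-trans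
        (Calc⁺ (SX (op β i)) (O.mem-c β (suc i)) (O.dn-at β (<⇒≤ l))
          (ih (rk-c< β l) (restrict (SX (op β i)) (O.mem-c β (suc i)) (O.dn-at β (<⇒≤ l)))) h)
        (≈P-trans (≡⇒≈P (cong (λ t → T (X (op β i)) (R t) u) (S.inv _ (O.mem-c β i))))
          (T-congₘ (R-col β i (<⇒≤ l) h) (R-col β i (<⇒≤ l) (S.mem _ h))))

      -- By induction T γ (T g y) may be replaced by T γ (T γ y), which is (q - 1) T γ y + q y by
      -- `T-quad`; by induction again, this does not depend on γ. Orbits off the class are stable,
      -- so all values used lie off the class.
      T-off-class-col : ∀ β i {u} → u ⊑ v → ¬ cls u ≡ κ → ∀ γ δ →
                        T (X γ) (col β i (R w)) u ≈P T (X δ) (col β i (R w)) u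
      T-off-class-col β i h ne γ δ with two γ δ
      ... | inj₁ refl = λ _ → refl
      T-off-class-col β zero h ne false δ | inj₂ refl = T-off-class h ne
      T-off-class-col β zero h ne true  δ | inj₂ refl = ≈P-sym (T-off-class h ne)
      T-off-class-col β (suc i) {u} h ne γ δ | inj₂ _ = ≈P-trans (lem γ) (≈P-sym (lem δ))
        where
        g : Bool
        g = op β i
        y : P → Poly
        y = col β i (R w)
        lem : ∀ γ → T (X γ) (T (X g) y) u ≈P mix (T (X g) y u) (y u)
        lem γ = ≈P-trans (T-congₘ (T-off-class-col β i h ne g γ)
                            (T-off-class-col β i (S.mem γ h) (λ e → ne (trans (sym (cls-X h γ)) e)) g γ))
               (≈P-trans (T-quad (SX γ) y h)
                         (mix-cong (T-off-class-col β i h ne γ g) (λ _ → refl)))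

      off-class : ∀ i {u} → u ⊑ v → ¬ cls u ≡ κ → col false i (R w) u ≈P col true i (R w) u
      off-class zero    h ne = λ _ → refl
      off-class (suc i) h ne = ≈P-trans (T-off-class-col false i h ne (op false i) (op true i))
        (T-congₘ (off-class i h ne) (off-class i (S.mem _ h) (λ e → ne (trans (sym (cls-X h _)) e))))

      col-cong : ∀ β i {x y} → (∀ {u} → u ⊑ v → x u ≈P y u) → ∀ {u} → u ⊑ v → col β i x u ≈P col β i y u
      col-cong β zero    e h = e h
      col-cong β (suc i) e h = T-congₘ (col-cong β i e h) (col-cong β i e (S.mem _ h))

      col-mix : ∀ β i x y {u} → u ⊑ v → col β i (λ z → mix (x z) (y z)) u ≈P mix (col β i x u) (col β i y u)
      col-mix β zero    x y h = λ _ → refl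
      col-mix β (suc i) x y h = ≈P-trans
        (T-congₘ (col-mix β i x y h) (col-mix β i x y (S.mem _ h)))
        (T-mix (SX (op β i)) (col β i x) (col β i y) h)

      col-shift : ∀ β i x → col β (suc i) x ≡ col (not β) i (T (X β) x)
      col-shift β zero    x = refl
      col-shift β (suc i) x = cong₂ (λ g y → T (X g) y) (sym (op-not β i)) (col-shift β i x)

      -- Every factor is evaluated where its matching goes down, hence only moves the argument one
      -- step towards b.
      col-bottom : ∀ {b} (o' : Orb b κ) β i → i ≤ suc κ → ∀ x → col β i x (c β i b) ≈P x b
      col-bottom o' β zero    l x = λ _ → refl
      col-bottom o' β (suc i) (s≤s l) x = ≈P-trans (T-dn (col β i x) (Orb.dn-at o' β l))
        (≈P-trans (≡⇒≈P (cong (col β i x) (S.inv _ (Orb.mem-c o' β i)))) (col-bottom o' β i (m≤n⇒m≤1+n l) x))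

      -- On an orbit of the size of that of v the two operators satisfy the braid relation.
      Good : P → Set
      Good u = ∀ β β' x → col β (suc κ) x u ≈P col β' (suc κ) x u

      -- At the lower element the product ending in γ unfolds by `T-up`. The other product becomes
      -- one of length κ + 2 at u; the braid relation at u, applied to T x in place of x, creates a
      -- square, and `T-quad` gives the same mixture. This is why `Good` quantifies over all x.
      good-step : ∀ {u} → u ⊑ v → ∀ γ → Dn (X γ) u → Good u → Good (X γ u)
      good-step {u} h γ d gd = to-any
        where
        u' : P
        u' = X γ u
        β : Bool
        β = proj₁ (op-hit γ κ)
        opβ : op β κ ≡ γ
        opβ = proj₂ (op-hit γ κ)
        lhs : ∀ x → col β (suc κ) x u' ≈P mix (col β (suc κ) x u) (col β κ x u)
        lhs x = ≈P-trans (≡⇒≈P (cong (λ g → T (X g) (col β κ x) u') opβ))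
               (≈P-trans (T-up (col β κ x) (S.dn⇒up γ h d))
               (mix-cong (≈P-sym (≈P-trans (≡⇒≈P (cong (λ g → T (X g) (col β κ x) u) opβ)) (T-dn (col β κ x) d)))
                         (≡⇒≈P (cong (col β κ x) (S.inv γ h)))))
        back : ∀ x → col (not β) (suc κ) x ≡ col β κ (T (X (not β)) x)
        back x = trans (col-shift (not β) κ x) (cong (λ g → col g κ (T (X (not β)) x)) (Bool.not-involutive β))
        rhs : ∀ x → col (not β) (suc κ) x u' ≈P mix (col (not β) (suc κ) x u) (col β κ x u)
        rhs x = ≈P-trans (≈P-sym (T-dn (col (not β) (suc κ) x) d))
               (≈P-trans (≡⇒≈P (cong (λ g → T (X g) (col (not β) (suc κ) x) u)
                    (sym (trans (cong not (op-not β κ)) (trans (Bool.not-involutive _) opβ)))))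
               (≈P-trans (≡⇒≈P (cong (λ y → y u) (col-shift (not β) (suc κ) x)))
               (≈P-trans (gd (not (not β)) (not β) (T (X (not β)) x))
               (≈P-trans (≡⇒≈P (cong (λ y → y u) (back (T (X (not β)) x))))
               (≈P-trans (col-cong β κ (T-quad (SX (not β)) x) h)
               (≈P-trans (col-mix β κ (T (X (not β)) x) x h)
                 (mix-cong (≡⇒≈P (cong (λ y → y u) (sym (back x)))) (λ _ → refl))))))))
        eq : ∀ x → col β (suc κ) x u' ≈P col (not β) (suc κ) x u'
        eq x = ≈P-trans (lhs x) (≈P-trans (mix-cong (gd β (not β) x) (λ _ → refl)) (≈P-sym (rhs x)))
        to-β : ∀ δ x → col δ (suc κ) x u' ≈P col β (suc κ) x u'
        to-β δ x with two β δ
        ... | inj₁ refl = λ _ → refl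
        ... | inj₂ refl = ≈P-sym (eq x)
        to-any : Good u'
        to-any δ δ' x = ≈P-trans (to-β δ x) (≈P-sym (to-β δ' x))

      -- At the top of the orbit both products evaluate to x b; from there `good-step` descends.
      good : ∀ {b} (o' : Orb b κ) β n i → n + i ≡ suc κ → Good (c β i b)
      good {b} o' β zero i refl δ δ' x = ≈P-trans (at-top δ) (≈P-sym (at-top δ'))
        where
        at-top : ∀ δ → col δ (suc κ) x (c β (suc κ) b) ≈P x b
        at-top δ = ≈P-trans (≡⇒≈P (cong (col δ (suc κ) x) (top≡ o' β δ))) (col-bottom o' δ (suc κ) ≤-refl x)
      good {b} o' β (suc n) i e = subst Good (S.inv _ (Orb.mem-c o' β i))
        (good-step (Orb.mem-c o' β (suc i)) (op β i)
          (Orb.dn-at o' β (≤-trans (m≤n+m i n) (≤-reflexive (suc-injective e))))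
          (good o' β n (suc i) (trans (+-suc n i) e)))

      col-equal : ∀ {u} → u ⊑ v → ∀ β β' → col β (suc κ) (R w) u ≈P col β' (suc κ) (R w) u
      col-equal {u} h β β' with cls u ≟ κ
      ... | no ne = sel β β'
        where
        sel : ∀ β β' → col β (suc κ) (R w) u ≈P col β' (suc κ) (R w) u
        sel false false = λ _ → refl
        sel false true  = off-class (suc κ) h ne
        sel true  false = ≈P-sym (off-class (suc κ) h ne)
        sel true  true  = λ _ → refl
      ... | yes e = on-class (locate h) (trans (sym (cls≡ (locate h))) e) β β' (R w)
        where
        on-class : (A' : At u) → At.κ A' ≡ κ → Good u
        on-class (at′ o' β i l refl) refl = good o' β (suc κ ∸ i) i (m∸n+n≡m l)

      R-below-top : ∀ γ → ∃ λ β → ∀ {u} → u ⊑ v → T (X γ) (R (X γ v)) u ≈P col β (suc κ) (R w) u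
      R-below-top γ with below-top γ
      ... | β , refl , e = β , λ {u} h → ≈P-trans (≡⇒≈P (cong (λ t → T (X γ) (R t) u) e))
                               (T-congₘ (R-col β κ ≤-refl h) (R-col β κ ≤-refl (S.mem _ h)))

      exchange : ∀ γ δ → Calc v (X γ) → Calc v (X δ)
      exchange γ δ cγ h with R-below-top γ | R-below-top δ
      ... | β , p | β' , q = ≈P-trans (cγ h) (≈P-trans (p h) (≈P-trans (col-equal h β β') (≈P-sym (q h))))

    exchange-pair : ∀ {v} → (∀ {w} → rk w < rk v → ∀ {M} → Spec w M → Calc w M) →
      ∀ {M N} → Spec v M → Spec v N → ¬ M v ≡ N v → Calc v M → Calc v N
    exchange-pair {v} ih {M} {N} SM SN ne = Exchange.exchange ih X SX ne false true
      where
      X : Bool → P → P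
      X false = M
      X true  = N
      SX : ∀ β → Spec v (X β)
      SX false = SM
      SX true  = SN

    -- Compare with the chosen matching M₀. Exchange needs different values at v; if they agree, a
    -- third matching with another value serves as a bridge. It exists from rank 2 on, and in rank 1
    -- the two matchings coincide.
    special-calculates : ∀ {v M} → Spec v M → Calc v M
    special-calculates {v} = go v (<-wellFounded _)
      where
      go : ∀ v → Acc _<_ (rk v) → ∀ {M} → Spec v M → Calc v M
      go v (acc rs) {M} SM = compare (M v Fin.≟ M₀ v)
        where
        ch : ∃ λ M₀ → Spec v M₀ × Calc v M₀
        ch = chosen (Spec.top-dn SM)
        M₀ : P → P
        M₀ = proj₁ ch
        ih : ∀ {w} → rk w < rk v → ∀ {M} → Spec w M → Calc w M
        ih l = go _ (rs l)
        dM : Dn M v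
        dM = Spec.top-dn SM
        compare : Dec (M v ≡ M₀ v) → Calc v M
        compare (no ne) = exchange-pair ih (proj₁ (proj₂ ch)) SM (λ e → ne (sym e)) (proj₂ (proj₂ ch))
        compare (yes e) with n≡0⊎0<n (rk (M v))
        ... | inj₂ p = through (second (≤-trans (s≤s p) (≤-reflexive (sym (proj₂ dM)))) (M₀ v))
          where
          through : (∃ λ K → Spec v K × ¬ K v ≡ M₀ v) → Calc v M
          through (K , SK , ne) = exchange-pair ih SK SM (λ q → ne (trans q e))
            (exchange-pair ih (proj₁ (proj₂ ch)) SK (λ q → ne (sym q)) (proj₂ (proj₂ ch)))
        ... | inj₁ z = calc
          where
          agree : ∀ {u} → u ⊑ v → M u ≡ M₀ u
          agree {u} h with ⊑-cases h
          ... | inj₁ refl = e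
          ... | inj₂ l = trans (cong M u≡) (trans (Spec.inv SM (⊑-refl v)) (sym
                   (trans (cong M₀ (trans u≡ e)) (Spec.inv (proj₁ (proj₂ ch)) (⊑-refl v)))))
            where
            u≡ : u ≡ M v
            u≡ = least (n<1⇒n≡0 (≤-trans l (≤-reflexive (trans (proj₂ dM) (cong suc z))))) z
          calc : Calc v M
          calc {u} h = ≈P-trans (proj₂ (proj₂ ch) h)
                         (≡⇒≈P (cong₂ (λ a b → Tₘ a (R b) u) (sym (agree h)) (sym e)))

open import Data.List.Properties
open import Data.List.Relation.Binary.Sublist.Propositional using (_⊆_; []; _∷_; ⊆-refl; ⊆-trans) renaming (_∷ʳ_ to _skip_)
open import Data.Vec as Vec using (Vec; []; _∷_)
open import Data.Vec.Relation.Unary.All as VecAll using ([]; _∷_)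
open import Data.Vec.Relation.Unary.All.Properties using (lookup⁺)
open import Data.Maybe as Maybe using (Maybe; just; nothing)
open import Data.List.Membership.Propositional using (_∈_)
open import Data.List.Membership.Propositional.Properties using (∈-lookup; ∈-map⁺; ∈-++⁺ˡ; ∈-++⁺ʳ; ∈-filter⁺; ∈-allFin)
open import Data.List.Relation.Unary.All as ListAll using (All; []; _∷_)
import Data.List.Relation.Unary.All.Properties as ListAll
open import Data.List.Relation.Unary.Any as ListAny using (Any; here; there)
import Data.List.Relation.Unary.Any.Properties as ListAny
open import Data.List.Relation.Unary.AllPairs as AllPairs using (AllPairs; []; _∷_)
import Data.List.Relation.Unary.AllPairs.Properties as AllPairs
open import Data.List.Relation.Unary.Unique.Propositional.Properties using (allFin⁺)


-- Words and inversions

-- The set S of generators is arbitrary, so case distinctions on equality in W take place under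
-- double negation. This is harmless: the integer equations to be proved are stable.
infixl 1 _>>=_ _>>_
_>>=_ : ∀ {a b} {A : Set a} {B : Set b} → ¬ ¬ A → (A → ¬ ¬ B) → ¬ ¬ B
(m >>= f) k = m (λ a → f a k)

_>>_ : ∀ {a b} {A : Set a} {B : Set b} → ¬ ¬ A → ¬ ¬ B → ¬ ¬ B
m >> n = m >>= λ _ → n

return : ∀ {a} {A : Set a} → A → ¬ ¬ A
return a k = k a

em : ∀ {a} {A : Set a} → ¬ ¬ Dec A
em k = k (no (λ a → k (yes a)))

run : ¬ ¬ ⊥ → ⊥
run m = m id

stableᵇ : ∀ {b b' : Bool} → ¬ ¬ (b ≡ b') → b ≡ b'
stableᵇ = decidable-stable (_ Bool.≟ _)

stable≤ : ∀ {m n} → ¬ ¬ (m ≤ n) → m ≤ n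
stable≤ = decidable-stable (_ ≤? _)

module Words (C : CoxeterSystem) where
  open Coxeter C public

  ≡⇒≈ : ∀ {a b} → a ≡ b → a ≈W b
  ≡⇒≈ refl = ≈refl

  ++-congˡ : ∀ p {a b} → a ≈W b → p ++ a ≈W p ++ b
  ++-congˡ p ≈refl = ≈refl
  ++-congˡ p (≈sym h) = ≈sym (++-congˡ p h)
  ++-congˡ p (≈trans g h) = ≈trans (++-congˡ p g) (++-congˡ p h)
  ++-congˡ p (relator a c s t k e) = subst₂ _≈W_ (++-assoc p a _) (++-assoc p a c) (relator (p ++ a) c s t k e)

  ++-congʳ : ∀ p {a b} → a ≈W b → a ++ p ≈W b ++ p
  ++-congʳ p ≈refl = ≈refl
  ++-congʳ p (≈sym h) = ≈sym (++-congʳ p h)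
  ++-congʳ p (≈trans g h) = ≈trans (++-congʳ p g) (++-congʳ p h)
  ++-congʳ p (relator a c s t k e) = subst₂ _≈W_
    (trans (cong (a ++_) (sym (++-assoc (alt s t (2 * suc k)) c p))) (sym (++-assoc a _ p)))
    (sym (++-assoc a c p)) (relator a (c ++ p) s t k e)

  ++-cong : ∀ {a a' b b'} → a ≈W a' → b ≈W b' → a ++ b ≈W a' ++ b'
  ++-cong {a' = a'} {b} p q = ≈trans (++-congʳ b p) (++-congˡ a' q)

  ss≈e : ∀ s → s ∷ s ∷ [] ≈W []
  ss≈e s = relator [] [] s s 0 (m-diag s)

  rev : Word → Word
  rev = reverse

  inverseʳ : ∀ w → w ++ rev w ≈W []
  inverseʳ [] = ≈refl
  inverseʳ (x ∷ w) = ≈trans (≡⇒≈ (cong (x ∷_) (trans (cong (w ++_) (unfold-reverse x w)) (sym (++-assoc w (rev w) _)))))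
                    (≈trans (++-congˡ [ x ] (++-congʳ [ x ] (inverseʳ w))) (ss≈e x))

  inverseˡ : ∀ w → rev w ++ w ≈W []
  inverseˡ w = subst (λ z → rev w ++ z ≈W []) (reverse-involutive w) (inverseʳ (rev w))

  -- Derived from reversal being inversion, so that no relator has to be reversed.
  rev-cong : ∀ {a b} → a ≈W b → rev a ≈W rev b
  rev-cong {a} {b} h = ≈trans (≡⇒≈ (sym (++-identityʳ (rev a))))
    (≈trans (++-congˡ (rev a) (≈trans (≈sym (inverseʳ b)) (++-congʳ (rev b) (≈sym h))))
    (≈trans (≡⇒≈ (sym (++-assoc (rev a) a (rev b)))) (++-congʳ (rev b) (inverseˡ a))))

  record Inv (t : Word) : Set where
    constructor involution
    field square : t ++ t ≈W []

  inv-rev : ∀ {t} → Inv t → rev t ≈W t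
  inv-rev {t} (involution h) = ≈trans (≡⇒≈ (sym (++-identityʳ (rev t)))) (≈trans (++-congˡ (rev t) (≈sym h))
    (≈trans (≡⇒≈ (sym (++-assoc (rev t) t t))) (++-congʳ t (inverseˡ t))))

  -- Decides identities that hold in every group, the values of `ref` being involutions, by free
  -- reduction.
  module Solver where
    infixr 6 _∙_
    data Expr (n k : ℕ) : Set where
      var : Fin n → Expr n k
      ref : Fin k → Expr n k
      _∙_ : Expr n k → Expr n k → Expr n k
      inv : Expr n k → Expr n k
      ε   : Expr n k

    data Lit (n k : ℕ) : Set where
      pos neg : Fin n → Lit n k
      rfl     : Fin k → Lit n k

    flip-lit : ∀ {n k} → Lit n k → Lit n k
    flip-lit (pos i) = neg i
    flip-lit (neg i) = pos i
    flip-lit (rfl i) = rfl i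

    _≟L_ : ∀ {n k} (a b : Lit n k) → Dec (a ≡ b)
    pos i ≟L pos j with i Fin.≟ j
    ... | yes refl = yes refl
    ... | no n     = no λ { refl → n refl }
    neg i ≟L neg j with i Fin.≟ j
    ... | yes refl = yes refl
    ... | no n     = no λ { refl → n refl }
    rfl i ≟L rfl j with i Fin.≟ j
    ... | yes refl = yes refl
    ... | no n     = no λ { refl → n refl }
    pos i ≟L neg j = no λ ()
    pos i ≟L rfl j = no λ ()
    neg i ≟L pos j = no λ ()
    neg i ≟L rfl j = no λ ()
    rfl i ≟L pos j = no λ ()
    rfl i ≟L neg j = no λ ()

    push : ∀ {n k} → Lit n k → List (Lit n k) → List (Lit n k)
    push a [] = a ∷ []
    push a (b ∷ l) with b ≟L flip-lit a
    ... | yes _ = l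
    ... | no _  = a ∷ b ∷ l

    norm norm⁻ : ∀ {n k} → Expr n k → List (Lit n k) → List (Lit n k)
    norm (var i) l = push (pos i) l
    norm (ref i) l = push (rfl i) l
    norm (a ∙ b) l = norm a (norm b l)
    norm (inv a) l = norm⁻ a l
    norm ε       l = l
    norm⁻ (var i) l = push (neg i) l
    norm⁻ (ref i) l = push (rfl i) l
    norm⁻ (a ∙ b) l = norm⁻ b (norm⁻ a l)
    norm⁻ (inv a) l = norm a l
    norm⁻ ε       l = l

    module _ {n k} (ρ : Vec Word n) {σ : Vec Word k} (σ-inv : VecAll.All Inv σ) where

      ⟦_⟧ : Expr n k → Word
      ⟦ var i ⟧ = Vec.lookup ρ i
      ⟦ ref i ⟧ = Vec.lookup σ i
      ⟦ a ∙ b ⟧ = ⟦ a ⟧ ++ ⟦ b ⟧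
      ⟦ inv a ⟧ = rev ⟦ a ⟧
      ⟦ ε ⟧     = []

      ⟦_⟧ₗ : Lit n k → Word
      ⟦ pos i ⟧ₗ = Vec.lookup ρ i
      ⟦ neg i ⟧ₗ = rev (Vec.lookup ρ i)
      ⟦ rfl i ⟧ₗ = Vec.lookup σ i

      ⟦_⟧ₛ : List (Lit n k) → Word
      ⟦ [] ⟧ₛ    = []
      ⟦ a ∷ l ⟧ₛ = ⟦ a ⟧ₗ ++ ⟦ l ⟧ₛ

      flip-inverse : ∀ a → ⟦ a ⟧ₗ ++ ⟦ flip-lit a ⟧ₗ ≈W []
      flip-inverse (pos i) = inverseʳ (Vec.lookup ρ i)
      flip-inverse (neg i) = inverseˡ (Vec.lookup ρ i)
      flip-inverse (rfl i) = Inv.square (lookup⁺ σ-inv i)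

      push-sound : ∀ a l → ⟦ a ⟧ₗ ++ ⟦ l ⟧ₛ ≈W ⟦ push a l ⟧ₛ
      push-sound a [] = ≈refl
      push-sound a (b ∷ l) with b ≟L flip-lit a
      ... | no _     = ≈refl
      ... | yes refl = ≈trans (≡⇒≈ (sym (++-assoc ⟦ a ⟧ₗ _ ⟦ l ⟧ₛ))) (++-congʳ ⟦ l ⟧ₛ (flip-inverse a))

      sound  : ∀ a l → ⟦ a ⟧ ++ ⟦ l ⟧ₛ ≈W ⟦ norm a l ⟧ₛ
      sound⁻ : ∀ a l → rev ⟦ a ⟧ ++ ⟦ l ⟧ₛ ≈W ⟦ norm⁻ a l ⟧ₛ
      sound (var i) l = push-sound (pos i) l
      sound (ref i) l = push-sound (rfl i) l
      sound (a ∙ b) l = ≈trans (≡⇒≈ (++-assoc ⟦ a ⟧ ⟦ b ⟧ _)) (≈trans (++-congˡ ⟦ a ⟧ (sound b l)) (sound a _))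
      sound (inv a) l = sound⁻ a l
      sound ε       l = ≈refl
      sound⁻ (var i) l = push-sound (neg i) l
      sound⁻ (ref i) l = ≈trans (++-congʳ ⟦ l ⟧ₛ (inv-rev (lookup⁺ σ-inv i))) (push-sound (rfl i) l)
      sound⁻ (a ∙ b) l = ≈trans (≡⇒≈ (trans (cong (_++ ⟦ l ⟧ₛ) (reverse-++ ⟦ a ⟧ ⟦ b ⟧)) (++-assoc (rev ⟦ b ⟧) (rev ⟦ a ⟧) _)))
                        (≈trans (++-congˡ (rev ⟦ b ⟧) (sound⁻ a l)) (sound⁻ b _))
      sound⁻ (inv a) l = ≈trans (≡⇒≈ (cong (_++ ⟦ l ⟧ₛ) (reverse-involutive ⟦ a ⟧))) (sound a l)
      sound⁻ ε       l = ≈refl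

      solve : ∀ a b → norm a [] ≡ norm b [] → ⟦ a ⟧ ≈W ⟦ b ⟧
      solve a b e = ≈trans (≡⇒≈ (sym (++-identityʳ _))) (≈trans (sound a [])
        (≈trans (≡⇒≈ (cong ⟦_⟧ₛ e)) (≈trans (≈sym (sound b [])) (≡⇒≈ (++-identityʳ _)))))

    x₀ : ∀ {n k} → Expr (1 + n) k
    x₀ = var (# 0)
    x₁ : ∀ {n k} → Expr (2 + n) k
    x₁ = var (# 1)
    x₂ : ∀ {n k} → Expr (3 + n) k
    x₂ = var (# 2)
    r₀ : ∀ {n k} → Expr n (1 + k)
    r₀ = ref (# 0)
    r₁ : ∀ {n k} → Expr n (2 + k)
    r₁ = ref (# 1)
    r₂ : ∀ {n k} → Expr n (3 + k)
    r₂ = ref (# 2)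

  open Solver public

  conj : Word → Word → Word
  conj w t = w ++ t ++ rev w

  conj-cong : ∀ w {t t'} → t ≈W t' → conj w t ≈W conj w t'
  conj-cong w h = ++-congˡ w (++-congʳ (rev w) h)

  conj-congˡ : ∀ {w w'} t → w ≈W w' → conj w t ≈W conj w' t
  conj-congˡ t h = ++-cong h (++-congˡ t (rev-cong h))

  conj-++ : ∀ u v t → conj (u ++ v) t ≈W conj u (conj v t)
  conj-++ u v t = solve (u ∷ v ∷ t ∷ []) [] ((x₀ ∙ x₁) ∙ x₂ ∙ inv (x₀ ∙ x₁)) (x₀ ∙ (x₁ ∙ x₂ ∙ inv x₁) ∙ inv x₀) refl

  conj⁻ : ∀ w {t r} → conj w t ≈W r → t ≈W conj (rev w) r
  conj⁻ w {t} {r} h = ≈trans (solve (w ∷ t ∷ []) [] x₁ (inv x₀ ∙ (x₀ ∙ x₁ ∙ inv x₀) ∙ inv (inv x₀)) refl) (conj-cong (rev w) h)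

  conj⁺ : ∀ w {t r} → t ≈W conj (rev w) r → conj w t ≈W r
  conj⁺ w {t} {r} h = ≈trans (conj-cong w h) (solve (w ∷ r ∷ []) [] (x₀ ∙ (inv x₀ ∙ x₁ ∙ inv (inv x₀)) ∙ inv x₀) x₁ refl)

  -- Par w t b: b is the parity of the number of letters x of w = u x v with v t v⁻¹ ≈ x.
  data Par : Word → Word → Bool → Set where
    []   : ∀ {t} → Par [] t false
    hit  : ∀ {x w t b} → conj w t ≈W [ x ] → Par w t b → Par (x ∷ w) t (not b)
    miss : ∀ {x w t b} → ¬ conj w t ≈W [ x ] → Par w t b → Par (x ∷ w) t b

  par? : ∀ w t → ¬ ¬ ∃ (Par w t)
  par? [] t = return (false , [])
  par? (x ∷ w) t = do
    b , p ← par? w t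
    d ← em {A = conj w t ≈W [ x ]}
    case d of λ { (yes h) → return (not b , hit h p) ; (no n) → return (b , miss n p) }

  par-fun : ∀ {w t b b'} → Par w t b → Par w t b' → b ≡ b'
  par-fun [] [] = refl
  par-fun (hit _ p) (hit _ q)  = cong not (par-fun p q)
  par-fun (hit h _) (miss n _) = ⊥-elim (n h)
  par-fun (miss n _) (hit h _) = ⊥-elim (n h)
  par-fun (miss _ p) (miss _ q) = par-fun p q

  par-congᵗ : ∀ {w t t' b} → t ≈W t' → Par w t b → Par w t' b
  par-congᵗ e [] = []
  par-congᵗ {x ∷ w} e (hit h p)  = hit (≈trans (conj-cong w (≈sym e)) h) (par-congᵗ e p)
  par-congᵗ {x ∷ w} e (miss n p) = miss (λ h → n (≈trans (conj-cong w e) h)) (par-congᵗ e p)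

  par-++ : ∀ {u v t a b} → Par u (conj v t) a → Par v t b → Par (u ++ v) t (a xor b)
  par-++ [] q = q
  par-++ {x ∷ u} {v} {t} {b = b} (hit {b = a} h p) q =
    subst (Par (x ∷ u ++ v) t) (sym (xor-notˡ a b)) (hit (≈trans (conj-++ u v t) h) (par-++ p q))
    where
    xor-notˡ : ∀ a b → not a xor b ≡ not (a xor b)
    xor-notˡ false b = refl
    xor-notˡ true  b = sym (Bool.not-involutive b)
  par-++ {x ∷ u} {v} {t} (miss n p) q = miss (λ h → n (≈trans (≈sym (conj-++ u v t)) h)) (par-++ p q)

  module Relators (s t : S) where
    letter : S → S → ℕ → S
    letter a b zero    = a
    letter a b (suc k) = letter b a k

    alt-∷ʳ : ∀ a b k → alt a b (suc k) ≡ alt a b k ∷ʳ letter a b k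
    alt-∷ʳ a b zero    = refl
    alt-∷ʳ a b (suc k) = cong (a ∷_) (alt-∷ʳ b a k)

    alt-+ : ∀ a b n k → alt a b (n + k) ≡ alt a b n ++ alt (letter a b n) (letter b a n) k
    alt-+ a b zero    k = refl
    alt-+ a b (suc n) k = cong (a ∷_) (alt-+ b a n k)

    rev-alt-suc : ∀ a b k → rev (alt a b (suc k)) ≡ letter a b k ∷ rev (alt a b k)
    rev-alt-suc a b k = trans (cong rev (alt-∷ʳ a b k)) (reverse-++ (alt a b k) _)

    rev-alt : ∀ a b k → rev (alt a b k) ≡ alt (letter b a k) (letter a b k) k
    rev-alt a b zero    = refl
    rev-alt a b (suc k) = trans (rev-alt-suc a b k) (cong (letter a b k ∷_) (rev-alt a b k))

    letter-double : ∀ a b n → letter a b (n + n) ≡ a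
    letter-double a b zero    = refl
    letter-double a b (suc n) = trans (cong (letter b a) (+-suc n n)) (letter-double a b n)

    -- the suffix of length k of … s t s t
    suf : ℕ → Word
    suf k = rev (alt t s k)

    y : ℕ → S
    y = letter t s

    -- The reflection attached to the letter number `k` of ... s t s t, counted from the right: that
    -- letter is a hit for r exactly when r is `ρ k`.
    ρ : ℕ → Word
    ρ k = conj (rev (suf k)) [ y k ]

    ρ≡ : ∀ k → ρ k ≡ alt t s (suc k + k)
    ρ≡ k = trans (cong₂ (λ p q → p ++ y k ∷ q) rr (reverse-involutive (suf k)))
          (trans (sym (++-assoc (alt t s k) [ y k ] (suf k)))
          (trans (cong₂ _++_ (sym (alt-∷ʳ t s k)) (rev-alt t s k))
                 (sym (alt-+ t s (suc k) k))))
      where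
      rr : rev (suf k) ≡ alt t s k
      rr = reverse-involutive (alt t s k)

    module _ {m : ℕ} (rel : alt s t (m + m) ≈W []) where

      alt-period : ∀ n → alt t s (suc (n + m) + (n + m)) ≈W alt t s (suc n + n)
      alt-period n = ≈trans (≡⇒≈ (trans (cong (alt t s) eq) (alt-+ t s (suc n + n) (m + m))))
                     (subst (λ z → alt t s (suc n + n) ++ z ≈W alt t s (suc n + n))
                        (cong₂ (λ a b → alt a b (m + m)) (sym (letter-double s t n)) (sym (letter-double t s n)))
                        (≈trans (++-congˡ (alt t s (suc n + n)) rel) (≡⇒≈ (++-identityʳ _))))
        where
        eq : suc (n + m) + (n + m) ≡ (suc n + n) + (m + m)
        eq = cong suc (trans (+-assoc n m (n + m)) (trans (cong (n +_) (trans (sym (+-assoc m n m)) (trans (cong (_+ m) (+-comm m n)) (+-assoc n m m)))) (sym (+-assoc n n (m + m)))))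

      ρ-period : ∀ n → ρ (n + m) ≈W ρ n
      ρ-period n = ≈trans (≡⇒≈ (ρ≡ (n + m))) (≈trans (alt-period n) (≡⇒≈ (sym (ρ≡ n))))

      -- By `ρ-period` the letter number n + m is a hit exactly when the letter number n is. So the
      -- two halves of a relator cancel, see `par-relator`.
      par-period : ∀ n {r a b c} → Par (suf (n + m)) r a → Par (suf m) r b → Par (suf n) r c → a ≡ b xor c
      par-period zero p q [] = trans (par-fun p q) (sym (Bool.xor-identityʳ _))
      par-period (suc n) {r} {a} {b} {c} p q s' = go (subst (λ z → Par z r a) (rev-alt-suc t s (n + m)) p) (subst (λ z → Par z r c) (rev-alt-suc t s n) s')
        where
        to : conj (suf (n + m)) r ≈W [ y (n + m) ] → conj (suf n) r ≈W [ y n ]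
        to h = conj⁺ (suf n) (≈trans (conj⁻ (suf (n + m)) h) (ρ-period n))
        from : conj (suf n) r ≈W [ y n ] → conj (suf (n + m)) r ≈W [ y (n + m) ]
        from h = conj⁺ (suf (n + m)) (≈trans (conj⁻ (suf n) h) (≈sym (ρ-period n)))
        go : ∀ {a c} → Par (y (n + m) ∷ suf (n + m)) r a → Par (y n ∷ suf n) r c → a ≡ b xor c
        go (hit _ p) (hit _ s') = trans (cong not (par-period n p q s')) (sym (xor-notʳ b _))
          where
          xor-notʳ : ∀ a b → a xor not b ≡ not (a xor b)
          xor-notʳ false b = refl
          xor-notʳ true  b = refl
        go (miss _ p) (miss _ s') = par-period n p q s'
        go (hit h _) (miss n' _) = ⊥-elim (n' (to h))
        go (miss n' _) (hit h _) = ⊥-elim (n' (from h))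

      par-relator : ∀ {r b} → Par (alt s t (m + m)) r b → b ≡ false
      par-relator {r} {b} p = stableᵇ do
          b' , q ← par? (suf m) r
          return (trans (par-period m (subst (λ z → Par z r b) (sym suf≡) p) q q) (Bool.xor-same b'))
        where
        suf≡ : suf (m + m) ≡ alt s t (m + m)
        suf≡ = trans (rev-alt t s (m + m)) (cong₂ (λ a b → alt a b (m + m)) (letter-double s t m) (letter-double t s m))

  -- `par-++` is a cocycle rule, and a relator has even parity at every element, so inserting it
  -- changes nothing. Hence the inversions of an element of W are well defined.
  par-≈ : ∀ {w w' t b b'} → w ≈W w' → Par w t b → Par w' t b' → b ≡ b'
  par-≈ ≈refl p q = par-fun p q
  par-≈ (≈sym h) p q = sym (par-≈ h q p)
  par-≈ {t = t} (≈trans {b = w} g h) p q = stableᵇ do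
    _ , r ← par? w t
    return (trans (par-≈ g p r) (par-≈ h r q))
  par-≈ {t = r} (relator a c s t k e) p q = stableᵇ do
      let A = alt s t (2 * suc k)
      x , px ← par? c r
      y , py ← par? A (conj c r)
      z , pz ← par? a (conj c r)
      let pz' = par-congᵗ {a} (≈sym (≈trans (conj-++ A c r) (≈trans (conj-congˡ (conj c r) (rel≈)) (≡⇒≈ (++-identityʳ (conj c r)))))) pz
      return (trans (par-fun p (par-++ pz' (par-++ py px)))
             (trans (cong (λ y → z xor (y xor x)) (Relators.par-relator s t {suc k} (subst (_≈W []) A≡ rel≈) (subst (λ w → Par w (conj c r) y) A≡ py)))
                    (sym (par-fun q (par-++ pz px)))))
    where
    rel≈ : alt s t (2 * suc k) ≈W []
    rel≈ = subst (_≈W []) (++-identityʳ _) (relator [] [] s t k e)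
    A≡ : alt s t (2 * suc k) ≡ alt s t (suc k + suc k)
    A≡ = cong (λ z → alt s t (suc k + z)) (+-identityʳ (suc k))

-- The order of a product of two generators

module Representation (C : CoxeterSystem) where
  open import Data.Integer using (ℤ; 0ℤ; 1ℤ; -_; _-_) renaming (_+_ to infixl 6 _⊕_)
  open Words C

  -- Each scalar is replaced by an integer sequence: 2 cos (π / m) is an eigenvalue of the path with
  -- m - 1 vertices, so `Adj m` can play its part over the integers.
  V : Set
  V = S → ℕ → ℤ

  _≐_ : V → V → Set
  f ≐ g = ∀ u i → f u i ≡ g u i

  -- The matrix only shows that s and t are not distinct. As integer equations are stable, they may
  -- be proved as if s and t were equal.
  same-gen : ∀ {s t} → m s t ≡ 1 → ∀ {f g : ℤ} → (s ≡ t → f ≡ g) → f ≡ g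
  same-gen {s} {t} e h = stableℤ λ k → m-off s t (λ p → k (h p)) e

  m-cong : ∀ {s t} → m s t ≡ 1 → ∀ u → m s u ≡ m t u
  m-cong {s} {t} e u = decidable-stable (m s u ≟ m t u) λ k → m-off s t (λ { refl → k refl }) e

  -- The dual of the geometric representation with each coefficient 2 cos (π / m) replaced by Adj m.
  act : S → V → V
  act s f u i with m s u ≟ 1
  ... | yes _ = - f u i
  ... | no _  = f u i ⊕ Adj (m s u) (f s) i

  act-same : ∀ {s u} f → m s u ≡ 1 → ∀ i → act s f u i ≡ - f u i
  act-same {s} {u} f e i with m s u ≟ 1
  ... | yes _ = refl
  ... | no n  = ⊥-elim (n e)

  act-other : ∀ {s u} f → ¬ m s u ≡ 1 → ∀ i → act s f u i ≡ f u i ⊕ Adj (m s u) (f s) i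
  act-other {s} {u} f n i with m s u ≟ 1
  ... | yes e = ⊥-elim (n e)
  ... | no _  = refl

  act-cong : ∀ s {f g} → f ≐ g → act s f ≐ act s g
  act-cong s e u i with m s u ≟ 1
  ... | yes _ = cong -_ (e u i)
  ... | no _  = cong₂ _⊕_ (e u i) (Adj-cong (m s u) (e s) i)

  apply : Word → V → V
  apply []      f = f
  apply (s ∷ w) f = apply w (act s f)

  apply-cong : ∀ w {f g} → f ≐ g → apply w f ≐ apply w g
  apply-cong []      e = e
  apply-cong (s ∷ w) e = apply-cong w (act-cong s e)

  apply-++ : ∀ a b f → apply (a ++ b) f ≡ apply b (apply a f)
  apply-++ []      b f = refl
  apply-++ (s ∷ a) b f = apply-++ a b (act s f)

  dbl : ℕ → ℕ
  dbl zero    = 0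
  dbl (suc j) = 2 + dbl j

  dbl-+ : ∀ j n → dbl j + n ≡ j + j + n
  dbl-+ zero    n = refl
  dbl-+ (suc j) n = cong suc (trans (cong suc (dbl-+ j n)) (cong (_+ n) (sym (+-suc j j))))

  dbl≡ : ∀ j → dbl j ≡ j + j
  dbl≡ j = trans (sym (+-identityʳ (dbl j))) (trans (dbl-+ j 0) (+-identityʳ (j + j)))

  module Pair (s t : S) (s≁t : ¬ m s t ≡ 1) where
    k : ℕ
    k = m s t

    k≡ : m t s ≡ k
    k≡ = m-sym t s

    module Alternate (x : ℕ → ℕ → ℤ) (x-step : ∀ n i → x (2 + n) i ≡ Adj k (x (1 + n)) i - x n i) where
      open WaveSequence k x x-step using (sx) public

      -- Up to sign, the entries at s and t are two consecutive terms of the wave recursion; acting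
      -- by s and then by t advances it by two.
      record State (n : ℕ) (g : V) : Set where
        field
          at-s : ∀ i → g s i ≡ x (suc n) i
          at-t : ∀ i → g t i ≡ - x n i
      open State

      half-s : ∀ {n g} → State n g → ∀ i → act s g s i ≡ - x (suc n) i
      half-s st i = trans (act-same _ (m-diag s) i) (cong -_ (at-s st i))

      half-t : ∀ {n g} → State n g → ∀ i → act s g t i ≡ x (2 + n) i
      half-t {n} st i = trans (act-other _ s≁t i) (trans (cong₂ _⊕_ (at-t st i) (Adj-cong k (at-s st) i))
        (trans (ℤ.+-comm (- x n i) _) (sym (x-step n i))))

      two-steps : ∀ {n g} → State n g → State (2 + n) (act t (act s g))
      two-steps {n} {g} st = record
        { at-s = λ i → trans (act-other _ (λ e → s≁t (trans (sym k≡) e)) i)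
            (trans (cong₂ _⊕_ (half-s st i) (trans (cong (λ z → Adj z (act s g t) i) k≡) (Adj-cong k (half-t st) i)))
            (trans (ℤ.+-comm (- x (suc n) i) _) (sym (x-step (suc n) i))))
        ; at-t = λ i → trans (act-same _ (m-diag t) i) (cong -_ (half-t st i)) }

      apply-state : ∀ j {n g} → State n g → State (dbl j + n) (apply (alt s t (dbl j)) g)
      apply-state zero    st = st
      apply-state (suc j) {n} {g} st = subst (λ z → State z (apply (alt s t (dbl (suc j))) g))
        (trans (+-suc (dbl j) (suc n)) (cong suc (+-suc (dbl j) n))) (apply-state j (two-steps st))

      -- The entry at a third generator u collects, through the two operators, every other term of
      -- the wave seen at s and at t.
      apply-third : ∀ j {n g u} → State n g → ¬ m s u ≡ 1 → ¬ m t u ≡ 1 → ∀ i →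
        apply (alt s t (dbl j)) g u i ≡ g u i ⊕ (Adj (m s u) (sx j (suc n)) i ⊕ Adj (m t u) (sx j (2 + n)) i)
      apply-third zero {n} {g} {u} st _ _ i = sym (trans (cong (g u i ⊕_) (cong₂ _⊕_ (Adj-0 (m s u) i) (Adj-0 (m t u) i))) (ℤ.+-identityʳ _))
      apply-third (suc j) {n} {g} {u} st su tu i = trans (apply-third j (two-steps st) su tu i)
        (trans (cong (_⊕ (Adj (m s u) (sx j (3 + n)) i ⊕ Adj (m t u) (sx j (4 + n)) i))
                  (trans (act-other _ tu i) (cong₂ _⊕_ (trans (act-other _ su i) (cong (g u i ⊕_) (Adj-cong (m s u) (at-s st) i)))
                                                       (Adj-cong (m t u) (half-t st) i))))
        (trans (lem (g u i) (Adj (m s u) (x (suc n)) i) (Adj (m t u) (x (2 + n)) i) (Adj (m s u) (sx j (3 + n)) i) (Adj (m t u) (sx j (4 + n)) i))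
               (cong (g u i ⊕_) (cong₂ _⊕_ (sym (Adj-+ (m s u) (x (suc n)) (sx j (3 + n)) i)) (sym (Adj-+ (m t u) (x (2 + n)) (sx j (4 + n)) i))))))
        where
        lem : ∀ g a b c d → ((g ⊕ a) ⊕ b) ⊕ (c ⊕ d) ≡ g ⊕ ((a ⊕ c) ⊕ (b ⊕ d))
        lem = solve-∀

    x : V → ℕ → ℕ → ℤ
    x f zero          i = - f t i
    x f (suc zero)    i = f s i
    x f (suc (suc n)) i = Adj k (x f (suc n)) i - x f n i

    module A f = Alternate (x f) (λ n i → refl)

    start : ∀ f → A.State f 0 f
    start f = record { at-s = λ i → refl ; at-t = λ i → sym (ℤ.neg-involutive _) }

  -- At s and t the relator advances the wave by its period 2 m s t. At any other generator it adds
  -- sums over one parity of a period, which vanish. If m s t = 1, then s and t act alike and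
  -- cancel.
  relator-trivial : ∀ s t k → m s t ≡ suc k → ∀ f → apply (alt s t (dbl (suc k))) f ≐ f
  relator-trivial s t zero e f u i with m s u ≟ 1
  ... | yes e' = trans (act-same (act s f) (trans (sym (m-cong e u)) e') i) (trans (cong -_ (act-same f e' i)) (ℤ.neg-involutive _))
  ... | no n = trans (act-other (act s f) (λ e' → n (trans (m-cong e u) e')) i)
      (trans (cong₂ _⊕_ (act-other f n i) (trans (cong (λ z → Adj z (act s f t) i) (sym (m-cong e u)))
                (trans (Adj-cong (m s u) (λ i → trans (act-same f e i) (cong -_ (sym (same-gen e (λ { refl → refl }))))) i) (Adj-neg (m s u) (f s) i))))
        (lem (f u i) (Adj (m s u) (f s) i)))
    where
    lem : ∀ a b → (a ⊕ b) ⊕ - b ≡ a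
    lem = solve-∀
  relator-trivial s t (suc k') e f u i = by (m s u ≟ 1) (m t u ≟ 1)
    where
    open Pair s t (λ e' → 1+n≢0 (suc-injective (trans (sym e) e')))
    open A f
    x-step : ∀ n i → x f (2 + n) i ≡ Adj (suc (suc k')) (x f (1 + n)) i - x f n i
    x-step n i = cong (λ z → Adj z (x f (1 + n)) i - x f n i) e
    module FW = FiniteWave (suc k') (x f) x-step
    g : V
    g = apply (alt s t (dbl (suc (suc k')))) f
    st : State (dbl (suc (suc k')) + 0) g
    st = apply-state (suc (suc k')) (start f)
    shift-index : ∀ n → dbl (suc (suc k')) + n ≡ n + suc (suc k') + suc (suc k')
    shift-index n = trans (dbl-+ (suc (suc k')) n) (trans (+-comm (suc (suc k') + suc (suc k')) n) (sym (+-assoc n _ _)))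
    g-s : ∀ i → g s i ≡ f s i
    g-s i = trans (State.at-s st i) (trans (cong (λ z → x f z i) (trans (sym (+-suc (dbl (suc (suc k'))) 0)) (shift-index 1))) (FW.x-periodic 1 i))
    g-t : ∀ i → g t i ≡ f t i
    g-t i = trans (State.at-t st i) (trans (cong -_ (trans (cong (λ z → x f z i) (shift-index 0)) (FW.x-periodic 0 i))) (ℤ.neg-involutive _))
    sx≡ : ∀ j n i → sx j n i ≡ WaveSequence.sx (suc (suc k')) (x f) x-step j n i
    sx≡ zero    n i = refl
    sx≡ (suc j) n i = cong (x f n i ⊕_) (sx≡ j (2 + n) i)
    sx-0 : ∀ n i → sx (suc (suc k')) n i ≡ 0ℤ
    sx-0 n i = trans (sx≡ (suc (suc k')) n i) (FW.sx-zero n i)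
    by : Dec (m s u ≡ 1) → Dec (m t u ≡ 1) → g u i ≡ f u i
    by (yes p) _ = same-gen p λ { refl → g-s i }
    by (no _) (yes p) = same-gen p λ { refl → g-t i }
    by (no p) (no q) = trans (apply-third (suc (suc k')) (start f) p q i) (trans (cong (f u i ⊕_)
      (cong₂ _⊕_ (trans (Adj-cong (m s u) (sx-0 1) i) (Adj-0 (m s u) i)) (trans (Adj-cong (m t u) (sx-0 2) i) (Adj-0 (m t u) i)))) (ℤ.+-identityʳ _))

  apply-≈ : ∀ {a b} → a ≈W b → ∀ f → apply a f ≐ apply b f
  apply-≈ ≈refl f u i = refl
  apply-≈ (≈sym h) f u i = sym (apply-≈ h f u i)
  apply-≈ (≈trans g h) f u i = trans (apply-≈ g f u i) (apply-≈ h f u i)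
  apply-≈ (relator a c s t k e) f u i = trans (cong (λ h → h u i) (trans (apply-++ a _ f) (apply-++ (alt s t (2 * suc k)) c (apply a f))))
    (trans (apply-cong c (λ u i → trans (cong (λ z → apply (alt s t z) (apply a f) u i) (trans (cong (suc k +_) (+-identityʳ (suc k))) (sym (dbl≡ (suc k)))))
                                       (relator-trivial s t k e (apply a f) u i)) u i)
           (cong (λ h → h u i) (sym (apply-++ a c f))))

  -- If (s t)ⁿ = e with n < m s t, the wave that starts with a unit impulse at the wall is
  -- antisymmetric about time n, hence vanishes then, but its front has not yet reached the other wall.
  order-exact : ∀ s t n → alt s t (n + n) ≈W [] → 1 ≤ n → (∃ λ k → m s t ≡ suc k) × m s t ≤ n
  order-exact s t (suc n) h _ with m s t ≟ 1
  ... | yes e = (0 , e) , ≤-trans (≤-reflexive e) (s≤s z≤n)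
  ... | no s≁t = bound (m s t) refl
    where
    open Pair s t s≁t
    δ : ℕ → ℤ
    δ zero    = 1ℤ
    δ (suc _) = 0ℤ
    f : V
    f u i with m s u ≟ 1
    ... | yes _ = δ i
    ... | no _  = 0ℤ
    f-s : ∀ i → f s i ≡ δ i
    f-s i with m s s ≟ 1
    ... | yes _ = refl
    ... | no n  = ⊥-elim (n (m-diag s))
    f-t : ∀ i → f t i ≡ 0ℤ
    f-t i with m s t ≟ 1
    ... | yes e = ⊥-elim (s≁t e)
    ... | no _  = refl
    y : ℕ → ℕ → ℤ
    y = x f
    N : ℕ
    N = dbl (suc n)
    fixed : apply (alt s t N) f ≐ f
    fixed = apply-≈ (≈trans (≡⇒≈ (cong (alt s t) (dbl≡ (suc n)))) h) f
    st : A.State f (N + 0) (apply (alt s t N) f)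
    st = A.apply-state f (suc n) (start f)
    N+0 : N + 0 ≡ N
    N+0 = +-identityʳ N
    y₀ : ∀ i → y 0 i ≡ 0ℤ
    y₀ i = cong -_ (f-t i)
    at-N : ∀ i → y N i ≡ - y 0 i
    at-N i = trans (cong (λ z → y z i) (sym N+0)) (trans (sym (ℤ.neg-involutive _)) (cong -_ (trans (sym (A.State.at-t st i))
               (trans (fixed t i) (trans (f-t i) (sym (y₀ i)))))))
    at-N+1 : ∀ i → y (suc N) i ≡ y 1 i
    at-N+1 i = trans (cong (λ z → y (suc z) i) (sym N+0)) (trans (sym (A.State.at-s st i)) (fixed s i))
    Anti : ℕ → Set
    Anti j = ∀ a → a + j ≡ N → ∀ i → y a i ≡ - y j i
    anti : ∀ j → Anti j × Anti (suc j)
    anti zero = (λ a e i → trans (cong (λ z → y z i) (trans (sym (+-identityʳ a)) e)) (at-N i))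
              , λ a e i → let a≡ = trans (+-comm 1 a) e in
                  move (y (suc (suc a)) i) (y a i) (trans (cong (_- y a i) (trans (Adj-cong k (λ i → trans (cong (λ z → y z i) a≡) (trans (at-N i) (cong -_ (y₀ i)))) i) (Adj-0 k i))) (ℤ.+-identityˡ _))
                       (trans (cong (λ z → y (suc z) i) a≡) (at-N+1 i))
      where
      move : ∀ b c {d} → b ≡ - c → b ≡ d → c ≡ - d
      move b c p q = trans (sym (ℤ.neg-involutive c)) (cong -_ (trans (sym p) q))
    anti (suc j) = proj₂ (anti j) , λ a e i →
        move (y (suc (suc a)) i) (Adj k (y (suc a)) i) (y a i) (y j i) (Adj k (y (suc j)) i) refl
             (proj₁ (anti j) (suc (suc a)) (trans (sym (trans (+-suc a (suc j)) (cong suc (+-suc a j)))) e) i)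
             (trans (Adj-cong k (proj₂ (anti j) (suc a) (trans (sym (+-suc a (suc j))) e)) i) (Adj-neg k (y (suc j)) i))
      where
      move : ∀ b c a p q → b ≡ c - a → b ≡ - p → c ≡ - q → a ≡ - (q - p)
      move b c a p q e₁ e₂ e₃ = trans (lem c a) (trans (cong₂ _-_ e₃ (trans (sym e₁) e₂)) (lem' p q))
        where
        lem : ∀ c a → a ≡ c - (c - a)
        lem = solve-∀
        lem' : ∀ p q → - q - - p ≡ - (q - p)
        lem' = solve-∀
    middle : ∀ i → y (suc n) i ≡ 0ℤ
    middle i = double-zero (proj₁ (anti (suc n)) (suc n) (sym (dbl≡ (suc n))) i)
    contra : k ≡ 0 ⊎ suc n < k → ⊥
    contra c = front-nonzero k y (λ _ _ → refl) y₀ (f-s 0) (λ i → f-s (suc i)) n c middle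
    bound : ∀ k' → k' ≡ k → (∃ λ k → m s t ≡ suc k) × m s t ≤ suc n
    bound zero    e = ⊥-elim (contra (inj₁ (sym e)))
    bound (suc k') e = (k' , sym e) , ≮⇒≥ λ l → contra (inj₂ l)

-- Bruhat order

module Bruhat (C : CoxeterSystem) where
  open Words C public

  [-]-inv : ∀ s → Inv [ s ]
  [-]-inv s = involution (ss≈e s)

  Refl : Word → Set
  Refl t = ∃₂ λ w s → t ≈W refl-word w s

  refl-cong : ∀ {t t'} → t ≈W t' → Refl t → Refl t'
  refl-cong e (w , s , h) = w , s , ≈trans (≈sym e) h

  refl-inv : ∀ {t} → Refl t → Inv t
  refl-inv (w , s , h) = involution (≈trans (++-cong h h)
    (solve (w ∷ []) ([-]-inv s ∷ []) ((x₀ ∙ r₀ ∙ inv x₀) ∙ x₀ ∙ r₀ ∙ inv x₀) ε refl))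

  refl-conj : ∀ g {t} → Refl t → Refl (conj g t)
  refl-conj g (w , s , h) = g ++ w , s , ≈trans (conj-cong g h) (≈sym (conj-++ g w [ s ]))

  refl-gen : ∀ s → Refl [ s ]
  refl-gen s = [] , s , ≈refl

  -- Write t = w s w⁻¹. Compared with w w⁻¹, which has even parity, the word has one more letter,
  -- and that letter is a hit.
  par-self : ∀ {t b} → Refl t → Par t t b → b ≡ true
  par-self {t} {b} (w , s , h) p = stableᵇ {b} {true} do
      let t' = conj w [ s ]
      x , px ← par? w [ s ]
      z , pz ← par? (rev w) t'
      let c₁ : conj (rev w) t' ≈W [ s ]
          c₁ = solve (w ∷ []) ([-]-inv s ∷ []) (inv x₀ ∙ (x₀ ∙ r₀ ∙ inv x₀) ∙ inv (inv x₀)) r₀ refl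
          c₂ : conj (s ∷ rev w) t' ≈W [ s ]
          c₂ = ≈trans (conj-++ [ s ] (rev w) t') (≈trans (conj-cong [ s ] c₁) (++-congˡ [ s ] (ss≈e s)))
          p₁ = par-++ {w} {s ∷ rev w} {t'} (par-congᵗ {w} (≈sym c₂) px) (par-++ {[ s ]} {rev w} (hit {b = false} (≈trans (≡⇒≈ (++-identityʳ _)) c₁) []) pz)
          p₂ = par-++ {w} {rev w} {t'} (par-congᵗ {w} (≈sym c₁) px) pz
      return (trans (par-≈ h (par-congᵗ {t} h p) p₁) (bool x z (par-≈ (inverseʳ w) p₂ [])))
    where
    bool : ∀ x z → x xor z ≡ false → x xor not z ≡ true
    bool false false _ = refl
    bool true  true  _ = refl

  -- The strong exchange condition: an odd count means that some letter is a hit, and deleting that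
  -- letter multiplies w by t.
  par-deletion : ∀ {w t b} → Par w t b → b ≡ true →
                 ∃ λ w' → w' ⊆ w × length w ≡ suc (length w') × w ++ t ≈W w'
  par-deletion {x ∷ w} {t} (hit h _) _ = w , x skip ⊆-refl , refl ,
    ≈trans (++-congˡ [ x ] (≈trans (solve (w ∷ t ∷ []) [] (x₀ ∙ x₁) ((x₀ ∙ x₁ ∙ inv x₀) ∙ x₀) refl) (++-congʳ w h)))
           (++-congʳ w (ss≈e x))
  par-deletion {x ∷ w} (miss _ p) e with par-deletion p e
  ... | w' , sub , l , h = x ∷ w' , refl ∷ sub , cong suc l , ++-congˡ [ x ] h

  Red : Word → Set
  Red w = ∀ w' → w' ≈W w → length w ≤ length w'

  red? : ∀ w → ¬ ¬ ∃ λ r → r ≈W w × Red r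
  red? w = go w (<-wellFounded _)
    where
    go : ∀ w → Acc _<_ (length w) → ¬ ¬ ∃ λ r → r ≈W w × Red r
    go w (acc rs) = em {A = ∃ λ w' → w' ≈W w × length w' < length w} >>= λ where
      (yes (w' , e , l)) → do
        r , e' , h ← go w' (rs l)
        return (r , ≈trans e' e , h)
      (no n) → return (w , ≈refl , λ w' e → ≮⇒≥ (λ l → n (w' , e , l)))

  red-length : ∀ {a b} → a ≈W b → Red a → Red b → length a ≡ length b
  red-length h ra rb = ≤-antisym (ra _ (≈sym h)) (rb _ h)

  Shorter-cong : ∀ {a a' b b'} → a ≈W a' → b ≈W b' → Shorter a b → Shorter a' b'
  Shorter-cong p q (x , e , h) = x , ≈trans e p , λ b e' → h b (≈trans e' (≈sym q))

  Shorter-asym : ∀ {a b} → Shorter a b → ¬ Shorter b a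
  Shorter-asym (a' , e , h) (b' , e' , h') = <-asym (h b' e') (h' a' e)

  Shorter-irrefl : ∀ {a b} → a ≈W b → ¬ Shorter a b
  Shorter-irrefl p (a' , e , h) = <-irrefl refl (h a' (≈trans e p))

  Shorter-trans : ∀ {a b c} → Shorter a b → Shorter b c → Shorter a c
  Shorter-trans (a' , e , h) (b' , e' , h') = a' , e , λ c q → <-trans (h b' e') (h' c q)

  red-Shorter : ∀ {a b} → Red b → length a < length b → Shorter a b
  red-Shorter rb l = _ , ≈refl , λ c q → ≤-trans l (rb c q)

  Shorter-red : ∀ {a b} → Red a → Shorter a b → length a < length b
  Shorter-red ra (a' , e , h) = ≤-trans (s≤s (ra a' e)) (h _ ≈refl)

  par-true⇒ : ∀ {x t} → Par x t true → ¬ ¬ Shorter (x ++ t) x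
  par-true⇒ {x} {t} p = do
    r , e , rr ← red? x
    b , q ← par? r t
    let w' , _ , l , h = par-deletion q (par-≈ e q p)
    return (w' , ≈trans (≈sym h) (++-congʳ t e) , λ c f → ≤-trans (≤-reflexive (sym l)) (rr c (≈trans f (≈sym e))))

  par-mult : ∀ {x t b b'} → Refl t → Par x t b → Par (x ++ t) t b' → b' ≡ not b
  par-mult {x} {t} {b} rt p q = stableᵇ do
    c , r ← par? t t
    let eq : conj t t ≈W t
        eq = solve [] (refl-inv rt ∷ []) (r₀ ∙ r₀ ∙ inv r₀) r₀ refl
    return (trans (par-fun q (par-++ (par-congᵗ {x} (≈sym eq) p) r))
           (trans (cong (b xor_) (par-self rt r)) (xor-true b)))
    where
    xor-true : ∀ b → b xor true ≡ not b
    xor-true false = refl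
    xor-true true  = refl

  mult-mult : ∀ x {t} → Refl t → (x ++ t) ++ t ≈W x
  mult-mult x rt = solve (x ∷ []) (refl-inv rt ∷ []) ((x₀ ∙ r₀) ∙ r₀) x₀ refl

  par-false⇒ : ∀ {x t} → Refl t → Par x t false → ¬ ¬ Shorter x (x ++ t)
  par-false⇒ {x} {t} rt p = do
    b , q ← par? (x ++ t) t
    sh ← par-true⇒ (subst (Par (x ++ t) t) (par-mult rt p q) q)
    return (Shorter-cong (mult-mult x rt) ≈refl sh)

  up⇒par-false : ∀ {x t b} → Shorter x (x ++ t) → Par x t b → b ≡ false
  up⇒par-false {b = false} sh p = refl
  up⇒par-false {b = true}  sh p = ⊥-elim (par-true⇒ p (Shorter-asym sh))

  down⇒par-true : ∀ {x t b} → Refl t → Shorter (x ++ t) x → Par x t b → b ≡ true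
  down⇒par-true {b = true}  rt sh p = refl
  down⇒par-true {b = false} rt sh p = ⊥-elim (par-false⇒ rt p (Shorter-asym sh))

  quot : Word → Word → Word
  quot x y = rev x ++ y

  quot-cong : ∀ {x x' y y'} → x ≈W x' → y ≈W y' → quot x y ≈W quot x' y'
  quot-cong p q = ++-cong (rev-cong p) q

  quot-mult : ∀ x y → x ++ quot x y ≈W y
  quot-mult x y = solve (x ∷ y ∷ []) [] (x₀ ∙ inv x₀ ∙ x₁) x₁ refl

  quot-left : ∀ s x y → quot (s ∷ x) (s ∷ y) ≈W quot x y
  quot-left s x y = solve (x ∷ y ∷ []) ([-]-inv s ∷ []) (inv (r₀ ∙ x₀) ∙ r₀ ∙ x₁) (inv x₀ ∙ x₁) refl

  refl-quot-sym : ∀ x y → Refl (quot x y) → Refl (quot y x)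
  refl-quot-sym x y r = refl-cong (≈trans (≈sym (inv-rev (refl-inv r)))
    (solve (x ∷ y ∷ []) [] (inv (inv x₀ ∙ x₁)) (inv x₁ ∙ x₀) refl)) r

  infix 4 _⟶_
  _⟶_ : Word → Word → Set
  x ⟶ y = Refl (quot x y) × Shorter x y

  ⟶-cong : ∀ {x x' y y'} → x ≈W x' → y ≈W y' → x ⟶ y → x' ⟶ y'
  ⟶-cong p q (r , sh) = refl-cong (quot-cong p q) r , Shorter-cong p q sh

  comparable : ∀ x y → Refl (quot x y) → ¬ ¬ (x ⟶ y ⊎ y ⟶ x)
  comparable x y r = par? x (quot x y) >>= λ where
    (true  , p) → do
      sh ← par-true⇒ p
      return (inj₂ (refl-quot-sym x y r , Shorter-cong (quot-mult x y) ≈refl sh))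
    (false , p) → do
      sh ← par-false⇒ r p
      return (inj₁ (r , Shorter-cong ≈refl (quot-mult x y) sh))

  ≤B-congˡ : ∀ {u u' v} → u ≈W u' → u ≤B v → u' ≤B v
  ≤B-congˡ e (base h) = base (≈trans (≈sym e) h)
  ≤B-congˡ e (step w s p sh h) = step w s (≤B-congˡ e p) sh h

  ≤B-congʳ : ∀ {u v v'} → v ≈W v' → u ≤B v → u ≤B v'
  ≤B-congʳ e (base h) = base (≈trans h e)
  ≤B-congʳ e (step w s p sh h) = step w s p sh (≈trans (≈sym e) h)

  ≤B-refl : ∀ {u} → u ≤B u
  ≤B-refl = base ≈refl

  ≤B-step : ∀ {u v v'} → u ≤B v → v ⟶ v' → u ≤B v'
  ≤B-step {v = v} {v'} p ((w , s , e) , sh) = step w s p (Shorter-cong ≈refl (≈sym h) sh) (≈sym h)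
    where
    h : v ++ refl-word w s ≈W v'
    h = ≈trans (++-congˡ v (≈sym e)) (quot-mult v v')

  step-⟶ : ∀ {v v'} w s → Shorter v (v ++ refl-word w s) → v' ≈W v ++ refl-word w s → v ⟶ v'
  step-⟶ {v} {v'} w s sh e = (w , s , ≈trans (++-congˡ (rev v) e) (solve (v ∷ refl-word w s ∷ []) [] (inv x₀ ∙ x₀ ∙ x₁) x₁ refl))
                           , Shorter-cong ≈refl (≈sym e) sh

  ⟶⇒≤B : ∀ {u v} → u ⟶ v → u ≤B v
  ⟶⇒≤B = ≤B-step ≤B-refl

  ≤B-trans : ∀ {u v w} → u ≤B v → v ≤B w → u ≤B w
  ≤B-trans p (base e) = ≤B-congʳ e p
  ≤B-trans p (step w s q sh e) = step w s (≤B-trans p q) sh e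

  ≤B-cases : ∀ {u v} → u ≤B v → u ≈W v ⊎ Shorter u v
  ≤B-cases (base e) = inj₁ e
  ≤B-cases (step w s p sh e) with ≤B-cases p
  ... | inj₁ q = inj₂ (Shorter-cong (≈sym q) (≈sym e) sh)
  ... | inj₂ q = inj₂ (Shorter-trans q (Shorter-cong ≈refl (≈sym e) sh))

  -- Common ground for left and right multiplication by a generator. The axioms of a special
  -- matching come from `φ-edge`: an edge of the Bruhat graph either is matched by φ or is carried
  -- to an edge of the same direction.
  record Mult (φ : Word → Word) : Set where
    field
      φ-cong : ∀ {x y} → x ≈W y → φ x ≈W φ y
      φ-inv  : ∀ x → φ (φ x) ≈W x
      φ-refl : ∀ x → Refl (quot x (φ x))
      φ-edge : ∀ {x y} → x ⟶ y → ¬ ¬ (φ x ≈W y ⊎ φ x ⟶ φ y)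
      φ-len  : ∀ x → length (φ x) ≡ suc (length x)

    φ-swap : ∀ {x y} → φ x ≈W y → x ≈W φ y
    φ-swap {x} e = ≈trans (≈sym (φ-inv x)) (φ-cong e)

    φ-up : ∀ {x} → Shorter x (φ x) → x ⟶ φ x
    φ-up sh = φ-refl _ , sh

    φ-down : ∀ {x} → Shorter (φ x) x → φ x ⟶ x
    φ-down {x} sh = refl-quot-sym x (φ x) (φ-refl x) , sh

    φ-cases : ∀ x → ¬ ¬ (Shorter x (φ x) ⊎ Shorter (φ x) x)
    φ-cases x = do
      inj₁ h ← comparable x (φ x) (φ-refl x)
        where inj₂ h → return (inj₂ (proj₂ h))
      return (inj₁ (proj₂ h))

    -- With `lift₂`, the lifting property before any direction of φ is assumed: `φ-edge` is applied
    -- to each edge of a chain from u to v.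
    lift₁ : ∀ {u v} → u ≤B v → ¬ ¬ (φ u ≤B v ⊎ φ u ≤B φ v)
    lift₁ (base e) = return (inj₂ (base (φ-cong e)))
    lift₁ {u} {v'} (step {v} w s p sh e) = lift₁ p >>= λ where
        (inj₁ q) → return (inj₁ (step w s q sh e))
        (inj₂ q) → φ-edge (step-⟶ w s sh e) >>= λ where
          (inj₁ h) → return (inj₁ (≤B-congʳ h q))
          (inj₂ h) → return (inj₂ (≤B-step q h))

    lift₂ : ∀ {u v} → u ≤B v → ¬ ¬ (u ≤B φ v ⊎ φ u ≤B φ v)
    lift₂ (base e) = return (inj₂ (base (φ-cong e)))
    lift₂ {u} {v'} (step {v} w s p sh e) = φ-edge (step-⟶ w s sh e) >>= λ where
        (inj₁ h) → return (inj₁ (≤B-congʳ (φ-swap h) p))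
        (inj₂ h) → lift₂ p >>= λ where
          (inj₁ q) → return (inj₁ (≤B-step q h))
          (inj₂ q) → return (inj₂ (≤B-step q h))

    down-closed : ∀ {u v} → Shorter (φ v) v → u ≤B v → ¬ ¬ (φ u ≤B v)
    down-closed sh p = lift₁ p >>= λ where
      (inj₁ q) → return q
      (inj₂ q) → return (≤B-step q (φ-down sh))

    lift-up : ∀ {u v} → Shorter u (φ u) → u ≤B v → ¬ ¬ (u ≤B φ v)
    lift-up sh p = lift₂ p >>= λ where
      (inj₁ q) → return q
      (inj₂ q) → return (≤B-trans (⟶⇒≤B (φ-up sh)) q)

    lift-dn : ∀ {u v} → Shorter (φ u) u → u ≤B v → ¬ ¬ (φ u ≤B φ v)
    lift-dn sh p = lift₂ p >>= λ where
      (inj₁ q) → return (≤B-trans (⟶⇒≤B (φ-down sh)) q)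
      (inj₂ q) → return q

  left right : S → Word → Word
  left s w = s ∷ w
  right s w = w ∷ʳ s

  left-mult : ∀ s → Mult (left s)
  left-mult s = record
    { φ-cong = ++-congˡ [ s ]
    ; φ-inv  = λ x → ++-congʳ x (ss≈e s)
    ; φ-refl = λ x → rev x , s , ≡⇒≈ (cong (λ z → rev x ++ s ∷ z) (sym (reverse-involutive x)))
    ; φ-edge = edge
    ; φ-len  = λ _ → refl
    }
    where
    edge : ∀ {x y} → x ⟶ y → ¬ ¬ (s ∷ x ≈W y ⊎ (s ∷ x) ⟶ (s ∷ y))
    -- The exceptional case is s = y x⁻¹. Otherwise the new letter s is a miss, so the parity at x⁻¹
    -- y stays even and the edge still goes up.
    edge {x} {y} (r , sh) = em {A = conj x (quot x y) ≈W [ s ]} >>= λ where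
      (yes h) → return (inj₁ (≈trans (++-congʳ x (≈sym h)) (solve (x ∷ y ∷ []) [] ((x₀ ∙ (inv x₀ ∙ x₁) ∙ inv x₀) ∙ x₀) x₁ refl)))
      (no n) → do
        b , p ← par? x (quot x y)
        let p' = subst (Par x (quot x y)) (up⇒par-false (Shorter-cong ≈refl (≈sym (quot-mult x y)) sh) p) p
        sh' ← par-false⇒ r (miss n p')
        return (inj₂ (refl-cong (≈sym (quot-left s x y)) r , Shorter-cong ≈refl (++-congˡ [ s ] (quot-mult x y)) sh'))

  right-mult : ∀ s → Mult (right s)
  right-mult s = record
    { φ-cong = ++-congʳ [ s ]
    ; φ-inv  = λ x → ≈trans (≡⇒≈ (++-assoc x [ s ] [ s ])) (≈trans (++-congˡ x (ss≈e s)) (≡⇒≈ (++-identityʳ x)))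
    ; φ-refl = λ x → [] , s , solve (x ∷ []) ([-]-inv s ∷ []) (inv x₀ ∙ x₀ ∙ r₀) r₀ refl
    ; φ-edge = edge
    ; φ-len  = λ x → trans (length-++ x) (+-comm (length x) 1)
    }
    where
    edge : ∀ {x y} → x ⟶ y → ¬ ¬ (x ∷ʳ s ≈W y ⊎ (x ∷ʳ s) ⟶ (y ∷ʳ s))
    edge {x} {y} (r , sh) = em {A = quot x y ≈W [ s ]} >>= λ where
      (yes h) → return (inj₁ (≈trans (++-congˡ x (≈sym h)) (quot-mult x y)))
      (no n) → do
        b , p ← par? x (quot x y)
        let t  = quot x y
            -- The reflection that takes x s to y s; the new last letter is a miss for it, so its
            -- parity is that of t in x.
            t' = conj [ s ] t
            p' = subst (Par x t) (up⇒par-false (Shorter-cong ≈refl (≈sym (quot-mult x y)) sh) p) p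
            sst : t ≈W conj [ s ] t'
            sst = solve (t ∷ []) ([-]-inv s ∷ []) x₀ (r₀ ∙ (r₀ ∙ x₀ ∙ inv r₀) ∙ inv r₀) refl
            mis : ¬ conj [] t' ≈W [ s ]
            mis = λ h → n (≈trans sst (≈trans (conj-cong [ s ] (≈trans (≡⇒≈ (sym (++-identityʳ t'))) h)) (++-congˡ [ s ] (ss≈e s))))
            q : Par (x ∷ʳ s) t' false
            q = par-++ {x} {[ s ]} (par-congᵗ {x} sst p') (miss mis [])
            r' : Refl t'
            r' = refl-conj [ s ] r
            e : (x ∷ʳ s) ++ t' ≈W y ∷ʳ s
            e = solve (x ∷ y ∷ []) ([-]-inv s ∷ []) ((x₀ ∙ r₀) ∙ r₀ ∙ (inv x₀ ∙ x₁) ∙ inv r₀) (x₁ ∙ r₀) refl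
        sh' ← par-false⇒ r' q
        return (inj₂ (refl-cong (≈trans (solve (x ∷ t' ∷ []) ([-]-inv s ∷ []) x₁ (inv (x₀ ∙ r₀) ∙ (x₀ ∙ r₀) ∙ x₁) refl)
                                         (++-congˡ (rev (x ∷ʳ s)) e)) r'
                     , Shorter-cong ≈refl e sh'))

  -- Each step down the chain deletes a letter, by `par-deletion`. This bounds the interval below v
  -- by the finitely many subwords of one word.
  subword : ∀ {u v} → u ≤B v → ∀ {w} → w ≈W v → ¬ ¬ ∃ λ w' → w' ⊆ w × u ≈W w'
  subword (base h) {w} e = return (w , ⊆-refl , ≈trans h (≈sym e))
  subword {u} (step {v} {v'} w₀ s p sh h) {w} e = do
    let rt = w₀ , s , ≈refl
        t  = refl-word w₀ s
        wt≈v : w ++ t ≈W v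
        wt≈v = ≈trans (++-congʳ t (≈trans e h)) (mult-mult v rt)
    b , q ← par? w t
    let d , sub , _ , h' = par-deletion q (down⇒par-true rt (Shorter-cong (≈sym wt≈v) (≈sym (≈trans e h)) sh) q)
    w' , sub' , f ← subword p (≈trans (≈sym h') wt≈v)
    return (w' , ⊆-trans sub' sub , f)

  red-tail : ∀ {s w} → Red (s ∷ w) → Red w
  red-tail {s} r w' e = s≤s⁻¹ (r (s ∷ w') (++-congˡ [ s ] e))
    where open import Data.Nat using (s≤s⁻¹)

  red-down : ∀ {s w} → Red (s ∷ w) → Shorter (s ∷ s ∷ w) (s ∷ w)
  red-down {s} {w} r = Shorter-cong (≈sym (++-congʳ w (ss≈e s))) ≈refl (red-Shorter r ≤-refl)

  red-edge : ∀ {s w} → Red (s ∷ w) → w ⟶ s ∷ w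
  red-edge {s} {w} r = Mult.φ-up (left-mult s) (red-Shorter r ≤-refl)

  -- Induction on the word s v. If u is not below v, then s lowers u and s u ≤ v; a cover u₂ of s u
  -- below v is carried by s to a cover of u, since s u₂ = u would put u below v.
  up-cover : ∀ {v} → Red v → ∀ {u} → Red u → u ≤B v → ¬ u ≈W v →
             ¬ ¬ ∃ λ u' → Red u' × length u' ≡ suc (length u) × u ⟶ u' × u' ≤B v
  up-cover {[]} rv {u} ru p ne with ≤B-cases p
  ... | inj₁ e = ⊥-elim (ne e)
  ... | inj₂ sh with Shorter-red ru sh
  ...   | ()
  up-cover {s ∷ v} rv {u} ru p ne = em {A = u ≤B v} >>= λ where
      (yes q) → em {A = u ≈W v} >>= λ where
        (yes e) → return (s ∷ v , rv , cong suc (sym (red-length e ru (red-tail rv))) , ⟶-cong (≈sym e) ≈refl (red-edge rv) , ≤B-refl)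
        (no n) → do
          u' , r' , l , ed , le ← up-cover (red-tail rv) ru q n
          return (u' , r' , l , ed , ≤B-step le (red-edge rv))
      (no nq) → do
        c ← φ-cases u
        case c of λ where
          (inj₁ up) → λ k → lift-up up p (λ le → nq (≤B-congʳ (φ-inv v) le))
          (inj₂ dn) → do
            su≤ ← lift-dn dn p
            let su≤v = ≤B-congʳ (φ-inv v) su≤
            y , ey , ry ← red? (s ∷ u)
            u₂ , r₂ , l₂ , ed , le ← up-cover (red-tail rv) ry (≤B-congˡ (≈sym ey) su≤v)
                (λ h → ne (φ-swap (≈trans (≈sym ey) h)))
            let ly : length u ≡ suc (length y)
                ly = ≤-antisym (ru (s ∷ y) (≈trans (++-congˡ [ s ] ey) (φ-inv u))) (Shorter-red ry (Shorter-cong (≈sym ey) ≈refl dn))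
            inj₂ ed' ← φ-edge ed
              where inj₁ h → λ k → nq (≤B-congˡ (≈trans (≈sym h) (≈trans (φ-cong ey) (φ-inv u))) le)
            let ed″ : u ⟶ s ∷ u₂
                ed″ = ⟶-cong (≈trans (φ-cong ey) (φ-inv u)) ≈refl ed'
            z , ez , rz ← red? (s ∷ u₂)
            let lz : length z ≡ suc (length u)
                lz = ≤-antisym (≤-trans (rz (s ∷ u₂) (≈sym ez)) (≤-reflexive (trans (cong suc l₂) (cong suc (sym ly)))))
                               (Shorter-red ru (Shorter-cong ≈refl (≈sym ez) (proj₂ ed″)))
            le' ← down-closed (red-down rv) (≤B-step le (red-edge rv))
            return (z , rz , lz , ⟶-cong ≈refl (≈sym ez) ed″ , ≤B-congˡ (≈sym ez) le')
    where open Mult (left-mult s)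

  cover-edge : ∀ {u v} → Red u → Red v → length v ≡ suc (length u) → u ≤B v → ¬ ¬ (u ⟶ v)
  cover-edge ru rv l (base e) = ⊥-elim (1+n≢n (trans (sym l) (sym (red-length e ru rv))))
  cover-edge {u} {v} ru rv l (step {w} w₀ s p sh e) with ≤B-cases p
  ... | inj₁ h = return (⟶-cong (≈sym h) ≈refl (step-⟶ w₀ s sh e))
  ... | inj₂ sh' = do
    y , ey , ry ← red? w
    let a = Shorter-red ru (Shorter-cong ≈refl (≈sym ey) sh')
        b = Shorter-red ry (Shorter-cong (≈sym ey) (≈sym e) sh)
    return (⊥-elim (1+n≰n (≤-trans (s≤s a) (≤-trans b (≤-reflexive l)))))

  record DownMult (v : Word) : Set where
    constructor downMult
    field
      {φ}  : Word → Word
      mult : Mult φ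
      down : Shorter (φ v) v

  last-letter : ∀ (x : S) w → ∃₂ λ w' t → x ∷ w ≡ w' ∷ʳ t
  last-letter x [] = [] , x , refl
  last-letter x (y ∷ w) with last-letter y w
  ... | w' , t , e = x ∷ w' , t , cong (x ∷_) e

  -- Multiply on the left by the first letter s and on the right by the last letter t. If s v = v t,
  -- use the second letter r on the left in place of t: then r v = w t is shorter than v, and s v =
  -- r v would make v = s r w not reduced.
  two-mults : ∀ {v} → Red v → 2 ≤ length v →
              ¬ ¬ ∃₂ λ (φ ψ : DownMult v) → ¬ DownMult.φ φ v ≈W DownMult.φ ψ v
  two-mults {_ ∷ []} rv (s≤s ())
  two-mults {s ∷ r ∷ w} rv _ with last-letter s (r ∷ w)
  ... | w' , t , eq = em {A = s ∷ v ≈W v ∷ʳ t} >>= λ where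
      (no n) → return (downMult (left-mult s) (red-down rv) , downMult (right-mult t) dn-t , n)
      (yes h) → return (downMult (left-mult s) (red-down rv) , downMult (left-mult r) (dn-r h)
        , λ e → 1+n≰n (≤-trans (n≤1+n _) (rv w (≈sym (≈trans (++-congʳ (r ∷ w) (sr e)) (++-congʳ w (ss≈e r)))))))
    where
    v : Word
    v = s ∷ r ∷ w
    lv : length v ≡ suc (length w')
    lv = trans (cong length eq) (Mult.φ-len (right-mult t) w')
    vt : v ∷ʳ t ≈W w'
    vt = ≈trans (≡⇒≈ (cong (_∷ʳ t) eq)) (Mult.φ-inv (right-mult t) w')
    dn-t : Shorter (v ∷ʳ t) v
    dn-t = Shorter-cong (≈sym vt) ≈refl (red-Shorter rv (≤-reflexive (sym lv)))
    dn-r : s ∷ v ≈W v ∷ʳ t → Shorter (r ∷ v) v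
    dn-r h = Shorter-cong (≈sym e′) ≈refl (red-Shorter {w ∷ʳ t} rv (≤-reflexive (cong suc (Mult.φ-len (right-mult t) w))))
      where
      e′ : r ∷ v ≈W w ∷ʳ t
      e′ = ≈trans (++-congˡ [ r ] (≈trans (≈sym (Mult.φ-inv (right-mult t) v))
            (++-congʳ [ t ] (≈trans (≈sym h) (Mult.φ-inv (left-mult s) (r ∷ w))))))
            (++-congʳ (w ∷ʳ t) (ss≈e r))
    sr : s ∷ v ≈W r ∷ v → [ s ] ≈W [ r ]
    sr e = ≈trans (solve (v ∷ []) ([-]-inv s ∷ []) r₀ ((r₀ ∙ x₀) ∙ inv x₀) refl)
          (≈trans (++-congʳ (rev v) e) (solve (v ∷ []) ([-]-inv r ∷ []) ((r₀ ∙ x₀) ∙ inv x₀) r₀ refl))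

-- Reflection subgroups and common covers

module DihedralBound (C : CoxeterSystem) where
  open Bruhat C public

  -- A parity is found only under double negation, but it is unique, so conclusions about booleans
  -- can be drawn from it, see `pp-fun`.
  PP : Word → Word → Bool → Set
  PP w t b = ¬ ¬ Par w t b

  pp-++ : ∀ {u v t a b} → PP u (conj v t) a → PP v t b → PP (u ++ v) t (a xor b)
  pp-++ p q = do
    x ← p
    y ← q
    return (par-++ x y)

  pp-fun : ∀ {w t b b'} → PP w t b → PP w t b' → b ≡ b'
  pp-fun p q = stableᵇ do
    x ← p
    y ← q
    return (par-fun x y)

  pp-≈ : ∀ {w w' t b} → w ≈W w' → PP w t b → PP w' t b
  pp-≈ {w} {w'} {t} e p = do
    x ← p
    b' , y ← par? w' t
    return (subst (Par w' t) (sym (par-≈ e x y)) y)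

  pp-congᵗ : ∀ {w t t' b} → t ≈W t' → PP w t b → PP w t' b
  pp-congᵗ {w} e p = do
    x ← p
    return (par-congᵗ {w} e x)

  pp-cancel : ∀ {u v t c b} → PP (u ++ v) t c → PP v t b → PP u (conj v t) (c xor b)
  pp-cancel {u} {v} {t} {c} {b} p q = do
    a , x ← par? u (conj v t)
    return (subst (Par u (conj v t)) (xor-move a b c (pp-fun (pp-++ {u} {v} (return x) q) p)) x)
    where
    xor-move : ∀ a b c → a xor b ≡ c → a ≡ c xor b
    xor-move false false c e = trans e (sym (Bool.xor-identityʳ c))
    xor-move false true  .true refl = refl
    xor-move true  false .true refl = refl
    xor-move true  true  .false refl = refl

  pp-cases : ∀ w t {b} → (PP w t (not b) → ⊥) → PP w t b
  pp-cases w t {b} n = do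
    b' , x ← par? w t
    return (subst (Par w t) (pick b' b λ e → n (return (subst (Par w t) e x))) x)
    where
    pick : ∀ b' b → ¬ b' ≡ not b → b' ≡ b
    pick false false _ = refl
    pick false true  n = ⊥-elim (n refl)
    pick true  false n = ⊥-elim (n refl)
    pick true  true  _ = refl

  clash : ∀ {w t} → PP w t true → PP w t false → ⊥
  clash p q with pp-fun p q
  ... | ()

  pp-self : ∀ {t} → Refl t → PP t t true
  pp-self {t} r = do
    b , p ← par? t t
    return (subst (Par t t) (par-self r p) p)

  pp-up : ∀ {x y} → x ⟶ y → PP x (quot x y) false
  pp-up {x} {y} (r , sh) = do
    b , p ← par? x (quot x y)
    return (subst (Par x (quot x y)) (up⇒par-false (Shorter-cong ≈refl (≈sym (quot-mult x y)) sh) p) p)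

  pp-down : ∀ {x t} → Refl t → Shorter (x ++ t) x → PP x t true
  pp-down {x} {t} r sh = do
    b , p ← par? x t
    return (subst (Par x t) (down⇒par-true r sh p) p)

  true⇒shorter : ∀ {x t} → PP x t true → ¬ ¬ Shorter (x ++ t) x
  true⇒shorter p = p >>= par-true⇒

  false⇒shorter : ∀ {x t} → Refl t → PP x t false → ¬ ¬ Shorter x (x ++ t)
  false⇒shorter r p = p >>= par-false⇒ r

  pp-rev : ∀ v {r b} → PP v r b → PP (rev v) (conj v r) b
  pp-rev v {r} {b} p = pp-cancel {rev v} {v} {r} {false} (pp-≈ (≈sym (inverseˡ v)) (return [])) p

  refl≉e : ∀ {t} → Refl t → ¬ t ≈W []
  refl≉e r e = clash (pp-self r) (pp-≈ (≈sym e) (return []))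

  conj-self : ∀ {t} → Refl t → conj t t ≈W t
  conj-self r = solve [] (refl-inv r ∷ []) (r₀ ∙ r₀ ∙ inv r₀) r₀ refl

  conj-conj : ∀ {t} → Refl t → ∀ u → conj t (conj t u) ≈W u
  conj-conj {t} r u = solve (u ∷ []) (refl-inv r ∷ []) (r₀ ∙ (r₀ ∙ x₀ ∙ inv r₀) ∙ inv r₀) x₀ refl

  -- Write t′ = w s w⁻¹. As t′ commutes with t, the letters of w and those of w⁻¹ contribute the
  -- same parity; the middle letter is a miss because t ≠ t′.
  commuting-false : ∀ {t t'} → Refl t' → ¬ t ≈W t' → conj t' t ≈W t → PP t' t false
  commuting-false {t} {t'} (w , s , h) ne com = pp-≈ (≈sym h) total
    where
    c₀ : Word
    c₀ = conj (rev w) t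
    ne-s : ¬ conj [] c₀ ≈W [ s ]
    ne-s e = ne (≈trans (solve (w ∷ t ∷ []) [] x₁ (x₀ ∙ (inv x₀ ∙ x₁ ∙ inv (inv x₀)) ∙ inv x₀) refl)
                 (≈trans (conj-cong w (≈trans (≡⇒≈ (sym (++-identityʳ c₀))) e)) (≈sym h)))
    same : conj (s ∷ rev w) t ≈W c₀
    same = ≈trans (solve (w ∷ t ∷ []) ([-]-inv s ∷ []) ((r₀ ∙ inv x₀) ∙ x₁ ∙ inv (r₀ ∙ inv x₀))
                     (inv x₀ ∙ ((x₀ ∙ r₀ ∙ inv x₀) ∙ x₁ ∙ inv (x₀ ∙ r₀ ∙ inv x₀)) ∙ inv (inv x₀)) refl)
                  (conj-cong (rev w) (≈trans (conj-congˡ t (≈sym h)) com))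
    total : PP (conj w [ s ]) t false
    total = do
      b , p ← par? (rev w) t
      let q : PP (rev (rev w)) c₀ b
          q = pp-rev (rev w) (return p)
      x ← pp-++ {w} {s ∷ rev w} {t} {b} {b} (pp-congᵗ {w} (≈sym same) (subst (λ z → PP z c₀ b) (reverse-involutive w) q))
             (pp-++ {[ s ]} {rev w} {t} {false} {b} (return (miss ne-s [])) (return p))
      return (subst (Par (conj w [ s ]) t) (Bool.xor-same b) x)

  record ReflectionSet (F : Word → Set) : Set where
    field
      F-cong : ∀ {t t'} → t ≈W t' → F t → F t'
      F-refl : ∀ {t} → F t → Refl t
      F-conj : ∀ {t t'} → F t → F t' → F (conj t t')

  -- the canonical generators of the reflection subgroup generated by F
  χ : (Word → Set) → Word → Set
  χ F τ = F τ × (∀ r → F r → ¬ r ≈W τ → PP τ r false)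

  module _ {F} (RF : ReflectionSet F) where
    open ReflectionSet RF

    Clean : Word → Set
    Clean v = ∀ r → F r → PP v r false

    split-clean : ∀ y → ¬ Clean y → ¬ ¬ ∃₂ λ u v → ∃ λ x → y ≡ u ++ x ∷ v × Clean v × ¬ Clean (x ∷ v)
    split-clean [] n = ⊥-elim (n λ r f → return [])
    split-clean (x ∷ y) n = em {A = Clean y} >>= λ where
      (yes cl) → return ([] , y , x , refl , cl , n)
      (no n') → do
        u , v , z , e , cl , n″ ← split-clean y n'
        return (x ∷ u , v , z , cong (x ∷_) e , cl , n″)

    unclean-letter : ∀ {x v} → Clean v → ¬ Clean (x ∷ v) → ¬ ¬ ∃ λ τ → F τ × conj v τ ≈W [ x ]
    unclean-letter cl n k = n λ r f → cl r f >>= λ p → return (miss (λ h → k (r , f , h)) p)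

    -- Here τ = v⁻¹ x v. No member of F is hit by v, nor, since F is stable under conjugation by τ,
    -- by v⁻¹; the middle letter hits τ only.
    hit-canonical : ∀ {x v τ} → Clean v → F τ → conj v τ ≈W [ x ] → χ F τ
    hit-canonical {x} {v} {τ} cl f h = f , λ ρ fρ ne → pp-≈ τ≈
        (pp-++ {rev v} {x ∷ v} {ρ} {false} {false}
          (pp-congᵗ {rev v} (≈sym (moved ρ)) (pp-rev v (cl (conj τ ρ) (F-conj f fρ))))
          (cl ρ fρ >>= λ p → return (miss (λ h' → ne (≈trans (conj⁻ v h') (≈sym (conj⁻ v h)))) p)))
      where
      τ≈ : rev v ++ x ∷ v ≈W τ
      τ≈ = ≈trans (++-congˡ (rev v) (++-congʳ v (≈sym h))) (solve (v ∷ τ ∷ []) [] (inv x₀ ∙ (x₀ ∙ x₁ ∙ inv x₀) ∙ x₀) x₁ refl)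
      moved : ∀ ρ → conj (x ∷ v) ρ ≈W conj v (conj τ ρ)
      moved ρ = ≈trans (conj-congˡ ρ (≈trans (solve (v ∷ [ x ] ∷ []) [] (x₁ ∙ x₀) (x₀ ∙ inv x₀ ∙ x₁ ∙ x₀) refl) (++-congˡ v τ≈)))
                       (conj-++ v τ ρ)

    -- Read a reduced word from the right up to the first letter that hits a member τ of F. Then τ
    -- is canonical by `hit-canonical`, and deleting the letter shows that y τ is shorter.
    canonical-inversion : ∀ {y t} → F t → PP y t true → ¬ ¬ ∃ λ τ → χ F τ × PP y τ true
    canonical-inversion {y} {t} f p = do
      y' , e , ry ← red? y
      u , v , x , eq , cl , n ← split-clean y' (λ cl → clash (pp-≈ (≈sym e) p) (cl t f))
      τ , fτ , h ← unclean-letter cl n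
      let sh : y' ++ τ ≈W u ++ v
          sh = ≈trans (≡⇒≈ (cong (_++ τ) eq)) (≈trans
                 (solve (u ∷ v ∷ [ x ] ∷ τ ∷ []) [] ((x₀ ∙ x₂ ∙ x₁) ∙ var (# 3)) (x₀ ∙ x₂ ∙ (x₁ ∙ var (# 3) ∙ inv x₁) ∙ x₁) refl)
                 (≈trans (++-congˡ u (++-congˡ [ x ] (++-congʳ v h))) (++-congˡ u (++-congʳ v (ss≈e x)))))
          lt : length (u ++ v) < length y'
          lt = ≤-reflexive (trans (cong suc (length-++ u)) (trans (sym (+-suc (length u) (length v)))
                 (trans (sym (length-++ u)) (cong length (sym eq)))))
      return (τ , hit-canonical cl fτ h , pp-≈ e (pp-down (F-refl fτ) (Shorter-cong (≈sym sh) ≈refl (red-Shorter ry lt))))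

  -- Reflection subgroups with two canonical generators

  module Dihedral {F} (RF : ReflectionSet F) (L : Bool → Word) (Lχ : ∀ b → χ F (L b)) where
    open ReflectionSet RF

    L-refl : ∀ b → Refl (L b)
    L-refl b = F-refl (proj₁ (Lχ b))

    ⟪_⟫ : List Bool → Word
    ⟪ [] ⟫    = []
    ⟪ b ∷ z ⟫ = L b ++ ⟪ z ⟫

    ⟪⟫-++ : ∀ y z → ⟪ y ++ z ⟫ ≡ ⟪ y ⟫ ++ ⟪ z ⟫
    ⟪⟫-++ [] z = refl
    ⟪⟫-++ (b ∷ y) z = trans (cong (L b ++_) (⟪⟫-++ y z)) (sym (++-assoc (L b) ⟪ y ⟫ ⟪ z ⟫))

    ⟪⟫-rev : ∀ z → ⟪ reverse z ⟫ ≈W rev ⟪ z ⟫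
    ⟪⟫-rev [] = ≈refl
    ⟪⟫-rev (b ∷ z) = ≈trans (≡⇒≈ (trans (cong ⟪_⟫ (unfold-reverse b z)) (trans (⟪⟫-++ (reverse z) [ b ]) (cong (⟪ reverse z ⟫ ++_) (++-identityʳ (L b))))))
      (≈trans (++-cong (⟪⟫-rev z) (≈sym (inv-rev (refl-inv (L-refl b))))) (≡⇒≈ (sym (reverse-++ (L b) ⟪ z ⟫))))

    D : Word → Set
    D r = ∃₂ λ z b → r ≈W conj ⟪ z ⟫ (L b)

    D-conj⟪⟫ : ∀ z {r} → D r → D (conj ⟪ z ⟫ r)
    D-conj⟪⟫ z {r} (y , b , e) = z ++ y , b , ≈trans (conj-cong ⟪ z ⟫ e) (≈trans (≈sym (conj-++ ⟪ z ⟫ ⟪ y ⟫ (L b))) (≡⇒≈ (cong (λ w → conj w (L b)) (sym (⟪⟫-++ z y)))))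

    D-gen : ∀ b → D (L b)
    D-gen b = [] , b , ≡⇒≈ (sym (++-identityʳ (L b)))

    D-word : ∀ {r} → D r → ∃ λ z → r ≈W ⟪ z ⟫
    D-word {r} (z , b , e) = z ++ b ∷ reverse z , ≈trans e (≈trans (++-congˡ ⟪ z ⟫ (++-congˡ (L b) (≈sym (⟪⟫-rev z)))) (≡⇒≈ (sym (⟪⟫-++ z (b ∷ reverse z)))))

    D⊆F : ∀ {r} → D r → F r
    D⊆F (z , b , e) = F-cong (≈sym e) (go z)
      where
      go : ∀ z → F (conj ⟪ z ⟫ (L b))
      go [] = F-cong (≡⇒≈ (sym (++-identityʳ (L b)))) (proj₁ (Lχ b))
      go (c ∷ z) = F-cong (≈sym (conj-++ (L c) ⟪ z ⟫ (L b))) (F-conj (proj₁ (Lχ c)) (go z))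

    D-set : ReflectionSet D
    D-set = record
      { F-cong = λ e (z , b , h) → z , b , ≈trans (≈sym e) h
      ; F-refl = λ d → F-refl (D⊆F d)
      ; F-conj = λ {t} {t'} d d' → let z , e = D-word d ; y , b , h = D-conj⟪⟫ z d'
                                   in y , b , ≈trans (conj-congˡ t' e) h
      }

    record RedB (z : List Bool) : Set where
      constructor redB
      field least : ∀ z' → ⟪ z' ⟫ ≈W ⟪ z ⟫ → length z ≤ length z'
    open RedB

    redB? : ∀ z → ¬ ¬ ∃ λ y → ⟪ y ⟫ ≈W ⟪ z ⟫ × RedB y
    redB? z = go z (<-wellFounded _)
      where
      go : ∀ z → Acc _<_ (length z) → ¬ ¬ ∃ λ y → ⟪ y ⟫ ≈W ⟪ z ⟫ × RedB y
      go z (acc rs) = em {A = ∃ λ z' → ⟪ z' ⟫ ≈W ⟪ z ⟫ × length z' < length z} >>= λ where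
        (yes (z' , e , l)) → do
          y , e' , h ← go z' (rs l)
          return (y , ≈trans e' e , h)
        (no n) → return (z , ≈refl , redB λ z' e → ≮⇒≥ (λ l → n (z' , e , l)))

    -- The exchange condition for words in the two generators: a canonical generator inverts no
    -- other member of F, so it behaves like a single letter.
    deletion : ∀ z {r} → D r → PP ⟪ z ⟫ r true → ¬ ¬ ∃ λ z' → length z ≡ suc (length z') × ⟪ z ⟫ ++ r ≈W ⟪ z' ⟫
    deletion [] d p = ⊥-elim (clash p (return []))
    deletion (b ∷ z) {r} d p = em {A = conj ⟪ z ⟫ r ≈W L b} >>= λ where
      (yes h) → return (z , refl , ≈trans
          (solve (⟪ z ⟫ ∷ r ∷ []) (refl-inv (L-refl b) ∷ []) ((r₀ ∙ x₀) ∙ x₁) (r₀ ∙ (x₀ ∙ x₁ ∙ inv x₀) ∙ x₀) refl)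
          (≈trans (++-congˡ (L b) (++-congʳ ⟪ z ⟫ h)) (solve (⟪ z ⟫ ∷ []) (refl-inv (L-refl b) ∷ []) (r₀ ∙ r₀ ∙ x₀) x₀ refl)))
      (no n) → do
        let q : PP ⟪ z ⟫ r true
            q = pp-cases ⟪ z ⟫ r λ k → clash p (pp-++ {L b} {⟪ z ⟫} {r} {false} {false} (proj₂ (Lχ b) _ (D⊆F (D-conj⟪⟫ z d)) n) k)
        z' , l , e ← deletion z d q
        return (b ∷ z' , cong suc l , ≈trans (≡⇒≈ (++-assoc (L b) ⟪ z ⟫ r)) (++-congˡ (L b) e))

    redB-empty : ∀ z → RedB z → (∀ b → PP ⟪ z ⟫ (L b) false) → z ≡ []
    redB-empty z rz k with initLast z
    ... | [] = refl
    ... | y ∷ʳ′ b = ⊥-elim (run (deletion y (D-gen b) q >>= λ (z' , l , e) →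
            return (1+n≰n (≤-trans (n≤1+n _) (≤-trans (≤-reflexive (sym (trans (length-++ y) (trans (+-comm (length y) 1) (cong suc l)))))
              (least rz z' (≈trans (≈sym e) (≡⇒≈ (sym ⟪yb⟫))))))))) 
      where
      ⟪yb⟫ : ⟪ y ++ [ b ] ⟫ ≡ ⟪ y ⟫ ++ L b
      ⟪yb⟫ = trans (⟪⟫-++ y [ b ]) (cong (⟪ y ⟫ ++_) (++-identityʳ (L b)))
      q : PP ⟪ y ⟫ (L b) true
      q = pp-congᵗ {⟪ y ⟫} (conj-self (L-refl b))
            (pp-cancel {⟪ y ⟫} {L b} {L b} {false} {true} (subst (λ w → PP w (L b) false) ⟪yb⟫ (k b)) (pp-self (L-refl b)))

    -- Otherwise y inverts a canonical generator τ of D different from both `L b`. Being canonical,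
    -- τ inverts neither of them, so by `redB-empty` its reduced word in them is empty and τ = e,
    -- which is no reflection.
    no-inversions : ∀ {y} → (∀ b → PP y (L b) false) → ∀ {r} → D r → PP y r false
    no-inversions {y} k {r} d = pp-cases y r λ p → run do
        τ , (dτ , canτ) , q ← canonical-inversion D-set d p
        let z₀ , e₀ = D-word dτ
        z , e , rz ← redB? z₀
        let not-gen : ∀ b → ¬ L b ≈W τ
            not-gen b h = clash q (pp-congᵗ {y} h (k b))
            z≡[] = redB-empty z rz λ b → pp-≈ (≈trans e₀ (≈sym e)) (canτ (L b) (D-gen b) (not-gen b))
        return (refl≉e (F-refl (D⊆F dτ)) (≈trans e₀ (≈trans (≈sym e) (≡⇒≈ (cong ⟪_⟫ z≡[])))))

    altB : Bool → ℕ → List Bool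
    altB b zero    = []
    altB b (suc n) = b ∷ altB (not b) n

    altB-length : ∀ b n → length (altB b n) ≡ n
    altB-length b zero    = refl
    altB-length b (suc n) = cong suc (altB-length (not b) n)

    altB-∷ʳ : ∀ b n → ∃ λ x → altB b (suc n) ≡ altB b n ∷ʳ x
    altB-∷ʳ b zero = b , refl
    altB-∷ʳ b (suc n) with altB-∷ʳ (not b) n
    ... | x , e = x , cong (b ∷_) e

    redB-alternates : ∀ z → RedB z → ∃ λ b → z ≡ altB b (length z)
    redB-alternates [] _ = true , refl
    redB-alternates (c ∷ []) _ = c , refl
    redB-alternates (c ∷ d ∷ z) rz with redB-alternates (d ∷ z) redB-tail
      where
      redB-tail : RedB (d ∷ z)
      redB-tail = redB λ z' h → s≤s⁻¹ (least rz (c ∷ z') (++-congˡ (L c) h))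
        where open import Data.Nat using (s≤s⁻¹)
    ... | b , e with c Bool.≟ not d
    ...   | yes refl = not d , cong (not d ∷_) (trans e (cong (λ x → altB x (length (d ∷ z))) (trans (sym (∷-injectiveˡ e)) (sym (Bool.not-involutive d)))))
    ...   | no ne with Bool.¬-not ne
    ...     | c≡ = ⊥-elim (1+n≰n (≤-trans (n≤1+n _) (least rz z (≈sym (≈trans (≡⇒≈ (cong (λ x → L x ++ L d ++ ⟪ z ⟫) (trans c≡ (Bool.not-involutive d))))
               (solve (⟪ z ⟫ ∷ []) (refl-inv (L-refl d) ∷ []) (r₀ ∙ r₀ ∙ x₀) x₀ refl))))))

    redB-prefix : ∀ y z → RedB (y ++ z) → RedB y
    redB-prefix y z r = redB λ y' h → +-cancelʳ-≤ (length z) (length y) (length y')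
      (subst₂ _≤_ (length-++ y) (length-++ y') (least r (y' ++ z)
        (≈trans (≡⇒≈ (⟪⟫-++ y' z)) (≈trans (++-congʳ ⟪ z ⟫ h) (≡⇒≈ (sym (⟪⟫-++ y z)))))))

    module Coset {m} (m-clean : ∀ b → PP m (L b) false) where

      pp-coset : ∀ z {r b} → D r → PP ⟪ z ⟫ r b → PP (m ++ ⟪ z ⟫) r b
      pp-coset z d p = pp-++ {m} {⟪ z ⟫} (no-inversions m-clean (D-conj⟪⟫ z d)) p

      -- If a inverted r, `deletion` would give a word for c that is shorter than the reduced one.
      -- The clean factor m does not change this parity.
      shorter-coset : ∀ {a c r} → RedB c → D r → ⟪ a ⟫ ++ r ≈W ⟪ c ⟫ → length a < length c →
                      ¬ ¬ Shorter (m ++ ⟪ a ⟫) (m ++ ⟪ c ⟫)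
      shorter-coset {a} {c} {r} rc d e l = do
        let keep : PP ⟪ a ⟫ r false
            keep = pp-cases ⟪ a ⟫ r λ p → run do
              z' , l' , e' ← deletion a d p
              return (1+n≰n (≤-trans (s≤s (≤-trans (n≤1+n _) (≤-reflexive (sym l'))))
                       (≤-trans l (least rc z' (≈trans (≈sym e') e)))))
        sh ← false⇒shorter (F-refl (D⊆F d)) (pp-coset a d keep)
        return (Shorter-cong ≈refl (≈trans (≡⇒≈ (++-assoc m ⟪ a ⟫ r)) (++-congˡ m e)) sh)

      quot-coset : ∀ a c → quot (m ++ ⟪ a ⟫) (m ++ ⟪ c ⟫) ≈W quot ⟪ a ⟫ ⟪ c ⟫
      quot-coset a c = solve (m ∷ ⟪ a ⟫ ∷ ⟪ c ⟫ ∷ []) [] (inv (x₀ ∙ x₁) ∙ x₀ ∙ x₂) (inv x₁ ∙ x₂) refl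

      level-up : ∀ {a c} → RedB a → D (quot ⟪ a ⟫ ⟪ c ⟫) → m ++ ⟪ a ⟫ ⟶ m ++ ⟪ c ⟫ → length a < length c
      level-up {a} {c} ra d ed = stable≤ do
        let r    = quot ⟪ a ⟫ ⟪ c ⟫
            dr   = F-refl (D⊆F d)
            keep : PP (m ++ ⟪ a ⟫) r false
            keep = pp-congᵗ {m ++ ⟪ a ⟫} (quot-coset a c) (pp-up ed)
            keep' : PP ⟪ a ⟫ r false
            keep' = pp-cases ⟪ a ⟫ r λ p → clash (pp-coset a d p) keep
            flip : PP ⟪ c ⟫ r true
            flip = pp-≈ (quot-mult ⟪ a ⟫ ⟪ c ⟫) (pp-++ {⟪ a ⟫} {r} {r} {false} {true} (pp-congᵗ {⟪ a ⟫} (≈sym (conj-self dr)) keep') (pp-self dr))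
        z' , l , e ← deletion c d flip
        return (≤-trans (s≤s (least ra z' (≈trans (≈sym e) (back dr))))
                        (≤-reflexive (sym l)))
        where
        back : Refl (quot ⟪ a ⟫ ⟪ c ⟫) → ⟪ c ⟫ ++ quot ⟪ a ⟫ ⟪ c ⟫ ≈W ⟪ a ⟫
        back dr = ≈trans (++-congˡ ⟪ c ⟫ (≈sym (inv-rev (refl-inv dr))))
          (solve (⟪ a ⟫ ∷ ⟪ c ⟫ ∷ []) [] (x₁ ∙ inv (inv x₀ ∙ x₁)) x₀ refl)

      chain : ∀ b n k → RedB (altB b (suc k + n)) → ¬ ¬ Shorter (m ++ ⟪ altB b n ⟫) (m ++ ⟪ altB b (suc k + n) ⟫)
      chain b n k r = do
          s ← last-step
          go k r s
        where
        last-step : ¬ ¬ Shorter (m ++ ⟪ altB b (k + n) ⟫) (m ++ ⟪ altB b (suc k + n) ⟫)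
        last-step with altB-∷ʳ b (k + n)
        ... | x , e = shorter-coset {altB b (k + n)} r (D-gen x) (≡⇒≈ (trans (cong (⟪ altB b (k + n) ⟫ ++_) (sym (++-identityʳ (L x))))
                        (trans (sym (⟪⟫-++ (altB b (k + n)) [ x ])) (cong ⟪_⟫ (sym e)))))
                        (≤-reflexive (trans (cong suc (altB-length b (k + n))) (sym (altB-length b (suc k + n)))))
        go : ∀ k → RedB (altB b (suc k + n)) → Shorter (m ++ ⟪ altB b (k + n) ⟫) (m ++ ⟪ altB b (suc k + n) ⟫) →
             ¬ ¬ Shorter (m ++ ⟪ altB b n ⟫) (m ++ ⟪ altB b (suc k + n) ⟫)
        go zero r s = return s
        go (suc k) r s with altB-∷ʳ b (suc k + n)
        ... | x , e = do
          s' ← chain b n k (redB-prefix _ [ x ] (subst RedB e r))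
          return (Shorter-trans s' s)

      no-gap : ∀ {a c} → RedB a → RedB c → suc (length a) < length c →
               ¬ ¬ ∃ λ z → Shorter (m ++ ⟪ a ⟫) (m ++ ⟪ z ⟫) × Shorter (m ++ ⟪ z ⟫) (m ++ ⟪ c ⟫)
      no-gap {a} {c} ra rc l with redB-alternates a ra | redB-alternates c rc
      ... | s , ea | t , ec = do
            second ← chain t (suc p) (length c ∸ suc (suc p)) (subst RedB (trans ec (cong (altB t) q≡)) rc)
            first ← first-step (t Bool.≟ s)
            return (altB t (suc p) , first , subst (λ z → Shorter (m ++ ⟪ altB t (suc p) ⟫) (m ++ ⟪ z ⟫)) (sym (trans ec (cong (altB t) q≡))) second)
        where
        p : ℕ
        p = length a
        q≡ : length c ≡ suc (length c ∸ suc (suc p)) + suc p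
        q≡ = trans (sym (m∸n+n≡m l)) (+-suc (length c ∸ suc (suc p)) (suc p))
        prefix : ∀ k n → RedB (altB t (k + n)) → RedB (altB t n)
        prefix zero    n r = r
        prefix (suc k) n r with altB-∷ʳ t (k + n)
        ... | x , e = prefix k n (redB-prefix _ [ x ] (subst RedB e r))
        rz : RedB (altB t (suc p))
        rz = prefix (suc (length c ∸ suc (suc p))) (suc p) (subst RedB (trans ec (cong (altB t) q≡)) rc)
        lt : length a < length (altB t (suc p))
        lt = ≤-reflexive (sym (altB-length t (suc p)))
        first-step : Dec (t ≡ s) → ¬ ¬ Shorter (m ++ ⟪ a ⟫) (m ++ ⟪ altB t (suc p) ⟫)
        first-step (yes refl) with altB-∷ʳ t p
        ... | x , e = shorter-coset {a} rz (D-gen x) (≡⇒≈ (trans (cong₂ _++_ (cong ⟪_⟫ ea) (sym (++-identityʳ (L x))))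
                        (trans (sym (⟪⟫-++ (altB t p) [ x ])) (cong ⟪_⟫ (sym e))))) lt
        -- The alternating words begin differently, so `altB t (suc p)` is L t · a, that is, a times
        -- the reflection a⁻¹ (L t) a.
        first-step (no ne) = shorter-coset {a} rz (reverse a , t , ≈refl)
          (≈trans (++-congˡ ⟪ a ⟫ (conj-congˡ (L t) (⟪⟫-rev a)))
          (≈trans (solve (⟪ a ⟫ ∷ L t ∷ []) [] (x₀ ∙ (inv x₀ ∙ x₁ ∙ inv (inv x₀))) (x₁ ∙ x₀) refl)
            (≡⇒≈ (cong (λ z → L t ++ ⟪ z ⟫) (trans ea (cong (λ b → altB b p) (trans (sym (Bool.not-involutive s)) (cong not (sym (Bool.¬-not ne))))))))))
          lt

      -- A larger difference in dihedral length would leave room, by `no-gap`, for an element of the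
      -- coset strictly between u and v in length.
      cover-level : ∀ {a c u v} → RedB a → RedB c → D (quot ⟪ a ⟫ ⟪ c ⟫) →
        Red u → Red v → u ≈W m ++ ⟪ a ⟫ → v ≈W m ++ ⟪ c ⟫ → u ⟶ v → length v ≡ suc (length u) →
        length c ≡ suc (length a)
      cover-level {a} {c} ra rc d ru rv eu ev ed l = ≤-antisym (≮⇒≥ λ gap → run do
          z , s₁ , s₂ ← no-gap ra rc gap
          y , ey , ry ← red? (m ++ ⟪ z ⟫)
          return (1+n≰n (≤-trans (s≤s (Shorter-red ru (Shorter-cong (≈sym eu) (≈sym ey) s₁)))
                   (≤-trans (Shorter-red ry (Shorter-cong (≈sym ey) (≈sym ev) s₂)) (≤-reflexive l)))))
        (level-up {a} {c} ra d (⟶-cong eu ev ed))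

    min-coset : ∀ w → ¬ ¬ ∃₂ λ m z → w ≈W m ++ ⟪ z ⟫ × (∀ b → PP m (L b) false)
    min-coset w = do
        r , e , rr ← red? w
        m , z , h , k ← go r (<-wellFounded _)
        return (m , z , ≈trans (≈sym e) h , k)
      where
      go : ∀ w → Acc _<_ (length w) → ¬ ¬ ∃₂ λ m z → w ≈W m ++ ⟪ z ⟫ × (∀ b → PP m (L b) false)
      go w (acc rs) = em {A = ∃ λ b → PP w (L b) true} >>= λ where
        (no n) → return (w , [] , ≡⇒≈ (sym (++-identityʳ w)) , λ b → pp-cases w (L b) λ p → n (b , p))
        (yes (b , p)) → do
          d , e , l ← true⇒shorter p
          m , z , h , k ← go d (rs (l w ≈refl))
          return (m , z ++ [ b ] , ≈trans (≈sym (mult-mult w (L-refl b))) (≈trans (++-congʳ (L b) (≈trans (≈sym e) h))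
            (≡⇒≈ (trans (++-assoc m ⟪ z ⟫ (L b)) (cong (m ++_) (trans (cong (⟪ z ⟫ ++_) (sym (++-identityʳ (L b)))) (sym (⟪⟫-++ z [ b ]))))))) , k)

    Shorter-rev : ∀ {a b} → Shorter a b → Shorter (rev a) (rev b)
    Shorter-rev {b = b} (a' , e , h) = rev a' , rev-cong e , λ c q → subst₂ _<_ (sym (length-reverse a')) (length-reverse c)
      (h (rev c) (≈trans (rev-cong q) (≡⇒≈ (reverse-involutive b))))

    -- Some canonical τ is inverted by t. If t ≠ τ they do not commute, by `commuting-false`, so τ t
    -- τ is shorter than t: both multiplications by τ shorten. The induction is on the length.
    F⊆D : (∀ {τ} → χ F τ → ¬ ¬ ∃ λ b → τ ≈W L b) → ∀ {t} → F t → ¬ ¬ D t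
    F⊆D full {t} f = do
        r , e , _ ← red? t
        d ← go r (<-wellFounded _) (F-cong (≈sym e) f)
        return (ReflectionSet.F-cong D-set e d)
      where
      go : ∀ t → Acc _<_ (length t) → F t → ¬ ¬ D t
      go t (acc rs) f = do
        τ , χτ@(fτ , can) , p ← canonical-inversion RF f (pp-self (F-refl f))
        b , eb ← full χτ
        (no t≉τ) ← em {A = t ≈W τ}
          where yes h → return ([] , b , ≈trans h (≈trans eb (≡⇒≈ (sym (++-identityʳ (L b))))))
        let nc : ¬ conj t τ ≈W τ
            nc h = clash p (commuting-false (F-refl f) (λ k → t≉τ (≈sym k)) h)
        s₁ ← true⇒shorter (pp-++ {τ} {t} {τ} {false} {true} (can (conj t τ) (F-conj f fτ) nc) p)
        s₂ ← true⇒shorter p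
        x , ex , lx ← return (Shorter-trans s₁ (Shorter-cong
               (solve [] (refl-inv (F-refl f) ∷ refl-inv (F-refl fτ) ∷ []) (inv (r₀ ∙ r₁)) (r₁ ∙ r₀) refl)
               (inv-rev (refl-inv (F-refl f))) (Shorter-rev s₂)))
        let ex' : x ≈W conj τ t
            ex' = ≈trans ex (solve [] (refl-inv (F-refl f) ∷ refl-inv (F-refl fτ) ∷ []) ((r₁ ∙ r₀) ∙ r₁) (r₁ ∙ r₀ ∙ inv r₁) refl)
        d ← go x (rs (lx t ≈refl)) (F-cong (≈sym ex') (F-conj fτ f))
        return (ReflectionSet.F-cong D-set (≈trans (conj-congˡ x (≡⇒≈ (++-identityʳ (L b))))
                 (≈trans (conj-congˡ x (≈sym eb)) (≈trans (conj-cong τ ex') (conj-conj (F-refl fτ) t)))) (D-conj⟪⟫ [ b ] d))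

  -- If t and t′ are reflections of w and w′ into a common neighbour then t ∈ FQ g with g = w⁻¹ w′.
  record FQ (g t : Word) : Set where
    constructor fq
    field
      refl₁ : Refl t
      refl₂ : Refl (t ++ g)

  module Quotient (g : Word) where
    F : Word → Set
    F = FQ g
    open FQ public

    flip-g : ∀ {t} → F t → t ++ g ++ t ≈W rev g
    flip-g {t} (fq r r') = ≈trans (solve (g ∷ []) (refl-inv r ∷ []) (r₀ ∙ x₀ ∙ r₀) ((r₀ ∙ x₀) ∙ r₀) refl)
      (≈trans (++-congʳ t (≈sym (inv-rev (refl-inv r'))))
        (solve (g ∷ []) (refl-inv r ∷ []) (inv (r₀ ∙ x₀) ∙ r₀) (inv x₀) refl))

    g≈ : ∀ {t} → F t → g ≈W t ++ rev g ++ t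
    g≈ {t} f = ≈trans (solve (g ∷ []) (refl-inv (refl₁ f) ∷ []) x₀ (r₀ ∙ (r₀ ∙ x₀ ∙ r₀) ∙ r₀) refl)
                      (++-congˡ t (++-congʳ t (flip-g f)))

    F-set : ReflectionSet F
    F-set = record
      { F-cong = λ e (fq r r') → fq (refl-cong e r) (refl-cong (++-congʳ g e) r')
      ; F-refl = refl₁
      ; F-conj = closed
      }
      where
      closed : ∀ {t t'} → F t → F t' → F (conj t t')
      closed {t} {t'} f f' = fq (refl-conj t (refl₁ f'))
        (refl-cong (≈sym (≈trans (++-congˡ (conj t t') (≈trans (g≈ f) (++-congˡ t (++-congʳ t (inv-g)))))
          (solve ((t' ++ g) ∷ []) (refl-inv (refl₁ f) ∷ refl-inv (refl₁ f') ∷ [])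
            ((r₀ ∙ r₁ ∙ inv r₀) ∙ r₀ ∙ (x₀ ∙ r₁) ∙ r₀) ((r₀ ∙ r₁) ∙ x₀ ∙ inv (r₀ ∙ r₁)) refl)))
          (refl-conj (t ++ t') (refl₂ f')))
        where
        inv-g : rev g ≈W (t' ++ g) ++ t'
        inv-g = ≈trans (≈sym (flip-g f')) (≡⇒≈ (sym (++-assoc t' g t')))

    F-conj-g : ∀ {t} → F t → F (conj g t)
    F-conj-g {t} f = fq (refl-conj g (refl₁ f)) (refl-cong
      (solve (g ∷ []) (refl-inv (refl₁ f) ∷ []) (r₀ ∙ (r₀ ∙ x₀) ∙ inv r₀) ((x₀ ∙ r₀ ∙ inv x₀) ∙ x₀) refl)
      (refl-conj t (refl₂ f)))

    open ReflectionSet F-set using (F-cong; F-conj)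

    two-letters : Word → Word → Bool → Word
    two-letters a b false = a
    two-letters a b true  = b

    no-inversions₂ : ∀ {a b y} → χ F a → χ F b → PP y a false → PP y b false →
      ∀ z c {r} → r ≈W conj (foldr (λ x w → two-letters a b x ++ w) [] z) (two-letters a b c) → PP y r false
    no-inversions₂ {a} {b} {y} χa χb pa pb z c e =
      Dihedral.no-inversions F-set (two-letters a b) (λ { false → χa ; true → χb }) {y}
        (λ { false → pa ; true → pb }) (z , c , ≈trans e (conj-congˡ (two-letters a b c) (≡⇒≈ (word z))))
      where
      word : ∀ z → foldr (λ x w → two-letters a b x ++ w) [] z ≡ Dihedral.⟪_⟫ F-set (two-letters a b) (λ { false → χa ; true → χb }) z
      word [] = refl
      word (x ∷ z) = cong (two-letters a b x ++_) (word z)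

    no-inversion-bab : ∀ {a b y} → χ F a → χ F b → PP y a false → PP y b false → PP y (conj b a) false
    no-inversion-bab {a} {b} χa χb pa pb = no-inversions₂ χa χb pa pb [ true ] false
      (conj-congˡ a (≡⇒≈ (sym (++-identityʳ b))))

    no-inversion-ababa : ∀ {a b y} → χ F a → χ F b → PP y a false → PP y b false → PP y (conj a (conj b a)) false
    no-inversion-ababa {a} {b} χa χb pa pb = no-inversions₂ χa χb pa pb (false ∷ true ∷ []) false
      (≈trans (≈sym (conj-++ a b a)) (conj-congˡ a (≡⇒≈ (cong (a ++_) (sym (++-identityʳ b))))))

    module _ (g²≉e : ¬ g ++ g ≈W []) where

      -- Use g⁻¹ = τ g τ: the factor τ on the right changes the parity at τ, and the one on the left
      -- does not, as g τ g⁻¹ = τ would give g² = e.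
      sign-flip : ∀ {τ b} → χ F τ → PP g τ b → PP (rev g) τ (not b)
      sign-flip {τ} {b} (f , can) p = pp-≈ (flip-g f)
          (pp-++ {τ} {g ++ τ} {τ} {false} {not b}
            (can (conj (g ++ τ) τ) (F-cong (≈sym moved) (F-conj-g f)) (λ h → g²≉e (bad (≈trans (≈sym moved) h))))
            (subst (PP (g ++ τ) τ) (Bool.xor-comm b true) (pp-++ {g} {τ} {τ} {b} {true} (pp-congᵗ {g} (≈sym (conj-self (refl₁ f))) p) (pp-self (refl₁ f)))))
        where
        moved : conj (g ++ τ) τ ≈W conj g τ
        moved = ≈trans (conj-++ g τ τ) (conj-cong g (conj-self (refl₁ f)))
        bad : conj g τ ≈W τ → g ++ g ≈W []
        bad h = ≈trans (++-congˡ g (g≈ f)) (≈trans (solve (g ∷ τ ∷ []) [] (x₀ ∙ x₁ ∙ inv x₀ ∙ x₁) ((x₀ ∙ x₁ ∙ inv x₀) ∙ x₁) refl)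
                  (≈trans (++-congʳ τ h) (Inv.square (refl-inv (refl₁ f)))))

      -- Suppose g inverts both, so that g⁻¹ does not invert τ₂. If g τ₁ τ₂ τ₁ g⁻¹ = τ₁, the
      -- parities of g g⁻¹ = e at τ₂ contradict each other. Otherwise, if g inverts τ₁ τ₂ τ₁, then
      -- g⁻¹ = τ₁ g τ₁ inverts τ₂; and if not, g τ₁ inverts neither generator but does invert τ₁ τ₂
      -- τ₁.
      not-both-flipped : ∀ {τ₁ τ₂} → χ F τ₁ → χ F τ₂ → ¬ τ₁ ≈W τ₂ → PP g τ₁ true → PP g τ₂ true → ⊥
      not-both-flipped {τ₁} {τ₂} χ₁@(f₁ , can₁) χ₂@(f₂ , can₂) ne p₁ p₂ = run do
          a , pa ← par? g (conj τ₁ τ₂)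
          d ← em {A = conj g (conj τ₁ τ₂) ≈W τ₁}
          return (cases a pa d)
        where
        keep₂ : PP (rev g) τ₂ false
        keep₂ = sign-flip χ₂ p₂
        ne₂ : ¬ τ₂ ≈W τ₁
        ne₂ h = ne (≈sym h)
        ne₁₂₁ : ¬ conj τ₁ τ₂ ≈W τ₁
        ne₁₂₁ h = ne (≈trans (≈sym (conj-self (refl₁ f₁))) (≈trans (conj-cong τ₁ (≈sym h)) (conj-conj (refl₁ f₁) τ₂)))
        cases : ∀ a → Par g (conj τ₁ τ₂) a → Dec (conj g (conj τ₁ τ₂) ≈W τ₁) → ⊥
        cases a pa (yes h) = clash
            (pp-++ {g} {rev g} {τ₂} {true} {false} (pp-congᵗ {g} (≈sym g⁻τ₂g) p₁) keep₂)
            (pp-≈ (≈sym (inverseʳ g)) (return []))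
          where
          g⁻τ₂g : conj (rev g) τ₂ ≈W τ₁
          g⁻τ₂g = ≈trans (conj-congˡ τ₂ (≈sym (flip-g f₁)))
                 (≈trans (solve (g ∷ τ₂ ∷ []) (refl-inv (refl₁ f₁) ∷ []) ((r₀ ∙ x₀ ∙ r₀) ∙ x₁ ∙ inv (r₀ ∙ x₀ ∙ r₀))
                            (r₀ ∙ (x₀ ∙ (r₀ ∙ x₁ ∙ inv r₀) ∙ inv x₀) ∙ inv r₀) refl)
                         (≈trans (conj-cong τ₁ h) (conj-self (refl₁ f₁))))
        cases true pa (no n) = clash
            (pp-≈ (flip-g f₁) (pp-++ {τ₁} {g ++ τ₁} {τ₂} {false} {true}
              (can₁ (conj (g ++ τ₁) τ₂) (F-cong (≈sym (conj-++ g τ₁ τ₂)) (F-conj-g (F-conj f₁ f₂)))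
                (λ h → n (≈trans (≈sym (conj-++ g τ₁ τ₂)) h)))
              (pp-++ {g} {τ₁} {τ₂} {true} {false} (return pa) (can₁ τ₂ f₂ ne₂))))
            keep₂
        cases false pa (no n) = clash
            (pp-++ {g} {τ₁} {conj τ₁ τ₂} {true} {false} (pp-congᵗ {g} (≈sym (conj-conj (refl₁ f₁) τ₂)) p₂) (can₁ (conj τ₁ τ₂) (F-conj f₁ f₂) ne₁₂₁))
            (no-inversion-bab χ₂ χ₁
              (pp-++ {g} {τ₁} {τ₂} {false} {false} (return pa) (can₁ τ₂ f₂ ne₂))
              (pp-++ {g} {τ₁} {τ₁} {true} {true} (pp-congᵗ {g} (≈sym (conj-self (refl₁ f₁))) p₁) (pp-self (refl₁ f₁))))

  FQ-rev : ∀ {g t} → FQ g t → FQ (rev g) t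
  FQ-rev {g} {t} f = fq (refl₁ f) (refl-cong
      (≈trans (conj-cong t (≈refl {t ++ g})) (≈trans (solve (g ∷ []) (refl-inv (refl₁ f) ∷ []) (r₀ ∙ (r₀ ∙ x₀) ∙ inv r₀) (r₀ ∙ (r₀ ∙ x₀ ∙ r₀)) refl)
         (++-congˡ t (flip-g f))))
      (refl-conj t (refl₂ f)))
    where open Quotient g

  FQ-rev⁻ : ∀ {g t} → FQ (rev g) t → FQ g t
  FQ-rev⁻ {g} {t} f = subst (λ h → FQ h t) (reverse-involutive g) (FQ-rev f)

  χ-rev : ∀ {g τ} → χ (FQ g) τ → χ (FQ (rev g)) τ
  χ-rev (f , can) = FQ-rev f , λ r fr → can r (FQ-rev⁻ fr)

  module NotInvolution {g} (g²≉e : ¬ g ++ g ≈W []) where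
    open Quotient g

    g⁻²≉e : ¬ rev g ++ rev g ≈W []
    g⁻²≉e h = g²≉e (≈trans (solve (g ∷ []) [] (x₀ ∙ x₀) (inv (inv x₀ ∙ inv x₀)) refl) (rev-cong h))

    same-sign : ∀ {τ₁ τ₂ b} → χ F τ₁ → χ F τ₂ → ¬ τ₁ ≈W τ₂ → PP g τ₁ b → PP g τ₂ b → ⊥
    same-sign {b = true}  χ₁ χ₂ ne p q = not-both-flipped g²≉e χ₁ χ₂ ne p q
    same-sign {b = false} χ₁ χ₂ ne p q = Quotient.not-both-flipped (rev g) g⁻²≉e (χ-rev χ₁) (χ-rev χ₂) ne
      (sign-flip g²≉e χ₁ p) (sign-flip g²≉e χ₂ q)

    at-most-two : ∀ {τ₁ τ₂ τ₃} → χ F τ₁ → χ F τ₂ → χ F τ₃ → ¬ τ₁ ≈W τ₂ → ¬ τ₂ ≈W τ₃ → ¬ τ₃ ≈W τ₁ → ⊥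
    at-most-two {τ₁} {τ₂} {τ₃} χ₁ χ₂ χ₃ n₁₂ n₂₃ n₃₁ = run do
        a , p ← par? g τ₁
        b , q ← par? g τ₂
        c , r ← par? g τ₃
        return (pigeon a b c (return p) (return q) (return r))
      where
      pigeon : ∀ a b c → PP g τ₁ a → PP g τ₂ b → PP g τ₃ c → ⊥
      pigeon false false _ p q r = same-sign χ₁ χ₂ n₁₂ p q
      pigeon true  true  _ p q r = same-sign χ₁ χ₂ n₁₂ p q
      pigeon false true  false p q r = same-sign χ₃ χ₁ n₃₁ r p
      pigeon false true  true  p q r = same-sign χ₂ χ₃ n₂₃ q r
      pigeon true  false true  p q r = same-sign χ₃ χ₁ n₃₁ r p
      pigeon true  false false p q r = same-sign χ₂ χ₃ n₂₃ q r

  ¬¬-finite : ∀ {n} {A : Fin n → Set} → (∀ i → ¬ ¬ A i) → ¬ ¬ (∀ i → A i)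
  ¬¬-finite {zero}  h = return λ ()
  ¬¬-finite {suc n} h = do
    a ← h Fin.zero
    f ← ¬¬-finite (λ i → h (Fin.suc i))
    return λ { Fin.zero → a ; (Fin.suc i) → f i }

  -- the reflection v⁻¹ x v attached to the letter x of w = u x v at position i
  inversion-at : (w : Word) → Fin (length w) → Word
  inversion-at (x ∷ w) Fin.zero    = conj (rev w) [ x ]
  inversion-at (x ∷ w) (Fin.suc i) = inversion-at w i

  inversion-position : ∀ {w t b} → Par w t b → b ≡ true → ∃ λ i → t ≈W inversion-at w i
  inversion-position {x ∷ w} (hit h _) e = Fin.zero , conj⁻ w h
  inversion-position {x ∷ w} (miss _ p) e with inversion-position p e
  ... | i , h = Fin.suc i , h

  module IsInvolution {g} (g²≈e : g ++ g ≈W []) (g≉e : ¬ g ≈W []) where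
    open Quotient g
    open ReflectionSet F-set using (F-cong; F-conj)

    g-inv : Inv g
    g-inv = involution g²≈e

    commutes : ∀ {t} → F t → t ++ g ≈W g ++ t
    commutes {t} f = ≈trans (solve (g ∷ []) (refl-inv (refl₁ f) ∷ g-inv ∷ []) (r₀ ∙ x₀) ((r₀ ∙ x₀ ∙ r₀) ∙ r₀) refl)
                    (++-congʳ t (≈trans (flip-g f) (inv-rev g-inv)))

    -- In g = (t g) t the reflection t g commutes with t and differs from it, so only the last
    -- factor inverts t.
    all-flipped : ∀ {t} → F t → PP g t true
    all-flipped {t} f = pp-≈ e₁ (pp-++ {t ++ g} {t} {t} {false} {true}
        (pp-congᵗ {t ++ g} (≈sym (conj-self (refl₁ f))) (commuting-false (refl₂ f) ne com)) (pp-self (refl₁ f)))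
      where
      e₁ : (t ++ g) ++ t ≈W g
      e₁ = ≈trans (++-congʳ t (commutes f)) (mult-mult g (refl₁ f))
      ne : ¬ t ≈W t ++ g
      ne h = g≉e (≈trans (solve (t ∷ g ∷ []) [] x₁ (inv x₀ ∙ x₀ ∙ x₁) refl) (≈trans (++-congˡ (rev t) (≈sym h)) (inverseˡ t)))
      com : conj (t ++ g) t ≈W t
      com = ≈trans (conj-congˡ t (commutes f)) (≈trans (solve (g ∷ t ∷ []) [] ((x₀ ∙ x₁) ∙ x₁ ∙ inv (x₀ ∙ x₁)) ((x₀ ∙ x₁) ∙ inv x₀) refl)
              (≈trans (++-congʳ (rev g) (≈sym (commutes f))) (solve (g ∷ t ∷ []) [] ((x₁ ∙ x₀) ∙ inv x₀) x₁ refl)))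

    conj-g : ∀ {t} → F t → conj g t ≈W t
    conj-g {t} f = ≈trans (≡⇒≈ (sym (++-assoc g t (rev g)))) (≈trans (++-congʳ (rev g) (≈sym (commutes f)))
                     (solve (g ∷ t ∷ []) [] ((x₁ ∙ x₀) ∙ inv x₀) x₁ refl))

    -- If τ₂ = τ₁ g, then g = τ₁ τ₂ does not invert τ₃. Otherwise the reflection τ₁ g inverts τ₂
    -- although the two commute and are distinct.
    not-commuting : ∀ {τ₁ τ₂ τ₃} → χ F τ₁ → χ F τ₂ → χ F τ₃ → ¬ τ₁ ≈W τ₂ → ¬ τ₂ ≈W τ₃ → ¬ τ₃ ≈W τ₁ →
                    ¬ conj τ₂ τ₁ ≈W τ₁
    not-commuting {τ₁} {τ₂} {τ₃} (f₁ , can₁) (f₂ , can₂) (f₃ , can₃) n₁₂ n₂₃ n₃₁ com =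
        run (em {A = τ₂ ≈W τ₁ ++ g} >>= λ d → return (cases d))
      where
      com' : conj τ₁ τ₂ ≈W τ₂
      com' = ≈trans (≡⇒≈ (sym (++-assoc τ₁ τ₂ (rev τ₁)))) (≈trans (++-congʳ (rev τ₁)
               (≈trans (++-congʳ τ₂ (≈sym com)) (solve [] (refl-inv (refl₁ f₁) ∷ refl-inv (refl₁ f₂) ∷ []) ((r₁ ∙ r₀ ∙ inv r₁) ∙ r₁) (r₁ ∙ r₀) refl)))
               (solve (τ₁ ∷ τ₂ ∷ []) [] ((x₁ ∙ x₀) ∙ inv x₀) x₁ refl))
      cases : Dec (τ₂ ≈W τ₁ ++ g) → ⊥
      cases (no n) = clash
        (pp-++ {τ₁} {g} {τ₂} {false} {true} (can₁ (conj g τ₂) (F-conj-g f₂) (λ h → n₁₂ (≈trans (≈sym h) (conj-g f₂)))) (all-flipped f₂))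
        (commuting-false (refl₂ f₁) n (≈trans (conj-++ τ₁ g τ₂) (≈trans (conj-cong τ₁ (conj-g f₂)) com')))
      cases (yes h) = clash (all-flipped f₃) (pp-≈ e₁ (pp-++ {τ₁} {τ₂} {τ₃} {false} {false}
          (can₁ (conj τ₂ τ₃) (F-conj f₂ f₃) (λ k → n₃₁ (≈trans (≈sym (conj-conj (refl₁ f₂) τ₃)) (≈trans (conj-cong τ₂ k) com))))
          (can₂ τ₃ f₃ (λ k → n₂₃ (≈sym k)))))
        where
        e₁ : τ₁ ++ τ₂ ≈W g
        e₁ = ≈trans (++-congˡ τ₁ h) (solve (g ∷ []) (refl-inv (refl₁ f₁) ∷ []) (r₀ ∙ r₀ ∙ x₀) x₀ refl)

    record Triangle (p q r : Word) : Set where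
      field
        χp : χ F p
        χq : χ F q
        χr : χ F r
        p≉q : ¬ p ≈W q
        q≉r : ¬ q ≈W r
        r≉p : ¬ r ≈W p

      nc : ¬ conj q p ≈W p
      nc = not-commuting χp χq χr p≉q q≉r r≉p

    rotate : ∀ {p q r} → Triangle p q r → Triangle q r p
    rotate T = record { χp = χq ; χq = χr ; χr = χp ; p≉q = q≉r ; q≉r = r≉p ; r≉p = p≉q }
      where open Triangle T

    -- the infinite word p q r p q r …
    letter : ℕ → Word → Word → Word → Word
    letter zero    p q r = p
    letter (suc n) p q r = letter n q r p

    prefix : ℕ → Word → Word → Word → Word
    prefix zero    p q r = []
    prefix (suc n) p q r = p ++ prefix n q r p

    prefix-suc : ∀ n p q r → prefix (suc n) p q r ≡ prefix n p q r ++ letter n p q r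
    prefix-suc zero    p q r = ++-identityʳ p
    prefix-suc (suc n) p q r = trans (cong (p ++_) (prefix-suc n q r p)) (sym (++-assoc p _ _))

    triangle-at : ∀ n {p q r} → Triangle p q r → Triangle (letter n p q r) (letter (1 + n) p q r) (letter (2 + n) p q r)
    triangle-at zero    T = T
    triangle-at (suc n) T = triangle-at n (rotate T)

    -- The word p q r p q r ... grows without cancellation. For the second component the last two
    -- letters are removed; by period three the earlier of them is the letter in question, so the
    -- conjugates that arise are words in two generators only.
    prefix-keeps : ∀ n {p q r} → Triangle p q r →
      PP (prefix n p q r) (letter n p q r) false × PP (prefix n p q r) (letter (1 + n) p q r) false
    prefix-keeps zero T = return [] , return []
    prefix-keeps (suc n) {p} {q} {r} T with prefix-keeps n T | triangle-at n T
    ... | kb , kz | Tn = subst (λ w → PP w z false) (sym (prefix-suc n p q r)) (pp-++ {y} {b} {z} {false} {false}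
                            (no-inversion-bab (Triangle.χq Tn) (Triangle.χp Tn) kz kb)
                            (proj₂ (Triangle.χp Tn) z (proj₁ (Triangle.χq Tn)) (λ h → Triangle.p≉q Tn (≈sym h))))
                       , subst (λ w → PP w a false) (sym (prefix-suc n p q r)) (pp-++ {y} {b} {a} {false} {false}
                            (bab n refl)
                            (proj₂ (Triangle.χp Tn) a (proj₁ (Triangle.χr Tn)) (Triangle.r≉p Tn)))
      where
      y b z a : Word
      y = prefix n p q r
      b = letter n p q r
      z = letter (1 + n) p q r
      a = letter (2 + n) p q r
      bab : ∀ k → k ≡ n → PP y (conj b a) false
      bab zero refl = return []
      bab (suc k) refl with prefix-keeps k T | triangle-at k T
      ... | ka , kb | Tk = subst (λ w → PP w (conj b a) false) (sym (prefix-suc k p q r)) (pp-++ {prefix k p q r} {a} {conj b a} {false} {false}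
            (no-inversion-ababa (Triangle.χp Tk) (Triangle.χq Tk) ka kb)
            (proj₂ (Triangle.χp Tk) (conj b a) (F-conj (proj₁ (Triangle.χq Tk)) (proj₁ (Triangle.χp Tk))) (Triangle.nc Tk)))

    ρ : ℕ → Word → Word → Word → Word
    ρ n p q r = conj (prefix n p q r) (letter n p q r)

    ρ-F : ∀ n {p q r} → Triangle p q r → F (ρ n p q r)
    ρ-F zero T = F-cong (≡⇒≈ (sym (++-identityʳ _))) (proj₁ (Triangle.χp T))
    ρ-F (suc n) {p} {q} {r} T = F-cong (≈sym (conj-++ p _ _)) (F-conj (proj₁ (Triangle.χp T)) (ρ-F n (rotate T)))

    -- Otherwise `prefix (3 + m)` would equal z, which inverts its own last letter; by period three
    -- this is a letter that `prefix-keeps` protects.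
    ρ-next : ∀ m {p q r} → Triangle p q r → ¬ ρ m q r p ≈W p
    ρ-next zero T h = Triangle.p≉q T (≈sym (≈trans (≡⇒≈ (sym (++-identityʳ _))) h))
    ρ-next (suc m) {p} {q} {r} T h = clash flips (proj₂ (prefix-keeps (3 + m) T))
      where
      l z : Word
      l = letter m q r p
      z = prefix (suc m) q r p
      x : Word
      x = letter (suc m) q r p
      flips-z : PP z l true
      flips-z = subst (λ w → PP w l true) (sym (prefix-suc m q r p)) (pp-++ {prefix m q r p} {l} {l} {false} {true}
        (pp-congᵗ {prefix m q r p} (≈sym (conj-self (refl₁ (proj₁ (Triangle.χp (triangle-at m (rotate T))))))) (proj₁ (prefix-keeps m (rotate T))))
        (pp-self (refl₁ (proj₁ (Triangle.χp (triangle-at m (rotate T)))))))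
      e₁ : prefix (3 + m) p q r ≈W z
      e₁ = ≈trans (≡⇒≈ (prefix-suc (2 + m) p q r))
          (≈trans (solve (p ∷ z ∷ x ∷ []) [] ((x₀ ∙ x₁) ∙ x₂) (x₀ ∙ (x₁ ∙ x₂ ∙ inv x₁) ∙ x₁) refl)
          (≈trans (++-congˡ p (++-congʳ z h)) (solve (z ∷ []) (refl-inv (refl₁ (proj₁ (Triangle.χp T))) ∷ []) (r₀ ∙ r₀ ∙ x₀) x₀ refl)))
      flips : PP (prefix (3 + m) p q r) l true
      flips = pp-≈ (≈sym e₁) flips-z

    ρ-distinct : ∀ m n {p q r} → Triangle p q r → m < n → ¬ ρ m p q r ≈W ρ n p q r
    ρ-distinct zero (suc n) {p} T _ h = ρ-next n T
      (≈trans (≈sym (conj-conj (refl₁ (proj₁ (Triangle.χp T))) _)) (≈trans (conj-cong p (≈trans (≈sym (conj-++ p _ _)) (≈sym h)))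
        (≈trans (conj-cong p (≡⇒≈ (++-identityʳ p))) (conj-self (refl₁ (proj₁ (Triangle.χp T)))))))
    ρ-distinct (suc m) (suc n) {p} T (s≤s l) h = ρ-distinct m n (rotate T) l
      (≈trans (≈sym (conj-conj (refl₁ (proj₁ (Triangle.χp T))) _)) (≈trans (conj-cong p (≈trans (≈sym (conj-++ p _ _)) (≈trans h (conj-++ p _ _))))
        (conj-conj (refl₁ (proj₁ (Triangle.χp T))) _)))

    -- The words p q r p q r … would give infinitely many reflections inverted by g.
    no-triangle : ∀ {p q r} → ¬ Triangle p q r
    no-triangle {p} {q} {r} T = run do
      f ← ¬¬-finite {suc (length g)} {λ i → ∃ λ k → ρ (Fin.toℕ i) p q r ≈W inversion-at g k} λ i → do
        x ← all-flipped (ρ-F (Fin.toℕ i) T)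
        return (inversion-position x refl)
      let i , j , i<j , e = Fin.pigeonhole (n<1+n (length g)) (λ i → proj₁ (f i))
      return (ρ-distinct _ _ T i<j (≈trans (proj₂ (f i)) (≈trans (≡⇒≈ (cong (inversion-at g) e)) (≈sym (proj₂ (f j))))))

    at-most-two : ∀ {τ₁ τ₂ τ₃} → χ F τ₁ → χ F τ₂ → χ F τ₃ → ¬ τ₁ ≈W τ₂ → ¬ τ₂ ≈W τ₃ → ¬ τ₃ ≈W τ₁ → ⊥
    at-most-two χ₁ χ₂ χ₃ n₁₂ n₂₃ n₃₁ = no-triangle (record
      { χp = χ₁ ; χq = χ₂ ; χr = χ₃ ; p≉q = n₁₂ ; q≉r = n₂₃ ; r≉p = n₃₁ })

  bool-pigeonhole : (f : Fin 3 → Bool) → ∃₂ λ i j → ¬ i ≡ j × f i ≡ f j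
  bool-pigeonhole f with f (# 0) Bool.≟ f (# 1) | f (# 1) Bool.≟ f (# 2)
  ... | yes p | _     = # 0 , # 1 , (λ ()) , p
  ... | no _  | yes q = # 1 , # 2 , (λ ()) , q
  ... | no p  | no q  = # 0 , # 2 , (λ ()) , trans (Bool.¬-not p) (trans (cong not (Bool.¬-not q)) (Bool.not-involutive _))

  module CommonNeighbours {w w'} (w≉w' : ¬ w ≈W w') (u : Fin 3 → Word) (u≉ : ∀ {i j} → ¬ i ≡ j → ¬ u i ≈W u j)
    (r : ∀ i → Refl (quot w (u i))) (r' : ∀ i → Refl (quot w' (u i))) where

    g : Word
    g = quot w w'

    open Quotient g

    g≉e : ¬ g ≈W []
    g≉e h = w≉w' (≈sym (≈trans (≈sym (quot-mult w w')) (≈trans (++-congˡ w h) (≡⇒≈ (++-identityʳ w)))))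

    t∈F : ∀ i → F (quot w (u i))
    t∈F i = fq (r i) (refl-cong (≈sym (≈trans (++-congʳ g (≈sym (inv-rev (refl-inv (r i)))))
              (solve (w ∷ u i ∷ w' ∷ []) [] (inv (inv x₀ ∙ x₁) ∙ inv x₀ ∙ x₂) (inv x₁ ∙ x₂) refl)))
              (refl-quot-sym w' (u i) (r' i)))

    at-most-two : ∀ {τ₁ τ₂ τ₃} → χ F τ₁ → χ F τ₂ → χ F τ₃ → ¬ τ₁ ≈W τ₂ → ¬ τ₂ ≈W τ₃ → ¬ τ₃ ≈W τ₁ → ⊥
    at-most-two χ₁ χ₂ χ₃ n₁₂ n₂₃ n₃₁ = run (em {A = g ++ g ≈W []} >>= λ where
      (yes h) → return (IsInvolution.at-most-two h g≉e χ₁ χ₂ χ₃ n₁₂ n₂₃ n₃₁)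
      (no n)  → return (NotInvolution.at-most-two n χ₁ χ₂ χ₃ n₁₂ n₂₃ n₃₁))

    generators : ¬ ¬ Σ (Bool → Word) λ L → (∀ b → χ F (L b)) × (∀ {τ} → χ F τ → ¬ ¬ ∃ λ b → τ ≈W L b)
    generators = do
      τ₁ , χ₁ , _ ← canonical-inversion F-set (t∈F (# 0)) (pp-self (r (# 0)))
      em {A = ∃ λ τ → χ F τ × ¬ τ ≈W τ₁} >>= λ where
        -- With only one canonical generator, `L` takes it as both values.
        (no n) → return ((λ _ → τ₁) , (λ _ → χ₁) , λ {τ} χτ k → n (τ , χτ , λ e → k (true , e)))
        (yes (τ₂ , χ₂ , ne)) → return (two-letters τ₁ τ₂ , (λ { false → χ₁ ; true → χ₂ })
          , λ {τ} χτ k → at-most-two χτ χ₁ χ₂ (λ e → k (false , e)) (λ e → ne (≈sym e)) (λ e → k (true , ≈sym e)))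

    module _ (rw : Red w) (ru : ∀ i → Red (u i))
      (level : (∀ i → length (u i) ≡ suc (length w)) ⊎ (∀ i → length w ≡ suc (length (u i)))) where

      -- The reflections lie in a subgroup with at most two canonical generators, so w and all `u i`
      -- lie in one coset of a dihedral group. By `cover-level` the `u i` have the same dihedral
      -- length, and only two alternating words have a given length.
      impossible : ⊥
      impossible = run do
        L , Lχ , full ← generators
        let open Dihedral F-set L Lχ
        m , z , e , k ← min-coset w
        let open Coset {m} k
        a , ea , ra ← redB? z
        d ← ¬¬-finite {3} λ i → F⊆D full (t∈F i)
        let D-w : ∀ i → ∃ λ y → quot w (u i) ≈W ⟪ y ⟫
            D-w i = D-word (d i)
        c ← ¬¬-finite {3} λ i → redB? (a ++ proj₁ (D-w i))
        let w≈ : w ≈W m ++ ⟪ a ⟫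
            w≈ = ≈trans e (++-congˡ m (≈sym ea))
            u≈ : ∀ i → u i ≈W m ++ ⟪ proj₁ (c i) ⟫
            u≈ i = ≈trans (≈sym (quot-mult w (u i))) (≈trans (++-cong w≈ (proj₂ (D-w i)))
                     (≈trans (≡⇒≈ (trans (++-assoc m ⟪ a ⟫ _) (cong (m ++_) (sym (⟪⟫-++ a _))))) (++-congˡ m (≈sym (proj₁ (proj₂ (c i)))))))
            dᵢ : ∀ i → D (quot ⟪ a ⟫ ⟪ proj₁ (c i) ⟫)
            dᵢ i = ReflectionSet.F-cong D-set (≈trans (quot-cong w≈ (u≈ i)) (quot-coset a (proj₁ (c i)))) (d i)
            dᵢ' : ∀ i → D (quot ⟪ proj₁ (c i) ⟫ ⟪ a ⟫)
            dᵢ' i = ReflectionSet.F-cong D-set (≈trans (≈sym (inv-rev (refl-inv (refl-cong (≈trans (quot-cong w≈ (u≈ i)) (quot-coset a (proj₁ (c i)))) (r i)))))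
                      (solve (⟪ a ⟫ ∷ ⟪ proj₁ (c i) ⟫ ∷ []) [] (inv (inv x₀ ∙ x₁)) (inv x₁ ∙ x₀) refl)) (dᵢ i)
            up : (∀ i → length (u i) ≡ suc (length w)) → ∀ i → length (proj₁ (c i)) ≡ suc (length a)
            up l i = cover-level ra (proj₂ (proj₂ (c i))) (dᵢ i) rw (ru i) w≈ (u≈ i)
              (r i , red-Shorter (ru i) (≤-reflexive (sym (l i)))) (l i)
            dn : (∀ i → length w ≡ suc (length (u i))) → ∀ i → length a ≡ suc (length (proj₁ (c i)))
            dn l i = cover-level (proj₂ (proj₂ (c i))) ra (dᵢ' i) (ru i) rw (u≈ i) w≈
              (refl-quot-sym w (u i) (r i) , red-Shorter rw (≤-reflexive (sym (l i)))) (l i)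
            same : ∀ i j → length (proj₁ (c i)) ≡ length (proj₁ (c j))
            same i j = [ (λ l → trans (up l i) (sym (up l j))) , (λ l → suc-injective (trans (sym (dn l i)) (dn l j))) ]′ level
            alt≡ : ∀ i → ∃ λ b → proj₁ (c i) ≡ altB b (length (proj₁ (c i)))
            alt≡ i = redB-alternates (proj₁ (c i)) (proj₂ (proj₂ (c i)))
            i , j , i≢j , b≡ = bool-pigeonhole (λ i → proj₁ (alt≡ i))
        return (u≉ i≢j (≈trans (u≈ i) (≈trans (++-congˡ m (≡⇒≈ (cong ⟪_⟫
          (trans (proj₂ (alt≡ i)) (trans (cong₂ altB b≡ (same i j)) (sym (proj₂ (alt≡ j)))))))) (≈sym (u≈ j)))))

-- The word problem

module WordProblem (C : CoxeterSystem) where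
  open DihedralBound C public
  open Representation C using (order-exact)

  -- Division of a reduced word p by a letter on the left, with fuel. If t and s ≠ t both divide
  -- p then so does the longest element alt s t (m s t) of the dihedral group they generate.
  divs : (S → Word → Maybe Word) → Word → Word → Maybe Word
  divs d []       p = just p
  divs d (x ∷ xs) p with d x p
  ... | just q  = divs d xs q
  ... | nothing = nothing

  div-by : (S → Word → Maybe Word) → S → S → Word → ℕ → Maybe Word
  -- Here m s t = ∞, and no element is divisible by both letters.
  div-by d t s p 0 = nothing
  div-by d t s p 1 = just p
  -- If p = (t s t ...) r with k + 1 letters, then s p = (t s t ...) r with k + 2 letters by the
  -- braid relation, and removing t leaves (s t s ...) r.
  div-by d t s p (suc (suc k)) = Maybe.map (alt s t (suc k) ++_) (divs d (alt t s (suc k)) p)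

  div : ℕ → S → Word → Maybe Word
  div zero    t p       = nothing
  div (suc n) t []      = nothing
  div (suc n) t (s ∷ p) = div-by (div n) t s p (m s t)

  alt-length : ∀ s t n → length (alt s t n) ≡ n
  alt-length s t zero    = refl
  alt-length s t (suc n) = cong suc (alt-length t s n)

  alt-double : ∀ s t n → alt s t (n + n) ≡ alt s t n ++ rev (alt t s n)
  alt-double s t n = trans (alt-+ s t n n) (cong (alt s t n ++_) (sym (rev-alt t s n)))
    where open Relators s t

  braid : ∀ {s t k} → m s t ≡ suc k → alt s t (suc k) ≈W alt t s (suc k)
  braid {s} {t} {k} e = ≈trans (solve (alt s t (suc k) ∷ alt t s (suc k) ∷ []) [] x₀ ((x₀ ∙ inv x₁) ∙ x₁) refl)
    (++-congʳ (alt t s (suc k)) (≈trans (≡⇒≈ (sym (trans (cong (λ z → alt s t (suc k + z)) (+-identityʳ (suc k))) (alt-double s t (suc k)))))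
      (≈trans (≡⇒≈ (sym (++-identityʳ _))) (relator [] [] s t k e))))

  unbraid : ∀ {s t n} → alt s t n ≈W alt t s n → alt s t (n + n) ≈W []
  unbraid {s} {t} {n} h = ≈trans (≡⇒≈ (alt-double s t n)) (≈trans (++-congʳ (rev (alt t s n)) h) (inverseʳ (alt t s n)))

  same-generator : ∀ {s t} → m s t ≡ 1 → [ s ] ≈W [ t ]
  same-generator = braid

  Sound : (S → Word → Maybe Word) → Set
  Sound d = ∀ t p {r} → d t p ≡ just r → t ∷ p ≈W r × length p ≡ suc (length r)

  divs-sound : ∀ {d} → Sound d → ∀ xs p {r} → divs d xs p ≡ just r → p ≈W xs ++ r × length p ≡ length xs + length r
  divs-sound sd [] p refl = ≈refl , refl
  divs-sound {d} sd (x ∷ xs) p e with d x p in eq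
  ... | just q with sd x p eq | divs-sound sd xs q e
  ...   | h , l | h' , l' = ≈trans (≈sym (++-congʳ p (ss≈e x))) (++-congˡ [ x ] (≈trans h h')) , trans l (cong suc l')

  div-by-sound : ∀ {d} → Sound d → ∀ t s p k {r} → m s t ≡ k → div-by d t s p k ≡ just r →
                 t ∷ s ∷ p ≈W r × suc (length p) ≡ suc (length r)
  div-by-sound sd t s p 1 e refl = ≈trans (++-congʳ (s ∷ p) (≈sym (same-generator e))) (++-congʳ p (ss≈e s)) , refl
  div-by-sound {d} sd t s p (suc (suc k)) e q with divs d (alt t s (suc k)) p in eq
  div-by-sound {d} sd t s p (suc (suc k)) e refl | just r with divs-sound sd (alt t s (suc k)) p eq
  ... | h , l = ≈trans (++-congˡ (t ∷ s ∷ []) h) (≈trans (++-congˡ [ t ] (++-congʳ r (braid e))) (++-congʳ (alt s t (suc k) ++ r) (ss≈e t)))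
              , cong suc (trans l (trans (cong (_+ length r) (trans (alt-length t s (suc k)) (sym (alt-length s t (suc k))))) (sym (length-++ (alt s t (suc k))))))

  div-sound : ∀ n → Sound (div n)
  div-sound (suc n) t (s ∷ p) q = div-by-sound (div-sound n) t s p (m s t) refl q

  Desc : Word → Word → Set
  Desc []       q = ⊤
  Desc (x ∷ xs) q = Shorter (x ∷ q) q × Desc xs (x ∷ q)

  Desc-cong : ∀ xs {q q'} → q ≈W q' → Desc xs q → Desc xs q'
  Desc-cong []       e _ = tt
  Desc-cong (x ∷ xs) e (h , k) = Shorter-cong (++-congˡ [ x ] e) e h , Desc-cong xs (++-congˡ [ x ] e) k

  Complete : ℕ → (S → Word → Maybe Word) → Set
  Complete n d = ∀ t p → length p ≤ n → Red p → Shorter (t ∷ p) p → ¬ d t p ≡ nothing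

  divs-complete : ∀ {n d} → Sound d → Complete n d → ∀ xs q → length q ≤ n → Red q → Desc xs q → ¬ divs d xs q ≡ nothing
  divs-complete sd cd [] q l rq _ ()
  divs-complete {d = d} sd cd (x ∷ xs) q l rq (h , k) e with d x q in eq
  ... | nothing = cd x q l rq h eq
  ... | just r with sd x q eq
  ...   | g , l' = divs-complete sd cd xs r (≤-trans (≤-trans (n≤1+n _) (≤-reflexive (sym l'))) l)
                     (λ w e' → s≤s⁻¹ (≤-trans (≤-reflexive (sym l')) (rq (x ∷ w) (≈trans (++-congˡ [ x ] (≈trans e' (≈sym g))) (++-congʳ q (ss≈e x))))))
                     (Desc-cong xs g k) e
    where open import Data.Nat using (s≤s⁻¹)

  refl-set : ReflectionSet Refl
  refl-set = record { F-cong = refl-cong ; F-refl = id ; F-conj = λ {t} _ → refl-conj t }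

  module TwoDescents (s t : S) where
    gen : Bool → S
    gen false = s
    gen true  = t

    L : Bool → Word
    L b = [ gen b ]

    Lχ : ∀ b → χ Refl (L b)
    Lχ b = refl-gen (gen b) , λ r _ ne → return (miss (λ h → ne (≈trans (≡⇒≈ (sym (++-identityʳ r))) h)) [])

    open Dihedral refl-set L Lχ

    ⟪altB⟫ : ∀ b n → ⟪ altB b n ⟫ ≡ alt (gen b) (gen (not b)) n
    ⟪altB⟫ b zero = refl
    ⟪altB⟫ b (suc n) = cong (gen b ∷_) (trans (⟪altB⟫ (not b) n) (cong (λ c → alt (gen (not b)) (gen c) n) (Bool.not-involutive b)))

    lst : Bool → ℕ → Bool
    lst c zero    = c
    lst c (suc n) = lst (not c) n

    lst-not : ∀ c n → lst (not c) n ≡ not (lst c n)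
    lst-not c zero    = refl
    lst-not c (suc n) = lst-not (not c) n

    altB-lst : ∀ c n → altB c (suc n) ≡ altB c n ∷ʳ lst c n
    altB-lst c zero    = refl
    altB-lst c (suc n) = cong (c ∷_) (altB-lst (not c) n)

    lst-onto : ∀ b n → ∃ λ c → lst c n ≡ b
    lst-onto b zero = b , refl
    lst-onto b (suc n) with lst-onto b n
    ... | c , e = not c , trans (cong (λ z → lst z n) (Bool.not-involutive c)) e

    module _ {M} (M-clean : ∀ b → PP M (L b) false) where
      open Coset {M} M-clean

      -- The inverse of w is M times an alternating word; taking letters off the end of that word
      -- shortens w each time, by `chain`.
      coset-descent : ∀ n c w → RedB (altB c (suc n)) → rev w ≈W M ++ ⟪ altB c (suc n) ⟫ →
        ∀ j b → b ≡ lst c n → j ≤ suc n → ¬ ¬ Desc (alt (gen b) (gen (not b)) j) w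
      coset-descent n c w rz h zero    b e _ = return tt
      coset-descent n c w rz h (suc j) b refl (s≤s l) = do
          sh ← chain c n 0 rz
          tl ← rest n c rz h' j l
          return (Shorter-cong (flip-rev h') (flip-rev h) (Shorter-rev sh)
                 , subst (λ z → Desc (alt (gen (not (lst c n))) (gen z) j) (gen (lst c n) ∷ w)) (Bool.not-involutive (lst c n)) tl)
        where
        flip-rev : ∀ {w v} → rev w ≈W v → rev v ≈W w
        flip-rev {w} h = ≈trans (≈sym (rev-cong h)) (≡⇒≈ (reverse-involutive w))
        h' : rev (gen (lst c n) ∷ w) ≈W M ++ ⟪ altB c n ⟫
        h' = ≈trans (≡⇒≈ (unfold-reverse (gen (lst c n)) w)) (≈trans (++-congʳ (L (lst c n)) (≈trans h
               (≡⇒≈ (trans (cong (M ++_) (trans (cong ⟪_⟫ (altB-lst c n)) (⟪⟫-++ (altB c n) _))) (sym (++-assoc M ⟪ altB c n ⟫ _))))))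
               (≈trans (≡⇒≈ (cong (λ z → ((M ++ ⟪ altB c n ⟫) ++ z) ++ L (lst c n)) (++-identityʳ (L (lst c n))))) (mult-mult (M ++ ⟪ altB c n ⟫) (refl-gen (gen (lst c n))))))
        rest : ∀ n c → RedB (altB c (suc n)) → rev (gen (lst c n) ∷ w) ≈W M ++ ⟪ altB c n ⟫ → ∀ j → j ≤ n →
               ¬ ¬ Desc (alt (gen (not (lst c n))) (gen (not (not (lst c n)))) j) (gen (lst c n) ∷ w)
        rest zero c rz h zero _ = return tt
        rest (suc n) c rz h j l = coset-descent n c (gen (lst c (suc n)) ∷ w) (redB-prefix _ _ (subst RedB (altB-lst c (suc n)) rz)) h j _
             (trans (cong not (lst-not c n)) (Bool.not-involutive (lst c n))) l

    -- The two alternating words of length n, n minimal, coincide; as the order of s t is exactly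
    -- m s t, this forces m s t ≤ n.
    descend : ∀ {w} → Shorter (s ∷ w) w → Shorter (t ∷ w) w →
              ¬ ¬ ∃ λ k → m s t ≡ suc k × Desc (alt s t (suc k)) w
    descend {w} ds dt = do
        M , z , hz , cl ← min-coset (rev w)
        a , ea , ra ← redB? z
        let open Coset {M} cl
            v≈ : rev w ≈W M ++ ⟪ a ⟫
            v≈ = ≈trans hz (++-congˡ M (≈sym ea))
            flips : ∀ b → PP ⟪ a ⟫ (L b) true
            flips b = pp-cases ⟪ a ⟫ (L b) λ p → clash (pp-≈ v≈ (pp-down (refl-gen (gen b)) (down b))) (pp-coset a (D-gen b) p)
        y , x , a≡ ← nonempty a flips
        z' , l , e ← deletion a (D-gen (not x)) (flips (not x))
        let n  = length z'
            a' = z' ∷ʳ not x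
            ea' : ⟪ a' ⟫ ≈W ⟪ a ⟫
            ea' = ≈trans (≡⇒≈ (trans (⟪⟫-++ z' [ not x ]) (cong (⟪ z' ⟫ ++_) (++-identityʳ (L (not x))))))
                 (≈trans (++-congʳ (L (not x)) (≈sym e)) (mult-mult ⟪ a ⟫ (refl-gen (gen (not x)))))
            la' : length a' ≡ suc n
            la' = trans (length-++ z') (+-comm n 1)
            ra' : RedB a'
            ra' = redB λ q h → ≤-trans (≤-reflexive (trans la' (sym l))) (RedB.least ra q (≈trans h ea'))
            b , alt-a = redB-alternates a ra
            b' , alt-a' = redB-alternates a' ra'
            a≡alt : a ≡ altB b (suc n)
            a≡alt = trans alt-a (cong (altB b) l)
            a'≡alt : a' ≡ altB b' (suc n)
            a'≡alt = trans alt-a' (cong (altB b') la')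
            b'≡ : b' ≡ not b
            b'≡ = Bool.¬-not (λ q → Bool.not-¬ {x} refl (sym (∷ʳ-injectiveʳ z' y (trans a'≡alt (trans (cong (λ c → altB c (suc n)) q) (trans (sym a≡alt) a≡))))))
            both : ∀ c → RedB (altB c (suc n)) × ⟪ altB c (suc n) ⟫ ≈W ⟪ a ⟫
            both c = pick c b b' b'≡ (subst RedB a≡alt ra , ≡⇒≈ (cong ⟪_⟫ (sym a≡alt))) (subst RedB a'≡alt ra' , ≈trans (≡⇒≈ (cong ⟪_⟫ (sym a'≡alt))) ea')
            exact = order-exact s t (suc n) (unbraid (≈trans (≡⇒≈ (sym (⟪altB⟫ false (suc n)))) (≈trans (proj₂ (both false))
                      (≈trans (≈sym (proj₂ (both true))) (≡⇒≈ (⟪altB⟫ true (suc n))))))) (s≤s z≤n)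
            k , m≡ = proj₁ exact
            c , lc = lst-onto false n
        d ← coset-descent cl n c w (proj₁ (both c)) (≈trans v≈ (++-congˡ M (≈sym (proj₂ (both c))))) (suc k) false (sym lc)
              (≤-trans (≤-reflexive (sym m≡)) (proj₂ exact))
        return (k , m≡ , d)
      where
      down : ∀ b → Shorter (rev w ++ L b) (rev w)
      down false = Shorter-cong (≡⇒≈ (unfold-reverse s w)) ≈refl (Shorter-rev ds)
      down true  = Shorter-cong (≡⇒≈ (unfold-reverse t w)) ≈refl (Shorter-rev dt)
      nonempty : ∀ a → (∀ b → PP ⟪ a ⟫ (L b) true) → ¬ ¬ ∃₂ λ y x → a ≡ y ∷ʳ x
      nonempty a fl with initLast a
      ... | [] = ⊥-elim (clash (fl true) (return []))
      ... | y ∷ʳ′ x = return (y , x , refl)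
      pick : ∀ c b b' {A : Bool → Set} → b' ≡ not b → A b → A b' → A c
      pick c b .(not b) refl p q with c Bool.≟ b
      ... | yes refl = p
      ... | no ne = subst _ (sym (Bool.¬-not ne)) q

  -- If t ≠ s divides s p, then by `descend` so does `alt s t (m s t)`. Its first letter turns s p
  -- back into p, and the rest is divided out of p.
  div-complete : ∀ n → Complete n (div n)
  div-complete n t [] l rp (_ , _ , h) q = n≮0 (h [] ≈refl)
  div-complete (suc n) t (s ∷ p) (s≤s l) rp sh q = run do
      k , e , d ← TwoDescents.descend s t (red-down rp) sh
      return (by k e d (subst (λ z → div-by (div n) t s p z ≡ nothing) e q))
    where
    by : ∀ k → m s t ≡ suc k → Desc (alt s t (suc k)) (s ∷ p) → ¬ div-by (div n) t s p (suc k) ≡ nothing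
    by zero e d ()
    by (suc k) e (_ , d) q with divs (div n) (alt t s (suc k)) p in eq
    ... | nothing = divs-complete (div-sound n) (div-complete n) (alt t s (suc k)) p l (red-tail rp)
                      (Desc-cong (alt t s (suc k)) (++-congʳ p (ss≈e s)) d) eq

  nf : Word → Word
  nf [] = []
  nf (s ∷ w) with div (length (nf w)) s (nf w)
  ... | just r  = r
  ... | nothing = s ∷ nf w

  nf-sound : ∀ w → w ≈W nf w
  nf-sound [] = ≈refl
  nf-sound (s ∷ w) with div (length (nf w)) s (nf w) in eq
  ... | just r  = ≈trans (++-congˡ [ s ] (nf-sound w)) (proj₁ (div-sound (length (nf w)) s (nf w) eq))
  ... | nothing = ++-congˡ [ s ] (nf-sound w)

  red-cons : ∀ {s w} → Red w → ¬ Shorter (s ∷ w) w → Red (s ∷ w)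
  red-cons {s} {w} rw n w' e = stable≤ do
    inj₁ (a , ea , h) ← Mult.φ-cases (left-mult s) w
      where inj₂ sh → λ _ → n sh
    return (≤-trans (s≤s (rw a ea)) (h w' e))

  nf-red : ∀ w → Red (nf w)
  nf-red [] _ _ = z≤n
  nf-red (s ∷ w) with div (length (nf w)) s (nf w) in eq
  ... | nothing = red-cons (nf-red w) λ sh → div-complete _ s (nf w) ≤-refl (nf-red w) sh eq
  ... | just r with div-sound (length (nf w)) s (nf w) eq
  ...   | h , l = λ w' e → s≤s⁻¹ (≤-trans (≤-reflexive (sym l)) (nf-red w (s ∷ w') (≈trans (++-congˡ [ s ] (≈trans e (≈sym h))) (++-congʳ (nf w) (ss≈e s)))))
    where open import Data.Nat using (s≤s⁻¹)

  -- Decidability up to double negation would not do: the completeness clause of EnumIntervalH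
  -- quantifies over all words.
  infix 4 _≈?_
  _≈?_ : ∀ a b → Dec (a ≈W b)
  a ≈? b with nf (a ++ rev b) in eq
  ... | [] = yes (≈trans (solve (a ∷ b ∷ []) [] x₀ ((x₀ ∙ inv x₁) ∙ x₁) refl)
               (++-congʳ b (≈trans (nf-sound (a ++ rev b)) (≡⇒≈ eq))))
  ... | x ∷ w = no λ h → 1+n≰n (≤-trans (s≤s z≤n) (subst (λ z → length z ≤ 0) eq (nf-red (a ++ rev b) []
                  (≈sym (≈trans (≈sym (nf-sound (a ++ rev b))) (≈trans (++-congʳ (rev b) h) (inverseʳ b)))))))

-- Parabolic cosets

module Cosets (C : CoxeterSystem) (H : CoxeterSystem.S C → Set) where
  open WordProblem C public
  open Parabolic H public

  InWH-cong : ∀ {u v} → u ≈W v → InWH u → InWH v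
  InWH-cong e h s hs d = h s hs (Shorter-cong (++-congʳ [ s ] (≈sym e)) (≈sym e) d)

  InWH-up : ∀ {u} → InWH u → ∀ {r} → H r → ¬ ¬ Shorter u (u ∷ʳ r)
  InWH-up {u} h {r} hr = Mult.φ-cases (right-mult r) u >>= λ where
    (inj₁ up) → return up
    (inj₂ dn) → λ _ → h r hr dn

  InWH-down : ∀ {v s} → InWH v → Shorter (s ∷ v) v → InWH (s ∷ v)
  InWH-down {v} {s} h sh r hr d = run do
    up ← InWH-up h hr
    inj₁ e ← Mult.φ-edge (left-mult s) (Mult.φ-down (right-mult r) d)
      where inj₂ (_ , sh') → return (Shorter-asym up (Shorter-cong (++-congʳ (v ∷ʳ r) (ss≈e s)) (++-congʳ v (ss≈e s)) sh'))
    return (Shorter-asym up (Shorter-cong (≈trans (≈sym e) (++-congʳ (v ∷ʳ r) (ss≈e s))) ≈refl sh))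

  -- Deodhar's lemma. Some r in H lowers s u on the right but raises u, so left multiplication by s
  -- does not carry the edge from u to u r to an upward edge; hence it matches the two ends.
  InWH-exit : ∀ {u s} → InWH u → Shorter u (s ∷ u) → ¬ InWH (s ∷ u) → ¬ ¬ ∃ λ r → H r × s ∷ u ≈W u ∷ʳ r
  InWH-exit {u} {s} h sh n k = n λ r hr d → run do
    up ← InWH-up h hr
    inj₂ (_ , sh') ← Mult.φ-edge (left-mult s) (Mult.φ-up (right-mult r) up)
      where inj₁ e → λ _ → k (r , hr , e)
    return (Shorter-asym sh' d)

  -- Coset u z : z ∈ u W_H
  data Coset (u : Word) : Word → Set where
    here  : ∀ {z} → z ≈W u → Coset u z
    there : ∀ {z z' r} → Coset u z → H r → z' ≈W z ∷ʳ r → Coset u z'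

  coset-congʳ : ∀ {u z z'} → z ≈W z' → Coset u z → Coset u z'
  coset-congʳ e (here h)       = here (≈trans (≈sym e) h)
  coset-congʳ e (there c hr h) = there c hr (≈trans (≈sym e) h)

  coset-congˡ : ∀ {u u' z} → u ≈W u' → Coset u z → Coset u' z
  coset-congˡ e (here h)       = here (≈trans h e)
  coset-congˡ e (there c hr h) = there (coset-congˡ e c) hr h

  coset-left : ∀ s {u z} → Coset u z → Coset (s ∷ u) (s ∷ z)
  coset-left s (here h)       = here (++-congˡ [ s ] h)
  coset-left s (there c hr h) = there (coset-left s c) hr (++-congˡ [ s ] h)

  coset-fixed : ∀ {s u r z} → H r → s ∷ u ≈W u ∷ʳ r → Coset u z → Coset u (s ∷ z)
  coset-fixed {s} hr e (here h) = there (here ≈refl) hr (≈trans (++-congˡ [ s ] h) e)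
  coset-fixed {s} hr e (there c hr' h) = there (coset-fixed hr e c) hr' (++-congˡ [ s ] h)

  -- Remove the factors from H one at a time by the lifting property: each of them raises y.
  coset-max : ∀ {u y z} → InWH y → Coset u z → y ≤B z → ¬ ¬ y ≤B u
  coset-max wy (here h) le = return (≤B-congʳ h le)
  coset-max {y = y} wy (there {z} {r = r} c hr h) le = do
    ct ← Mult.φ-cases (right-mult r) z
    up ← InWH-up wy hr
    le' ← lower ct up
    coset-max wy c le'
    where
    open Mult (right-mult r)
    lower : Shorter z (z ∷ʳ r) ⊎ Shorter (z ∷ʳ r) z → Shorter y (y ∷ʳ r) → ¬ ¬ y ≤B z
    lower (inj₂ dn) up = return (≤B-trans (≤B-congʳ h le) (⟶⇒≤B (φ-down dn)))
    lower (inj₁ z<) up = do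
      le' ← lift-up up (≤B-congʳ h le)
      return (≤B-congʳ (φ-inv z) le')

  coset-least : ∀ {u z} → InWH u → Coset u z → ¬ ¬ u ≤B z
  coset-least wu (here h) = return (base (≈sym h))
  coset-least {u} wu (there {z} {r = r} c hr h) = do
      le ← coset-least wu c
      ct ← φ-cases z
      le' ← raise le ct
      return (≤B-congʳ (≈sym h) le')
    where
    open Mult (right-mult r)
    raise : u ≤B z → Shorter z (z ∷ʳ r) ⊎ Shorter (z ∷ʳ r) z → ¬ ¬ u ≤B z ∷ʳ r
    raise le (inj₁ z<) = return (≤B-step le (φ-up z<))
    raise le (inj₂ dn) = do
      up ← InWH-up wu hr
      lift-up up le

  coset-rep : ∀ z → ¬ ¬ ∃ λ u → InWH u × Coset u z
  coset-rep z = do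
      u , wu , c ← go (nf z) (<-wellFounded _) (nf-red z)
      return (u , wu , coset-congʳ (≈sym (nf-sound z)) c)
    where
    go : ∀ z → Acc _<_ (length z) → Red z → ¬ ¬ ∃ λ u → InWH u × Coset u z
    go z (acc rs) rz = em {A = ∃ λ r → H r × Shorter (z ∷ʳ r) z} >>= λ where
      (no n) → return (z , (λ r hr d → n (r , hr , d)) , here ≈refl)
      (yes (r , hr , d)) → do
        u , wu , c ← go (nf (z ∷ʳ r)) (rs (Shorter-red (nf-red (z ∷ʳ r)) (Shorter-cong (nf-sound (z ∷ʳ r)) ≈refl d))) (nf-red (z ∷ʳ r))
        return (u , wu , there c hr (≈trans (≈sym (Mult.φ-inv (right-mult r) z)) (++-congʳ [ r ] (nf-sound (z ∷ʳ r)))))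

  e≤B : ∀ w → [] ≤B w
  e≤B w = ≤B-congʳ (≈sym (nf-sound w)) (go (nf w) (nf-red w))
    where
    go : ∀ r → Red r → [] ≤B r
    go [] _ = ≤B-refl
    go (s ∷ r) h = ≤B-step (go r (red-tail h)) (red-edge h)

  red-Len : ∀ {w} → Red w → Len w (length w)
  red-Len {w} r = (w , ≈refl , refl) , r

-- Bruhat intervals as graded posets

-- Elements of W whose Bruhat order is that of the given finite poset, closed downwards.
record Realization (C : CoxeterSystem) (H : CoxeterSystem.S C → Set) {N : ℕ}
                   (_⊑_ : Fin N → Fin N → Set) (PH : Fin N → Set) : Set where
  open Cosets C H
  field
    a       : Fin N → Word
    red     : ∀ i → Red (a i)
    inj     : ∀ {i j} → a i ≈W a j → i ≡ j
    to      : ∀ {i j} → i ⊑ j → a i ≤B a j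
    from    : ∀ {i j} → a i ≤B a j → i ⊑ j
    index   : ∀ {u} i → u ≤B a i → ∃ λ j → u ≈W a j
    ph-to   : ∀ {i} → PH i → InWH (a i)
    ph-from : ∀ {i} → InWH (a i) → PH i

  rank : Fin N → ℕ
  rank i = length (a i)

module RealizedOrder {C H N} {_⊑_ : Fin N → Fin N → Set} {PH} (_⊑?_ : ∀ x y → Dec (x ⊑ y))
                     (Re : Realization C H _⊑_ PH) where
  open Cosets C H
  open Realization Re

  ⊑-refl : ∀ x → x ⊑ x
  ⊑-refl x = from ≤B-refl

  ⊑-trans : ∀ {x y z} → x ⊑ y → y ⊑ z → x ⊑ z
  ⊑-trans p q = from (≤B-trans (to p) (to q))

  rank-cases : ∀ {x y} → x ⊑ y → x ≡ y ⊎ rank x < rank y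
  rank-cases p with ≤B-cases (to p)
  ... | inj₁ e  = inj₁ (inj e)
  ... | inj₂ sh = inj₂ (Shorter-red (red _) sh)

  rank-up : ∀ {x y} → x ⊑ y → ¬ x ≡ y → ∃ λ z → (x ⊑ z × rank z ≡ suc (rank x)) × z ⊑ y
  rank-up {x} {y} p ne = decidable-stable (Fin.any? λ z → ((x ⊑? z) ×-dec (rank z ≟ suc (rank x))) ×-dec (z ⊑? y)) do
    u , ru , l , e , le ← up-cover (red y) (red x) (to p) (λ h → ne (inj h))
    let z , h = index y le
    return (z , (from (≤B-congʳ h (⟶⇒≤B e)) , trans (red-length (≈sym h) (red z) ru) l) , from (≤B-congˡ h le))

  rank-down : ∀ {x n} → rank x ≡ suc n → ∃ λ y → y ⊑ x × rank y ≡ n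
  rank-down {x} e = go (a x) refl e
    where
    go : ∀ w → a x ≡ w → ∀ {n} → length w ≡ suc n → ∃ λ y → y ⊑ x × rank y ≡ n
    go (s ∷ p) eq refl = let y , h = index x le in y , from (≤B-congˡ h le) , red-length (≈sym h) (red y) (red-tail rw)
      where
      rw : Red (s ∷ p)
      rw = subst Red eq (red x)
      le : p ≤B a x
      le = subst (p ≤B_) (sym eq) (⟶⇒≤B (red-edge rw))

  rank-least : ∀ {x y} → rank x ≡ 0 → rank y ≡ 0 → x ≡ y
  rank-least {x} {y} p q = inj (≡⇒≈ (trans (empty p) (sym (empty q))))
    where
    empty : ∀ {w : Word} → length w ≡ 0 → w ≡ []
    empty {[]} _ = refl

  graded : FiniteGradedPoset N
  graded = record
    { _⊑_ = _⊑_ ; _⊑?_ = _⊑?_ ; ⊑-refl = ⊑-refl ; ⊑-trans = ⊑-trans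
    ; rk = rank ; ⊑-cases = rank-cases ; up-cover = rank-up }

-- Choose y below i with first rank one less. A second-rank cover of y below i has no room in the
-- first rank, so it is i. This gives both realizations one rank function.
rank-unique : ∀ {N} {_⊑_ : Fin N → Fin N → Set} (rk₁ rk₂ : Fin N → ℕ) →
  (∀ {x y} → x ⊑ y → x ≡ y ⊎ rk₁ x < rk₁ y) →
  (∀ {x y} → x ⊑ y → ¬ x ≡ y → ∃ λ z → (x ⊑ z × rk₂ z ≡ suc (rk₂ x)) × z ⊑ y) →
  (∀ {x n} → rk₁ x ≡ suc n → ∃ λ y → y ⊑ x × rk₁ y ≡ n) →
  (∀ {x n} → rk₂ x ≡ suc n → ∃ λ y → y ⊑ x × rk₂ y ≡ n) →
  ∀ i → rk₁ i ≡ rk₂ i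
rank-unique {_⊑_ = _⊑_} rk₁ rk₂ cases₁ up₂ down₁ down₂ i = go i (<-wellFounded _)
  where
  go : ∀ i → Acc _<_ (rk₁ i) → rk₁ i ≡ rk₂ i
  go i (acc rs) = by (rk₁ i) refl
    where
    zero-case : ∀ n → rk₁ i ≡ 0 → rk₂ i ≡ n → 0 ≡ n
    zero-case zero    _ _ = refl
    zero-case (suc n) e e₂ with down₂ e₂
    ... | j , l , e' with cases₁ l
    ...   | inj₁ refl = ⊥-elim (1+n≢n (trans (sym e₂) e'))
    ...   | inj₂ lt   = ⊥-elim (n≮0 (≤-trans lt (≤-reflexive e)))
    by : ∀ n → rk₁ i ≡ n → rk₁ i ≡ rk₂ i
    by zero e = trans e (zero-case (rk₂ i) e refl)
    by (suc n) e with down₁ e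
    ... | j , l , ej with go j (rs (≤-reflexive (trans (cong suc ej) (sym e))))
    ...   | eqj with up₂ l (λ { refl → 1+n≢n (trans (sym e) ej) })
    ...     | z , (jz , ez) , zi with cases₁ zi
    ...       | inj₁ refl = trans e (sym (trans ez (cong suc (trans (sym eqj) ej))))
    ...       | inj₂ lt with cases₁ jz
    ...         | inj₁ refl = ⊥-elim (1+n≢n (sym ez))
    ...         | inj₂ lt'  = ⊥-elim (1+n≰n (≤-trans (≤-trans (s≤s (≤-reflexive (sym ej))) lt') (s≤s⁻¹ (≤-trans lt (≤-reflexive e)))))

module RealizedSpec {C H N} (Γ : FiniteGradedPoset N) {PH}
  (Re : Realization C H (FiniteGradedPoset._⊑_ Γ) PH)
  (rk≡ : ∀ i → Realization.rank Re i ≡ FiniteGradedPoset.rk Γ i) where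
  open Cosets C H
  open Realization Re
  open GradedPoset Γ

  find : ∀ w → Dec (∃ λ j → w ≈W a j)
  find w = Fin.any? λ j → w ≈? a j

  mulMap : (Word → Word) → Fin N → Fin N
  mulMap φ i with find (φ (a i))
  ... | yes (j , _) = j
  ... | no _        = i

  mulMap-found : ∀ φ i → (∃ λ j → φ (a i) ≈W a j) → φ (a i) ≈W a (mulMap φ i)
  mulMap-found φ i h with find (φ (a i))
  ... | yes (_ , e) = e
  ... | no n        = ⊥-elim (n h)

  -- Holds on all of `Fin N` because `mulMap` fixes the indices whose product leaves the list. Sums
  -- over `Fin N` can therefore be reindexed by it.
  mulMap-inv : ∀ {φ} → Mult φ → ∀ i → mulMap φ (mulMap φ i) ≡ i
  mulMap-inv {φ} Φ i with find (φ (a i)) in eq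
  ... | yes (j , e) = inj (≈sym (≈trans (Mult.φ-swap Φ e) (mulMap-found φ j (i , ≈sym (Mult.φ-swap Φ e)))))
  ... | no _ with find (φ (a i)) | eq
  ...   | .(no _) | refl = refl

  ◁-edge : ∀ {x y} → x ◁ y → ¬ ¬ (a x ⟶ a y)
  ◁-edge {x} {y} (p , e) = cover-edge (red x) (red y) (trans (rk≡ y) (trans e (cong suc (sym (rk≡ x))))) (to p)

  module _ {v φ} (Φ : Mult φ) (down : Shorter (φ (a v)) (a v)) where
    open Mult Φ

    M : Fin N → Fin N
    M = mulMap φ

    M-found : ∀ {i} → i ⊑ v → φ (a i) ≈W a (M i)
    M-found {i} h = mulMap-found φ i (decidable-stable (find (φ (a i))) do
      le ← down-closed down (to h)
      return (index v le))

    M-mem : ∀ {i} → i ⊑ v → M i ⊑ v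
    M-mem {i} h = decidable-stable (M i ⊑? v) do
      le ← down-closed down (to h)
      return (from (≤B-congˡ (M-found h) le))

    M-up : ∀ {i} → i ⊑ v → Shorter (a i) (φ (a i)) → Up M i
    M-up {i} h sh = from (≤B-congʳ (M-found h) (⟶⇒≤B (φ-up sh)))
      , trans (sym (rk≡ (M i))) (trans (≤-antisym (≤-trans (red (M i) (φ (a i)) (M-found h)) (≤-reflexive (φ-len (a i))))
                                                  (Shorter-red (red i) (Shorter-cong ≈refl (M-found h) sh))) (cong suc (rk≡ i)))

    M-dn : ∀ {i} → i ⊑ v → Shorter (φ (a i)) (a i) → Dn M i
    M-dn {i} h sh = from (≤B-congˡ (M-found h) (⟶⇒≤B (φ-down sh)))
      , trans (sym (rk≡ i)) (trans (≤-antisym (≤-trans (red i (φ (a (M i))) (≈sym (φ-swap (M-found h)))) (≤-reflexive (φ-len (a (M i)))))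
                                              (Shorter-red (red (M i)) (Shorter-cong (M-found h) ≈refl sh))) (cong suc (rk≡ (M i))))

    Up-shorter : ∀ {i} → i ⊑ v → Up M i → Shorter (a i) (φ (a i))
    Up-shorter {i} h (_ , e) = Shorter-cong ≈refl (≈sym (M-found h)) (red-Shorter (red (M i)) (≤-reflexive (trans (cong suc (rk≡ i)) (trans (sym e) (sym (rk≡ (M i)))))))

    Dn-shorter : ∀ {i} → i ⊑ v → Dn M i → Shorter (φ (a i)) (a i)
    Dn-shorter {i} h (_ , e) = Shorter-cong (≈sym (M-found h)) ≈refl (red-Shorter (red i) (≤-reflexive (trans (cong suc (rk≡ (M i))) (trans (sym e) (sym (rk≡ i))))))

    M-edge : ∀ {x y} → x ◁ y → y ⊑ v → ¬ ¬ (M x ≡ y ⊎ M x ⊑ M y)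
    M-edge {x} {y} xy h = do
      e ← ◁-edge xy
      let hx = ⊑-trans (proj₁ xy) h
      φ-edge e >>= λ where
        (inj₁ q) → return (inj₁ (inj (≈trans (≈sym (M-found hx)) q)))
        (inj₂ q) → return (inj₂ (from (≤B-congˡ (M-found hx) (≤B-congʳ (M-found h) (⟶⇒≤B q)))))

    mult-spec : Spec v M
    mult-spec = record
      { inv  = λ _ → mulMap-inv Φ _
      ; mem  = M-mem
      ; cov  = λ {x} h → decidable-stable (((x ⊑? M x) ×-dec (rk (M x) ≟ suc (rk x))) ⊎-dec ((M x ⊑? x) ×-dec (rk x ≟ suc (rk (M x))))) do
          inj₁ sh ← φ-cases (a x)
            where inj₂ sh → return (inj₂ (M-dn h sh))
          return (inj₁ (M-up h sh))
      ; s-up = λ {x} {y} xy h ux uy → parallel xy h (λ q → ◁-asym xy (subst (y ◁_) (trans (cong M (sym q)) (mulMap-inv Φ x)) uy))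
                                        , trans (proj₂ uy) (cong suc (trans (proj₂ xy) (sym (proj₂ ux))))
      ; s-dn = λ {x} {y} xy h dx dy → parallel xy h (λ q → ◁-asym xy (subst (_◁ x) q dx))
                                        , suc-injective (trans (sym (proj₂ dy)) (trans (proj₂ xy) (cong suc (proj₂ dx))))
      ; s-eq = λ {x} {y} xy h ux dy → decidable-stable (M x Fin.≟ y) do
          inj₁ q ← M-edge xy h
            where inj₂ le → λ _ → 1+n≰n (≤-trans (≤-reflexive (trans (sym (proj₂ dy)) (trans (proj₂ xy) (sym (proj₂ ux))))) (rk-mono le))
          return q
      }
      where
      parallel : ∀ {x y} → x ◁ y → y ⊑ v → ¬ M x ≡ y → M x ⊑ M y
      parallel {x} {y} xy h ne = decidable-stable (M x ⊑? M y) do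
        inj₂ le ← M-edge xy h
          where inj₁ q → λ _ → ne q
        return le

  -- Left multiplication by the first letter of the chosen reduced word; the identity in rank 0 is
  -- junk.
  M₀ : Fin N → Fin N → Fin N
  M₀ v with a v
  ... | []    = λ i → i
  ... | s ∷ _ = mulMap (left s)

  first-letter : ∀ {v n} → rk v ≡ suc n → ∃ λ s → Shorter (s ∷ a v) (a v) × M₀ v ≡ mulMap (left s)
  first-letter {v} e with a v | red v | rk≡ v
  ... | []    | _ | q = ⊥-elim (0≢1+n (trans q e))
  ... | s ∷ w | r | _ = s , red-down r , refl

  spec₀ : ∀ {v n} → rk v ≡ suc n → Spec v (M₀ v)
  spec₀ {v} e with first-letter {v} e
  ... | s , d , q = subst (Spec v) (sym q) (mult-spec (left-mult s) d)

  two-specs : ∀ v → 2 ≤ rk v → ¬ ¬ ∃₂ λ K K' → Spec v K × Spec v K' × ¬ K v ≡ K' v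
  two-specs v l = do
    downMult {φ} Φ d , downMult {ψ} Ψ d' , ne ← two-mults (red v) (≤-trans l (≤-reflexive (sym (rk≡ v))))
    return (mulMap φ , mulMap ψ , mult-spec Φ d , mult-spec Ψ d' , λ e → ne (≈trans (M-found Φ d (⊑-refl v))
      (≈trans (≡⇒≈ (cong a e)) (≈sym (M-found Ψ d' (⊑-refl v))))))

  triple : ∀ {A : Set} → A → A → A → Fin 3 → A
  triple x y z Fin.zero = x
  triple x y z (Fin.suc Fin.zero) = y
  triple x y z (Fin.suc (Fin.suc Fin.zero)) = z

  distinct : ∀ {x y z : Fin N} → ¬ x ≡ y → ¬ x ≡ z → ¬ y ≡ z → ∀ {i j} → ¬ i ≡ j → ¬ triple x y z i ≡ triple x y z j
  distinct xy xz yz {Fin.zero} {Fin.zero} n = ⊥-elim (n refl)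
  distinct xy xz yz {Fin.zero} {Fin.suc Fin.zero} n = xy
  distinct xy xz yz {Fin.zero} {Fin.suc (Fin.suc Fin.zero)} n = xz
  distinct xy xz yz {Fin.suc Fin.zero} {Fin.zero} n = λ e → xy (sym e)
  distinct xy xz yz {Fin.suc Fin.zero} {Fin.suc Fin.zero} n = ⊥-elim (n refl)
  distinct xy xz yz {Fin.suc Fin.zero} {Fin.suc (Fin.suc Fin.zero)} n = yz
  distinct xy xz yz {Fin.suc (Fin.suc Fin.zero)} {Fin.zero} n = λ e → xz (sym e)
  distinct xy xz yz {Fin.suc (Fin.suc Fin.zero)} {Fin.suc Fin.zero} n = λ e → yz (sym e)
  distinct xy xz yz {Fin.suc (Fin.suc Fin.zero)} {Fin.suc (Fin.suc Fin.zero)} n = ⊥-elim (n refl)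

  every : ∀ {A : Set} {x y z : A} {Q : A → Set} → Q x → Q y → Q z → ∀ i → Q (triple x y z i)
  every p q r Fin.zero = p
  every p q r (Fin.suc Fin.zero) = q
  every p q r (Fin.suc (Fin.suc Fin.zero)) = r

  level-eq : ∀ {x y} → x ◁ y → rank y ≡ suc (rank x)
  level-eq {x} {y} (_ , e) = trans (rk≡ y) (trans e (cong suc (sym (rk≡ x))))

  noK : NoK
  noK = record
    { K↑ = λ {w} {w'} {x} {y} {z} ne xy xz yz wx wy wz w'x w'y w'z → run do
        r  ← ¬¬-finite {3} {λ i → a w ⟶ a (triple x y z i)} λ i → ◁-edge (every {Q = w ◁_} wx wy wz i)
        r' ← ¬¬-finite {3} {λ i → a w' ⟶ a (triple x y z i)} λ i → ◁-edge (every {Q = w' ◁_} w'x w'y w'z i)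
        return (CommonNeighbours.impossible (λ e → ne (inj e)) (λ i → a (triple x y z i)) (λ n e → distinct xy xz yz n (inj e))
          (λ i → proj₁ (r i)) (λ i → proj₁ (r' i)) (red w) (λ i → red (triple x y z i))
          (inj₁ λ i → level-eq (every {Q = w ◁_} wx wy wz i)))
    ; K↓ = λ {w} {w'} {x} {y} {z} ne xy xz yz xw yw zw xw' yw' zw' → run do
        r  ← ¬¬-finite {3} {λ i → a (triple x y z i) ⟶ a w} λ i → ◁-edge (every {Q = _◁ w} xw yw zw i)
        r' ← ¬¬-finite {3} {λ i → a (triple x y z i) ⟶ a w'} λ i → ◁-edge (every {Q = _◁ w'} xw' yw' zw' i)
        return (CommonNeighbours.impossible (λ e → ne (inj e)) (λ i → a (triple x y z i)) (λ n e → distinct xy xz yz n (inj e))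
          (λ i → refl-quot-sym (a (triple x y z i)) (a w) (proj₁ (r i))) (λ i → refl-quot-sym (a (triple x y z i)) (a w') (proj₁ (r' i)))
          (red w) (λ i → red (triple x y z i)) (inj₂ λ i → level-eq (every {Q = _◁ w} xw yw zw i)))
    }

-- Parabolic R-polynomials

module IntervalR {N} (Γ : FiniteGradedPoset N) (M₀ : Fin N → Fin N → Fin N)
  (spec₀ : ∀ {v n} → FiniteGradedPoset.rk Γ v ≡ suc n → GradedPoset.Spec Γ v (M₀ v)) where
  open GradedPoset Γ

  -- The first argument stands for the rank of v and makes the recursion structural. `R-diag` uses
  -- the value 1 in rank 0.
  Rf Rn : ℕ → Fin N → Fin N → Poly
  Rf n v u with u ⊑? v
  ... | yes _ = Rn n v u
  ... | no _  = 0P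
  Rn zero    v u = 1P
  Rn (suc n) v u = T (M₀ v) (Rf n (M₀ v v)) u

  R : Fin N → Fin N → Poly
  R v = Rf (rk v) v

  R-zero : ∀ {v u} → ¬ u ⊑ v → R v u ≈P 0P
  R-zero {v} {u} n with u ⊑? v
  ... | yes p = ⊥-elim (n p)
  ... | no _  = λ _ → refl

  R-calc : ∀ {v n} → rk v ≡ suc n → Calculates R v (M₀ v)
  R-calc {v} {n} e {u} h with u ⊑? v
  ... | no k = ⊥-elim (k h)
  ... | yes _ = ≡⇒≈P (trans (cong (λ k → Rn k v u) e) (cong (λ k → T (M₀ v) (Rf k (M₀ v v)) u)
          (suc-injective (trans (sym e) (proj₂ (Spec.top-dn (spec₀ e)))))))

  R-diag : ∀ v → R v v ≈P 1P
  R-diag v = go (rk v) v refl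
    where
    go : ∀ n v → rk v ≡ n → R v v ≈P 1P
    go zero v e with v ⊑? v
    ... | yes _ = ≡⇒≈P (cong (λ k → Rn k v v) e)
    ... | no k  = ⊥-elim (k (⊑-refl v))
    go (suc n) v e = ≈P-trans (R-calc e (⊑-refl v)) (≈P-trans (T-dn (R (M₀ v v)) d)
        (go n (M₀ v v) (suc-injective (trans (sym (proj₂ d)) e))))
      where d = Spec.top-dn (spec₀ e)

module ParabolicSum {N} (Γ : FiniteGradedPoset N) {PH : Fin N → Set} (PH? : ∀ y → Dec (PH y))
  (x : XParam) (R : Fin N → Fin N → Poly) where
  open GradedPoset Γ

  -- z ∈ u W_H for u ∈ W^H, in terms of the order only: u is the largest element of W^H below z
  Cos : Fin N → Fin N → Set
  Cos u z = u ⊑ z × (∀ y → PH y → y ⊑ z → y ⊑ u)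

  cos? : ∀ u z → Dec (Cos u z)
  cos? u z = (u ⊑? z) ×-dec Fin.all? λ y → PH? y →-dec ((y ⊑? z) →-dec (y ⊑? u))

  wt : Fin N → Fin N → Poly → Poly
  wt u z f with cos? u z
  ... | yes _ = E^ x (rk z ∸ rk u) f
  ... | no _  = 0P

  wt-yes : ∀ {u z} f → Cos u z → wt u z f ≈P E^ x (rk z ∸ rk u) f
  wt-yes {u} {z} f c with cos? u z
  ... | yes _ = λ _ → refl
  ... | no n  = ⊥-elim (n c)

  wt-no : ∀ {u z} f → ¬ Cos u z → wt u z f ≈P 0P
  wt-no {u} {z} f n with cos? u z
  ... | yes c = ⊥-elim (n c)
  ... | no _  = λ _ → refl

  wt-0 : ∀ u z {f} → f ≈P 0P → wt u z f ≈P 0P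
  wt-0 u z h with cos? u z
  ... | yes _ = ≈P-trans (E^-cong x (rk z ∸ rk u) h) (E^-0 x (rk z ∸ rk u))
  ... | no _  = λ _ → refl

  -- the parabolic R-polynomial as a signed sum of ordinary ones over the coset of u
  RH : Fin N → Fin N → Poly
  RH u v = ΣP λ z → wt u z (R v z)

module ParabolicFormula {C H N} (Γ : FiniteGradedPoset N) {PH} (PH? : ∀ y → Dec (PH y))
  (Re : Realization C H (FiniteGradedPoset._⊑_ Γ) PH)
  (rk≡ : ∀ i → Realization.rank Re i ≡ FiniteGradedPoset.rk Γ i)
  (R : Fin N → Fin N → Poly) (R-zero : ∀ {v u} → ¬ FiniteGradedPoset._⊑_ Γ u v → R v u ≈P 0P)
  (R-diag : ∀ v → R v v ≈P 1P)
  (R-calc : ∀ {v M} → GradedPoset.Spec Γ v M → GradedPoset.Calculates Γ R v M)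
  (x : XParam) (Rᶠ : List (CoxeterSystem.S C) → List (CoxeterSystem.S C) → Poly)
  (isR : Coxeter.Parabolic.IsParabolicR C H x Rᶠ) where
  open Cosets C H
  open Realization Re
  open GradedPoset Γ
  open RealizedSpec Γ Re rk≡ hiding (M)
  open ParabolicSum Γ PH? x R
  open IsParabolicR isR

  -- The representative of the coset of z is also the largest element of W^H below z, hence equal to
  -- u.
  cos⇒ : ∀ {u z} → PH u → Cos u z → ¬ ¬ Coset (a u) (a z)
  cos⇒ {u} {z} hu (uz , mx) = do
    u' , wu' , c ← coset-rep (a z)
    le ← coset-least wu' c
    le' ← coset-max (ph-to hu) c (to uz)
    let j , e = index z le
        ju = mx j (ph-from (InWH-cong e wu')) (from (≤B-congˡ e le))
        uj = from (≤B-congʳ e le')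
        j≡u : j ≡ u
        j≡u = ⊑-antisym-rk ju (≤-antisym (rk-mono ju) (rk-mono uj))
    return (coset-congˡ (≈trans e (≡⇒≈ (cong a j≡u))) c)

  cos⇐ : ∀ {u z} → PH u → Coset (a u) (a z) → Cos u z
  cos⇐ {u} {z} hu c = decidable-stable (u ⊑? z) (coset-least (ph-to hu) c >>= λ le → return (from le))
    , λ y hy yz → decidable-stable (y ⊑? u) (coset-max (ph-to hy) c (to yz) >>= λ le → return (from le))

  module Descent {v s} (hv : PH v) (d : Shorter (s ∷ a v) (a v)) where
    Φ : Mult (left s)
    Φ = left-mult s
    M : Fin N → Fin N
    M = mulMap (left s)
    sp : Spec v M
    sp = mult-spec Φ d
    open Spec sp using (mem; inv; cov)

    sv : Fin N
    sv = M v

    sv⊑v : sv ⊑ v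
    sv⊑v = mem (⊑-refl v)

    M≈ : ∀ {z} → z ⊑ v → s ∷ a z ≈W a (M z)
    M≈ = M-found Φ d

    M-outside : ∀ {z} → ¬ z ⊑ v → ¬ M z ⊑ v
    M-outside {z} n h = n (subst (_⊑ v) (mulMap-inv Φ z) (mem h))

    off : ∀ {z} → ¬ z ⊑ v → R sv z ≈P 0P
    off n = R-zero λ h → n (⊑-trans h sv⊑v)

    hsv : PH sv
    hsv = ph-from (InWH-cong (M≈ (⊑-refl v)) (InWH-down (ph-to hv) d))

    cos-M : ∀ {u z} → u ⊑ v → z ⊑ v → PH u → PH (M u) → Cos u z → Cos (M u) (M z)
    cos-M {u} {z} uv zv hu hsu c = decidable-stable (cos? (M u) (M z)) do
      c' ← cos⇒ hu c
      return (cos⇐ hsu (coset-congˡ (M≈ uv) (coset-congʳ (M≈ zv) (coset-left s c'))))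

    cos-M⁻ : ∀ {u z} → u ⊑ v → z ⊑ v → PH u → PH (M u) → Cos (M u) (M z) → Cos u z
    cos-M⁻ {u} {z} uv zv hu hsu c = subst₂ Cos (mulMap-inv Φ u) (mulMap-inv Φ z)
      (cos-M (mem uv) (mem zv) hsu (subst PH (sym (mulMap-inv Φ u)) hu) c)

    -- If s lowered z, then s u ≤ z with s u in W^H and of larger rank than u, against the
    -- maximality of u.
    up-on-coset : ∀ {u z} → u ⊑ v → z ⊑ v → PH (M u) → Up M u → Cos u z → Up M z
    up-on-coset {u} {z} uv zv hsu up (uz , mx) with cov zv
    ... | inj₁ u' = u'
    ... | inj₂ dn = ⊥-elim (1+n≰n (≤-trans (≤-reflexive (sym (proj₂ up))) (rk-mono (mx (M u) hsu su⊑z))))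
      where
      su⊑z : M u ⊑ z
      su⊑z = decidable-stable (M u ⊑? z) do
        le ← Mult.down-closed Φ (Dn-shorter Φ d zv dn) (to uz)
        return (from (≤B-congˡ (M≈ uv) le))

    step-down : ∀ {z} → z ⊑ v → Dn M z → R v z ≈P R sv (M z)
    step-down h dn = ≈P-trans (R-calc sp h) (T-dn (R sv) dn)

    step-up : ∀ {z} → z ⊑ v → Up M z → R v z ≈P mix (R sv z) (R sv (M z))
    step-up h up = ≈P-trans (R-calc sp h) (T-up (R sv) up)

    RH-desc : ∀ {u} → u ⊑ v → PH u → PH (M u) → Dn M u → RH u v ≈P RH (M u) sv
    RH-desc {u} uv hu hsu dn = ≈P-trans (ΣP-cong term) (≈P-sym (ΣP-reindex (λ z → wt (M u) z (R sv z)) M (mulMap-inv Φ)))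
      where
      term : ∀ z → wt u z (R v z) ≈P wt (M u) (M z) (R sv (M z))
      term z with z ⊑? v
      ... | no n = ≈P-trans (wt-0 u z (R-zero n)) (≈P-sym (wt-0 (M u) (M z) (off (M-outside n))))
      ... | yes h with cos? u z
      ...   | no n = ≈P-sym (wt-no (R sv (M z)) λ c → n (cos-M⁻ uv h hu hsu c))
      ...   | yes c = ≈P-trans (E^-cong x (rk z ∸ rk u) (step-down h dz))
                        (≈P-trans (≡⇒≈P (cong₂ (λ p q → E^ x (p ∸ q) (R sv (M z))) (proj₂ dz) (proj₂ dn)))
                                  (≈P-sym (wt-yes (R sv (M z)) c')))
        where
        c' : Cos (M u) (M z)
        c' = cos-M uv h hu hsu c
        dz : Dn M z
        dz = subst (M z ◁_) (mulMap-inv Φ z) (up-on-coset (mem uv) (mem h) (subst PH (sym (mulMap-inv Φ u)) hu)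
               (subst (M u ◁_) (sym (mulMap-inv Φ u)) dn) c')

    RH-asc-in : ∀ {u} → u ⊑ v → PH u → PH (M u) → Up M u → RH u v ≈P mix (RH u sv) (RH (M u) sv)
    RH-asc-in {u} uv hu hsu up = ≈P-trans (ΣP-cong term) (≈P-trans (ΣP-mix (λ z → wt u z (R sv z)) (λ z → wt (M u) (M z) (R sv (M z))))
        (mix-cong (λ _ → refl) (≈P-sym (ΣP-reindex (λ z → wt (M u) z (R sv z)) M (mulMap-inv Φ)))))
      where
      term : ∀ z → wt u z (R v z) ≈P mix (wt u z (R sv z)) (wt (M u) (M z) (R sv (M z)))
      term z with z ⊑? v
      ... | no n = ≈P-trans (wt-0 u z (R-zero n)) (≈P-sym (≈P-trans (mix-cong (wt-0 u z (off n)) (wt-0 (M u) (M z) (off (M-outside n)))) mix-0))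
      ... | yes h with cos? u z
      ...   | no n = ≈P-sym (≈P-trans (mix-cong (λ _ → refl) (wt-no (R sv (M z)) λ c → n (cos-M⁻ uv h hu hsu c))) mix-0)
      ...   | yes c = ≈P-trans (E^-cong x (rk z ∸ rk u) (step-up h uz)) (≈P-trans (E^-mix x (rk z ∸ rk u) (R sv z) (R sv (M z)))
                        (mix-cong (λ _ → refl) (≈P-trans (≡⇒≈P (cong₂ (λ p q → E^ x (p ∸ q) (R sv (M z))) (sym (proj₂ uz)) (sym (proj₂ up))))
                                                         (≈P-sym (wt-yes (R sv (M z)) (cos-M uv h hu hsu c))))))
        where
        uz : Up M z
        uz = up-on-coset uv h hsu up c

    -- By `InWH-exit` left multiplication by s maps the coset of u to itself. The terms at z and s z
    -- are added, and each such pair is an instance of `mix-E`.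
    RH-asc-out : ∀ {u} → u ⊑ v → PH u → Up M u → ¬ PH (M u) → RH u v ≈P G x (RH u sv)
    RH-asc-out {u} uv hu up nsu = ≈P-trans (ΣP-pairs A B M (mulMap-inv Φ) pairs) (ΣP-G x (λ z → wt u z (R sv z)))
      where
      A B : Fin N → Poly
      A z = wt u z (R v z)
      B z = G x (wt u z (R sv z))
      cos-stay : ∀ {z} → z ⊑ v → Cos u z → Cos u (M z)
      cos-stay {z} h c = decidable-stable (cos? u (M z)) do
        c' ← cos⇒ hu c
        r , hr , e ← InWH-exit (ph-to hu) (Up-shorter Φ d uv up) (λ w → nsu (ph-from (InWH-cong (M≈ uv) w)))
        return (cos⇐ hu (coset-congʳ (M≈ h) (coset-fixed hr e c')))
      cos-stay⁻ : ∀ {z} → z ⊑ v → Cos u (M z) → Cos u z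
      cos-stay⁻ {z} h c = subst (Cos u) (mulMap-inv Φ z) (cos-stay (mem h) c)
      zero-pair : ∀ {f g} → f ≈P 0P → g ≈P 0P → f +P g ≈P 0P
      zero-pair p q n = cong₂ ℤ._+_ (p n) (q n)
      G-zero : ∀ {f} → f ≈P 0P → G x f ≈P 0P
      G-zero p = ≈P-trans (G-cong x p) (G-0 x)
      up-pair : ∀ {z} → z ⊑ v → Cos u z → Up M z → A z +P A (M z) ≈P B z +P B (M z)
      up-pair {z} h c uz = ≈P-trans (+P-cong (≈P-trans (wt-yes (R v z) c) (≈P-trans (E^-cong x k (step-up h uz)) (E^-mix x k (R sv z) (R sv (M z)))))
                                       (≈P-trans (wt-yes (R v (M z)) c') (≈P-trans (≡⇒≈P (cong (λ j → E^ x j (R v (M z))) k')) 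
                                         (E^-cong x (suc k) (≈P-trans (step-down (mem h) (Spec.up⇒dn sp h uz)) (≡⇒≈P (cong (R sv) (mulMap-inv Φ z))))))))
                         (≈P-trans (mix-E x (E^ x k (R sv z)) (E^ x k (R sv (M z))))
                           (+P-cong (G-cong x (≈P-sym (wt-yes (R sv z) c)))
                                    (G-cong x (≈P-sym (≈P-trans (wt-yes (R sv (M z)) c') (≡⇒≈P (cong (λ j → E^ x j (R sv (M z))) k')))))))
        where
        k : ℕ
        k = rk z ∸ rk u
        c' : Cos u (M z)
        c' = cos-stay h c
        k' : rk (M z) ∸ rk u ≡ suc k
        k' = trans (cong (_∸ rk u) (proj₂ uz)) (+-∸-assoc 1 (rk-mono (proj₁ c)))
      pairs : ∀ z → A z +P A (M z) ≈P B z +P B (M z)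
      pairs z = by (z ⊑? v)
        where
        inside : z ⊑ v → Dec (Cos u z) → Up M z ⊎ Dn M z → A z +P A (M z) ≈P B z +P B (M z)
        inside h (no n) _ = ≈P-trans (zero-pair (wt-no (R v z) n) (wt-no (R v (M z)) λ c → n (cos-stay⁻ h c)))
          (≈P-sym (zero-pair (G-zero (wt-no (R sv z) n)) (G-zero (wt-no (R sv (M z)) λ c → n (cos-stay⁻ h c)))))
        inside h (yes c) (inj₁ uz) = up-pair h c uz
        inside h (yes c) (inj₂ dz) n = trans (ℤ.+-comm (A z n) (A (M z) n)) (trans (trans (cong (λ j → A (M z) n ℤ.+ A j n) (sym (mulMap-inv Φ z)))
          (trans (up-pair (mem h) (cos-stay h c) (Spec.dn⇒up sp h dz) n) (cong (λ j → B (M z) n ℤ.+ B j n) (mulMap-inv Φ z)))) (ℤ.+-comm (B (M z) n) (B z n)))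
        by : Dec (z ⊑ v) → A z +P A (M z) ≈P B z +P B (M z)
        by (no n) = ≈P-trans (zero-pair (wt-0 u z (R-zero n)) (wt-0 u (M z) (R-zero (M-outside n))))
          (≈P-sym (zero-pair (G-zero (wt-0 u z (off n))) (G-zero (wt-0 u (M z) (off (M-outside n))))))
        by (yes h) = inside h (cos? u z) (cov h)

  formula : ∀ {u v} → PH u → PH v → Rᶠ (a u) (a v) ≈P RH u v
  formula {u} {v} hu hv = go v (<-wellFounded _) hv hu
    where
    go : ∀ v → Acc _<_ (rk v) → PH v → ∀ {u} → PH u → Rᶠ (a u) (a v) ≈P RH u v
    go v (acc rs) hv {u} hu with u ⊑? v
    ... | no n = ≈P-trans (r-zero (a u) (a v) (ph-to hu) (ph-to hv) (λ le → n (from le))) (≈P-sym (ΣP-0 zero-term))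
      where
      zero-term : ∀ z → wt u z (R v z) ≈P 0P
      zero-term z with cos? u z
      ... | yes c = ≈P-trans (E^-cong x (rk z ∸ rk u) (R-zero λ h → n (⊑-trans (proj₁ c) h))) (E^-0 x (rk z ∸ rk u))
      ... | no _  = λ _ → refl
    ... | yes uv with ⊑-cases uv
    ...   | inj₁ refl = ≈P-trans (r-one (a u) (ph-to hu)) (≈P-sym (≈P-trans (ΣP-single u other)
              (≈P-trans (wt-yes (R u u) (⊑-refl u , λ _ _ h → h)) (≈P-trans (≡⇒≈P (cong (λ k → E^ x k (R u u)) (n∸n≡0 (rk u)))) (R-diag u)))))
      where
      other : ∀ z → ¬ z ≡ u → wt u z (R u z) ≈P 0P
      other z ne with cos? u z
      ... | no _  = λ _ → refl
      ... | yes c = ≈P-trans (E^-cong x (rk z ∸ rk u) (R-zero λ h → ne (⊑-antisym-rk h (≤-antisym (rk-mono h) (rk-mono (proj₁ c)))))) (E^-0 x (rk z ∸ rk u))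
    ...   | inj₂ lt = λ k → stableℤ (do
              ct ← Mult.φ-cases Φ (a u)
              wd ← em {A = InWH (s ∷ a u)}
              return (cases ct wd k))
      where
      rk-suc : ∃ λ n → rk v ≡ suc n
      rk-suc = rk v ∸ 1 , sym (m+[n∸m]≡n (≤-trans (s≤s z≤n) lt))
      fl : ∃ λ s → Shorter (s ∷ a v) (a v) × M₀ v ≡ mulMap (left s)
      fl = first-letter (proj₂ rk-suc)
      s : S
      s = proj₁ fl
      d : Shorter (s ∷ a v) (a v)
      d = proj₁ (proj₂ fl)
      open Descent hv d
      u<v : a u <B a v
      u<v = to uv , λ e → <-irrefl (cong rk (inj e)) lt
      ih : ∀ {u} → PH u → Rᶠ (a u) (a sv) ≈P RH u sv
      ih = go sv (rs (≤-reflexive (sym (proj₂ (Spec.top-dn sp))))) hsv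
      hsu⇒ : InWH (s ∷ a u) → PH (M u)
      hsu⇒ w = ph-from (InWH-cong (M≈ uv) w)
      R-u : Rᶠ (a u) (s ∷ a v) ≈P RH u sv
      R-u = ≈P-trans (respects (a u) (a u) (s ∷ a v) (a sv) ≈refl (M≈ (⊑-refl v))) (ih hu)
      R-su : InWH (s ∷ a u) → Rᶠ (s ∷ a u) (s ∷ a v) ≈P RH (M u) sv
      R-su w = ≈P-trans (respects (s ∷ a u) (a (M u)) (s ∷ a v) (a sv) (M≈ uv) (M≈ (⊑-refl v))) (ih (hsu⇒ w))
      cases : Shorter (a u) (s ∷ a u) ⊎ Shorter (s ∷ a u) (a u) → Dec (InWH (s ∷ a u)) → Rᶠ (a u) (a v) ≈P RH u v
      cases (inj₂ dn) _ = ≈P-trans (r-desc (a u) (a v) s (ph-to hu) (ph-to hv) u<v d dn)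
        (≈P-trans (R-su w) (≈P-sym (RH-desc uv hu (hsu⇒ w) (M-dn Φ d uv dn))))
        where
        w : InWH (s ∷ a u)
        w = InWH-down (ph-to hu) dn
      cases (inj₁ up) (yes w) = ≈P-trans (r-asc-in (a u) (a v) s (ph-to hu) (ph-to hv) u<v d (Shorter-asym up) w)
        (≈P-trans (mix-*P (Rᶠ (a u) (s ∷ a v)) (Rᶠ (s ∷ a u) (s ∷ a v)))
        (≈P-trans (mix-cong R-u (R-su w)) (≈P-sym (RH-asc-in uv hu (hsu⇒ w) (M-up Φ d uv up)))))
      cases (inj₁ up) (no nw) = ≈P-trans (r-asc-out (a u) (a v) s (ph-to hu) (ph-to hv) u<v d (Shorter-asym up) nw)
        (≈P-trans (G-*P x (Rᶠ (a u) (s ∷ a v)))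
        (≈P-trans (G-cong x R-u) (≈P-sym (RH-asc-out uv hu (M-up Φ d uv up) (λ h → nw (InWH-cong (≈sym (M≈ uv)) (ph-to h)))))))

-- Enumeration of intervals and the main theorem

sumP-cong : ∀ {A : Set} {f g : A → Poly} {L : List A} → All (λ x → f x ≈P g x) L → sumP (map f L) ≈P sumP (map g L)
sumP-cong []      = λ _ → refl
sumP-cong (h ∷ k) = +P-cong h (sumP-cong k)

sublists : ∀ {A : Set} → List A → List (List A)
sublists []       = [] ∷ []
sublists (x ∷ xs) = map (x ∷_) (sublists xs) ++ sublists xs

⊆⇒∈-sublists : ∀ {A : Set} {ys xs : List A} → ys ⊆ xs → ys ∈ sublists xs
⊆⇒∈-sublists []         = here refl
⊆⇒∈-sublists {xs = x ∷ xs} (.x skip s) = ∈-++⁺ʳ (map (x ∷_) (sublists xs)) (⊆⇒∈-sublists s)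
⊆⇒∈-sublists {xs = x ∷ xs} (refl ∷ s) = ∈-++⁺ˡ (∈-map⁺ (x ∷_) (⊆⇒∈-sublists s))

lookup-injective : ∀ {A : Set} {_~_ : A → A → Set} → (∀ {x y} → x ~ y → y ~ x) → ∀ {L} → AllPairs (λ x y → ¬ x ~ y) L →
                   ∀ i j → lookup L i ~ lookup L j → i ≡ j
lookup-injective sm (_ ∷ _) Fin.zero Fin.zero h = refl
lookup-injective sm {x ∷ L} (n ∷ _) Fin.zero (Fin.suc j) h = ⊥-elim (ListAll.lookup n (∈-lookup j) h)
lookup-injective sm {x ∷ L} (n ∷ _) (Fin.suc i) Fin.zero h = ⊥-elim (ListAll.lookup n (∈-lookup i) (sm h))
lookup-injective sm (_ ∷ p) (Fin.suc i) (Fin.suc j) h = cong Fin.suc (lookup-injective sm p i j h)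

module Enumerate (C : CoxeterSystem) (H : CoxeterSystem.S C → Set) (v : List (CoxeterSystem.S C)) where
  open Cosets C H

  Enumeration : List Word → List Word → Set
  Enumeration xs ys = All (λ y → Red y × y ≤B v) ys × (∀ {x} → x ∈ xs → x ≤B v → Any (x ≈W_) ys) × AllPairs (λ y z → ¬ y ≈W z) ys

  -- Which words lie below v is known only under double negation, whereas repetitions are removed by
  -- `≈?`.
  enumeration : ∀ xs → ¬ ¬ ∃ (Enumeration xs)
  enumeration [] = return ([] , [] , (λ ()) , [])
  enumeration (x ∷ xs) = do
      ys , al , cp , pw ← enumeration xs
      d ← em {A = x ≤B v}
      return (extend ys al cp pw d (ListAny.any? (x ≈?_) ys))
    where
    extend : ∀ ys → All (λ y → Red y × y ≤B v) ys → (∀ {x} → x ∈ xs → x ≤B v → Any (x ≈W_) ys) → AllPairs (λ y z → ¬ y ≈W z) ys →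
             Dec (x ≤B v) → Dec (Any (x ≈W_) ys) → ∃ (Enumeration (x ∷ xs))
    extend ys al cp pw (no n) _ = ys , al , (λ { (here refl) le → ⊥-elim (n le) ; (there m) le → cp m le }) , pw
    extend ys al cp pw (yes _) (yes an) = ys , al , (λ { (here refl) _ → an ; (there m) le → cp m le }) , pw
    extend ys al cp pw (yes le) (no na) = nf x ∷ ys , (nf-red x , ≤B-congˡ (nf-sound x) le) ∷ al
      , (λ { (here refl) _ → here (nf-sound x) ; (there m) le → there (cp m le) })
      , ListAll.¬Any⇒All¬ ys (λ an → na (ListAny.map (≈trans (nf-sound x)) an)) ∷ pw

  module _ {ys} (E : Enumeration (sublists (nf v)) ys) where
    element : Fin (length ys) → Word
    element = lookup ys

    element≤ : ∀ i → element i ≤B v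
    element≤ i = proj₂ (ListAll.lookup (proj₁ E) (∈-lookup i))

    index-of : ∀ {u} → u ≤B v → ∃ λ j → u ≈W element j
    index-of {u} le = decidable-stable (Fin.any? λ j → u ≈? element j) do
      w , sub , e ← subword le (≈sym (nf-sound v))
      let an = proj₁ (proj₂ E) (⊆⇒∈-sublists sub) (≤B-congˡ e le)
      return (ListAny.index an , ≈trans e (ListAny.lookup-index an))

    realization : Realization C H (λ i j → element i ≤B element j) (λ i → InWH (element i))
    realization = record
      { a       = element
      ; red     = λ i → proj₁ (ListAll.lookup (proj₁ E) (∈-lookup i))
      ; inj     = λ {i} {j} → lookup-injective ≈sym (proj₂ (proj₂ E)) i j
      ; to      = id
      ; from    = id
      ; index   = λ i le → index-of (≤B-trans le (element≤ i))
      ; ph-to   = id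
      ; ph-from = id
      }

module IntervalIndices {N} {_⊑_ : Fin N → Fin N → Set} {PH : Fin N → Set} (_⊑?_ : ∀ x y → Dec (x ⊑ y)) (PH? : ∀ y → Dec (PH y)) where

  Above : Fin N → Fin N → Fin N → Set
  Above u v z = PH z × u ⊑ z × z ⊑ v × ¬ z ≡ u

  above? : ∀ u v z → Dec (Above u v z)
  above? u v z = PH? z ×-dec (u ⊑? z) ×-dec (z ⊑? v) ×-dec ¬? (z Fin.≟ u)

  -- The index u is left out because `enumerates` puts it at the head of the list, where it
  -- contributes the unknown P u v itself, see `inversion`.
  rest : Fin N → Fin N → List (Fin N)
  rest u v = filter (above? u v) (allFin N)

  rest-all : ∀ u v → All (Above u v) (rest u v)
  rest-all u v = ListAll.all-filter (above? u v) (allFin N)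

  module _ {C H} (Re : Realization C H _⊑_ PH) where
    open Cosets C H
    open Realization Re

    enumerates : ∀ {u v} → PH u → u ⊑ v → EnumIntervalH (a u) (a v) (a u ∷ map a (rest u v))
    enumerates {u} {v} hu uv =
        ((≤B-refl , to uv) , ph-to hu) ∷ ListAll.map⁺ (ListAll.map (λ (hz , uz , zv , _) → (to uz , to zv) , ph-to hz) (rest-all u v))
      , complete
      , ListAll.map⁺ (ListAll.map (λ (_ , _ , _ , ne) e → ne (sym (inj e))) (rest-all u v))
        ∷ AllPairs.map⁺ (AllPairs.map (λ ne e → ne (inj e)) (AllPairs.filter⁺ (above? u v) (allFin⁺ N)))
      where
      complete : ∀ z → InInterval (a u) (a v) z → InWH z → Any (λ z' → z ≈W z') (a u ∷ map a (rest u v))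
      complete z (uz , zv) hz with index v zv
      ... | j , e with j Fin.≟ u
      ...   | yes refl = here e
      ...   | no ne = there (ListAny.map⁺ (ListAny.map (λ { refl → e })
                (∈-filter⁺ (above? u v) (∈-allFin j) (ph-from (InWH-cong e hz) , from (≤B-congʳ e uz) , from (≤B-congˡ e zv) , ne))))

    module _ {R P : Word → Word → Poly} (isP : IsParabolicP R P) (R-one : ∀ u → InWH u → R u u ≈P 1P) where
      open IsParabolicP isP

      tail-sum : Fin N → Fin N → Poly
      tail-sum u v = sumP (map (λ z → R (a u) (a z) *P P (a z) (a v)) (rest u v))

      inversion : ∀ {u v} → PH u → PH v → u ⊑ v → revP (rank v ∸ rank u) (P (a u) (a v)) ≈P P (a u) (a v) +P tail-sum u v
      inversion {u} {v} hu hv uv = ≈P-trans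
        (p-inv (a u) (a v) (rank u) (rank v) _ (ph-to hu) (ph-to hv) (to uv) (red-Len (red u)) (red-Len (red v)) (enumerates hu uv))
        (+P-cong (≈P-trans (*P-cong (R-one (a u) (ph-to hu)) (λ _ → refl)) (1P-*P (P (a u) (a v))))
                 (≡⇒≈P (cong sumP (sym (map-∘ (rest u v))))))

      degree : ∀ {u v} → PH u → PH v → u ⊑ v → ¬ u ≡ v → ∀ n → rank v ∸ rank u ≤ 2 * n → P (a u) (a v) n ≡ 0ℤ
      degree {u} {v} hu hv uv ne = p-deg (a u) (a v) (rank u) (rank v) (ph-to hu) (ph-to hv) (to uv , λ e → ne (inj e)) (red-Len (red u)) (red-Len (red v))

module Comparison {C₁ C₂ H₁ H₂ N} {_⊑_ : Fin N → Fin N → Set} {PH} (_⊑?_ : ∀ x y → Dec (x ⊑ y)) (PH? : ∀ y → Dec (PH y))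
  (Re₁ : Realization C₁ H₁ _⊑_ PH) (Re₂ : Realization C₂ H₂ _⊑_ PH) where
  private
    module A = Realization Re₁
    module B = Realization Re₂
    module O₁ = RealizedOrder _⊑?_ Re₁
    module O₂ = RealizedOrder _⊑?_ Re₂

  rk : Fin N → ℕ
  rk = A.rank

  rk≡ : ∀ i → B.rank i ≡ rk i
  rk≡ i = sym (rank-unique rk B.rank O₁.rank-cases O₂.rank-up O₁.rank-down O₂.rank-down i)

  Γ : FiniteGradedPoset N
  Γ = O₁.graded

  open GradedPoset Γ using (Spec; Calculates; rk-mono; module Calculation)
  private
    module S₁ = RealizedSpec Γ Re₁ (λ _ → refl)
  open IntervalR Γ S₁.M₀ S₁.spec₀

  two-specs : ¬ ¬ (∀ v → 2 ≤ rk v → ∃₂ λ K K' → Spec v K × Spec v K' × ¬ K v ≡ K' v)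
  two-specs = ¬¬-finite λ v → by v (2 ≤? rk v)
    where
    open DihedralBound C₁ using (¬¬-finite)
    by : ∀ v → Dec (2 ≤ rk v) → ¬ ¬ (2 ≤ rk v → ∃₂ λ K K' → Spec v K × Spec v K' × ¬ K v ≡ K' v)
    by v (no n) = return λ l → ⊥-elim (n l)
    by v (yes l) = do
      r ← S₁.two-specs v l
      return λ _ → r

  module _ (ts : ∀ v → 2 ≤ rk v → ∃₂ λ K K' → Spec v K × Spec v K' × ¬ K v ≡ K' v) where

    second : ∀ {v} → 2 ≤ rk v → (m : Fin N) → ∃ λ K → Spec v K × ¬ K v ≡ m
    second {v} l m with ts v l
    ... | K , K' , s , s' , ne with K v Fin.≟ m
    ...   | no n  = K , s , n
    ...   | yes e = K' , s' , λ e' → ne (trans e (sym e'))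

    all-calc : ∀ {v M} → Spec v M → Calculates R v M
    all-calc = Calculation.special-calculates S₁.noK R R-zero O₁.rank-least
      (λ {_} {v} (_ , e) → S₁.M₀ v , S₁.spec₀ e , R-calc e) second

    module Families (x : XParam) {R₁ P₁ : List (CoxeterSystem.S C₁) → List (CoxeterSystem.S C₁) → Poly}
      {R₂ P₂ : List (CoxeterSystem.S C₂) → List (CoxeterSystem.S C₂) → Poly}
      (isR₁ : Coxeter.Parabolic.IsParabolicR C₁ H₁ x R₁) (isP₁ : Coxeter.Parabolic.IsParabolicP C₁ H₁ R₁ P₁)
      (isR₂ : Coxeter.Parabolic.IsParabolicR C₂ H₂ x R₂) (isP₂ : Coxeter.Parabolic.IsParabolicP C₂ H₂ R₂ P₂) where
      private
        module F₁ = ParabolicFormula Γ PH? Re₁ (λ _ → refl) R R-zero R-diag all-calc x R₁ isR₁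
        module F₂ = ParabolicFormula Γ PH? Re₂ rk≡ R R-zero R-diag all-calc x R₂ isR₂
        module IR₁ = Coxeter.Parabolic.IsParabolicR isR₁
        module IR₂ = Coxeter.Parabolic.IsParabolicR isR₂
        module IP₁ = Coxeter.Parabolic.IsParabolicP isP₁
        module IP₂ = Coxeter.Parabolic.IsParabolicP isP₂
      open IntervalIndices _⊑?_ PH?

      R-equal : ∀ {u v} → PH u → PH v → R₁ (A.a u) (A.a v) ≈P R₂ (B.a u) (B.a v)
      R-equal hu hv = ≈P-trans (F₁.formula hu hv) (≈P-sym (F₂.formula hu hv))

      -- Induction on the rank gap: apart from P u v, the inversion formula only involves
      -- R-polynomials and P z v with z above u.
      P-equal : ∀ {v} → PH v → ∀ {u} → PH u → u ⊑ v → P₁ (A.a u) (A.a v) ≈P P₂ (B.a u) (B.a v)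
      P-equal {v} hv {u} = go u (<-wellFounded _)
        where
        go : ∀ u → Acc _<_ (rk v ∸ rk u) → PH u → u ⊑ v → P₁ (A.a u) (A.a v) ≈P P₂ (B.a u) (B.a v)
        go u (acc rs) hu uv with u Fin.≟ v
        ... | yes refl = ≈P-trans (IP₁.p-one (A.a u) (A.ph-to hu)) (≈P-sym (IP₂.p-one (B.a u) (B.ph-to hu)))
        ... | no ne = low-degree-unique (rk v ∸ rk u)
              (inversion Re₁ isP₁ IR₁.r-one hu hv uv)
              (subst (λ d → revP d (P₂ (B.a u) (B.a v)) ≈P P₂ (B.a u) (B.a v) +P tail-sum Re₂ isP₂ IR₂.r-one u v) d≡ (inversion Re₂ isP₂ IR₂.r-one hu hv uv))
              (sumP-cong (ListAll.map (λ {z} → term {z}) (rest-all u v)))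
              (degree Re₁ isP₁ IR₁.r-one hu hv uv ne)
              (λ n l → degree Re₂ isP₂ IR₂.r-one hu hv uv ne n (≤-trans (≤-reflexive d≡) l))
          where
          d≡ : B.rank v ∸ B.rank u ≡ rk v ∸ rk u
          d≡ = cong₂ _∸_ (rk≡ v) (rk≡ u)
          term : ∀ {z} → Above u v z → R₁ (A.a u) (A.a z) *P P₁ (A.a z) (A.a v) ≈P R₂ (B.a u) (B.a z) *P P₂ (B.a z) (B.a v)
          term {z} (hz , uz , zv , zu) = *P-cong (R-equal hu hz) (go z (rs (∸-monoʳ-< lt (rk-mono zv))) hz zv)
            where
            lt : rk u < rk z
            lt with O₁.rank-cases uz
            ... | inj₁ e = ⊥-elim (zu (sym e))
            ... | inj₂ l = l

theorem1p3 : (C₁ C₂ : CoxeterSystem)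
    (H₁ : CoxeterSystem.S C₁ → Set) (H₂ : CoxeterSystem.S C₂ → Set)
    (v₁ : List (CoxeterSystem.S C₁)) (v₂ : List (CoxeterSystem.S C₂)) →
    Coxeter.Parabolic.InWH C₁ H₁ v₁ → Coxeter.Parabolic.InWH C₂ H₂ v₂ →
    IntervalIso C₁ C₂ H₁ H₂ v₁ v₂ →
    (x : XParam)
    (R₁ P₁ : List (CoxeterSystem.S C₁) → List (CoxeterSystem.S C₁) → Poly)
    (R₂ P₂ : List (CoxeterSystem.S C₂) → List (CoxeterSystem.S C₂) → Poly) →
    Coxeter.Parabolic.IsParabolicR C₁ H₁ x R₁ →
    Coxeter.Parabolic.IsParabolicP C₁ H₁ R₁ P₁ →
    Coxeter.Parabolic.IsParabolicR C₂ H₂ x R₂ →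
    Coxeter.Parabolic.IsParabolicP C₂ H₂ R₂ P₂ →
    (P₁ [] v₁ ≈P P₂ [] v₂) × (R₁ [] v₁ ≈P R₂ [] v₂)
theorem1p3 C₁ C₂ H₁ H₂ v₁ v₂ wv₁ wv₂ iso x R₁ P₁ R₂ P₂ isR₁ isP₁ isR₂ isP₂ =
    (λ n → stableℤ (equal >>= λ (p , _) → return (p n))) , (λ n → stableℤ (equal >>= λ (_ , r) → return (r n)))
  where
  module W₁ = Cosets C₁ H₁
  module W₂ = Cosets C₂ H₂
  open IntervalIso iso

  module Indexed {ys} (E : Enumerate.Enumeration C₁ H₁ v₁ (sublists (W₁.nf v₁)) ys) where
    N : ℕ
    N = length ys
    open Enumerate C₁ H₁ v₁ using (element; element≤; index-of; realization)

    a : Fin N → W₁.Word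
    a = element E

    Re₁ : Realization C₁ H₁ (λ i j → a i W₁.≤B a j) (λ i → W₁.InWH (a i))
    Re₁ = realization E

    I : ∀ i → W₁.InInterval W₁.e v₁ (a i)
    I i = W₁.e≤B (a i) , element≤ E i

    b : Fin N → W₂.Word
    b i = W₂.nf (f (a i))

    b≈ : ∀ i → f (a i) W₂.≈W b i
    b≈ i = W₂.nf-sound (f (a i))

    preimage : ∀ {u} → u W₂.≤B v₂ → ∃ λ j → u W₂.≈W b j
    preimage {u} le =
      let a₀ , i₀ , e = f-surj u (W₂.e≤B u , le)
          j , e' = index-of E (proj₂ i₀)
      in j , W₂.≈trans (W₂.≈sym e) (W₂.≈trans (f-resp a₀ (a j) e') (b≈ j))

    Re₂ : Realization C₂ H₂ (λ i j → a i W₁.≤B a j) (λ i → W₁.InWH (a i))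
    Re₂ = record
      { a       = b
      ; red     = λ i → W₂.nf-red (f (a i))
      ; inj     = λ {i} {j} e → Realization.inj Re₁ (f-inj (a i) (a j) (I i) (I j) (W₂.≈trans (b≈ i) (W₂.≈trans e (W₂.≈sym (b≈ j)))))
      ; to      = λ {i} {j} le → W₂.≤B-congˡ (b≈ i) (W₂.≤B-congʳ (b≈ j) (f-mono (a i) (a j) (I i) (I j) le))
      ; from    = λ {i} {j} le → f-refl (a i) (a j) (I i) (I j) (W₂.≤B-congˡ (W₂.≈sym (b≈ i)) (W₂.≤B-congʳ (W₂.≈sym (b≈ j)) le))
      ; index   = λ i le → preimage (W₂.≤B-trans le (W₂.≤B-congˡ (b≈ i) (proj₂ (f-into (a i) (I i)))))
      ; ph-to   = λ {i} h → W₂.InWH-cong (b≈ i) (f-para (a i) (I i) h)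
      ; ph-from = λ {i} h → f-para⁻¹ (a i) (I i) (W₂.InWH-cong (W₂.≈sym (b≈ i)) h)
      }

    top : Fin N
    top = proj₁ (index-of E W₁.≤B-refl)
    top₁ : v₁ W₁.≈W a top
    top₁ = proj₂ (index-of E W₁.≤B-refl)
    top₂ : v₂ W₂.≈W b top
    -- The preimage of v₂ lies below the top index, so v₂ lies below the image of the top, and the
    -- other relation holds because f maps into the interval.
    top₂ = let j , e = preimage W₂.≤B-refl
               le : b top W₂.≤B b j
               le = W₂.≤B-congˡ (b≈ top) (W₂.≤B-congʳ e (proj₂ (f-into (a top) (I top))))
               le' : a j W₁.≤B a top
               le' = W₁.≤B-congʳ top₁ (proj₂ (I j))
           in W₂.≈trans e (antisym le (Realization.to Re₂ le'))
      where
      antisym : ∀ {x y} → x W₂.≤B y → y W₂.≤B x → y W₂.≈W x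
      antisym p q with W₂.≤B-cases q
      ... | inj₁ h = h
      ... | inj₂ s with W₂.≤B-cases p
      ...   | inj₁ h  = W₂.≈sym h
      ...   | inj₂ s' = ⊥-elim (W₂.Shorter-asym s s')

    bot : Fin N
    bot = proj₁ (index-of E (W₁.e≤B v₁))
    bot₁ : [] W₁.≈W a bot
    bot₁ = proj₂ (index-of E (W₁.e≤B v₁))
    h-bot : W₁.InWH (a bot)
    h-bot = W₁.InWH-cong bot₁ λ { r _ (_ , _ , lt) → n≮0 (lt [] W₁.≈refl) }
    h-top : W₁.InWH (a top)
    h-top = W₁.InWH-cong top₁ wv₁

    module _ (le? : ∀ i j → Dec (a i W₁.≤B a j)) (h? : ∀ i → Dec (W₁.InWH (a i))) where
      open Comparison le? h? Re₁ Re₂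

      bot₂ : [] W₂.≈W b bot
      -- The bottom index has rank 0 in the first system, hence by `rk≡` also in the second, where
      -- its reduced word is then empty.
      bot₂ = W₂.≡⇒≈ (sym (empty (trans (rk≡ bot) (n≤0⇒n≡0 (Realization.red Re₁ bot [] bot₁)))))
        where
        empty : ∀ {w : W₂.Word} → length w ≡ 0 → w ≡ []
        empty {[]} _ = refl

      conclude : ¬ ¬ (P₁ [] v₁ ≈P P₂ [] v₂ × R₁ [] v₁ ≈P R₂ [] v₂)
      conclude = do
        ts ← two-specs
        let open Families ts x isR₁ isP₁ isR₂ isP₂
        return ( ≈P-trans (Coxeter.Parabolic.IsParabolicP.respects isP₁ _ _ _ _ bot₁ top₁) (≈P-trans (P-equal h-top h-bot (W₁.≤B-congʳ top₁ (element≤ E bot)))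
                   (≈P-sym (Coxeter.Parabolic.IsParabolicP.respects isP₂ _ _ _ _ bot₂ top₂)))
               , ≈P-trans (Coxeter.Parabolic.IsParabolicR.respects isR₁ _ _ _ _ bot₁ top₁) (≈P-trans (R-equal h-bot h-top)
                   (≈P-sym (Coxeter.Parabolic.IsParabolicR.respects isR₂ _ _ _ _ bot₂ top₂))))

  equal : ¬ ¬ (P₁ [] v₁ ≈P P₂ [] v₂ × R₁ [] v₁ ≈P R₂ [] v₂)
  equal = do
    ys , E ← Enumerate.enumeration C₁ H₁ v₁ (sublists (W₁.nf v₁))
    le? ← W₁.¬¬-finite λ i → W₁.¬¬-finite λ j → em
    h? ← W₁.¬¬-finite λ i → em
    Indexed.conclude E le? h?
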